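{- Let $d\ge 1$, and let $T$, $K$, $X_1,\dots,X_{2d-1}$ and $B_{2d}$ be as in the context. Define coefficients $\alpha_{\mathbf n}$, $\mathbf n\in\mathbb{N}_0^{2d-1}$, with unspecified values $\alpha_{\mathbf e_1},\dots,\alpha_{\mathbf e_{2d-1}}$ (regarded as indeterminates), as follows: $\alpha_{\boldsymbol 0}=0$; for $\mathbf n=n_\ell\mathbf e_\ell$ with $n_\ell\ge1$, $1\le\ell\le 2d-1$, $$\alpha_{\mathbf n}=\frac{\alpha_{\mathbf e_\ell}^{n_\ell}X_\ell^{2(n_\ell-1)}(1-X_\ell^{n_\ell(2d-1)})}{(1-X_\ell^{2d-1})(1-X_\ell^2)^{n_\ell-1}(1-X_\ell^{2d+1})^{n_\ell-1}};$$ and for all other $\mathbf n$ (at least two nonzero coordinates) recursively by $$\alpha_{\mathbf n}\Big(-\frac{1}{zT^{2d-1}}+\sum_{\ell=1}^{d}\big(\mathbf X^{(2\ell-1)\mathbf n}+\mathbf X^{(-2\ell+1)\mathbf n}\big)\Big)=\sum_{\ell=2}^{2d}(-1)^\ell\sum_{\mathbf g_1+\dots+\mathbf g_\ell=\mathbf n}\Big(\prod_{k=1}^{\ell}\alpha_{\mathbf g_k}\Big)\sum_{\{b_1<\dots<b_\ell\}\subseteq B_{2d}}\ \prod_{k=1}^{\ell}\mathbf X^{b_k\mathbf g_k},$$ where the middle sum is over ordered tuples of vectors $\mathbf g_k\in\mathbb{N}_0^{2d-1}\setminus\{\boldsymbol 0\}$. For $j\in\mathbb{Z}$ put $\rho_j=\sum_{\mathbf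 n\in\mathbb{N}_0^{2d-1}}\alpha_{\mathbf n}\mathbf X^{j\mathbf n}$. Then the formal power series $T_j=T(1-\rho_j)$ satisfies $$T_j=1+z\prod_{\ell=1}^{d}\big(T_{j+2\ell-1}\,T_{j-2\ell+1}\big),\qquad j\in\mathbb{Z}.$$
   Context: $T=T(z)$ is the formal power series with $T(0)=1$ and $T=1+zT^{2d}$ (generating function of $2d$-ary trees). $K=\bigcup_{m\ge1}\mathbb{C}((z^{1/m}))$ is the field of Puiseux series in $z$. $X_1,\dots,X_{2d-1}\in K$ are the $2d-1$ small solutions (those of positive order in $z$, i.e. tending to $0$ as $z\to0$) of the characteristic equation $$1=zT^{2d-1}\sum_{\ell=1}^{d}\big(X^{2\ell-1}+X^{ -2\ell+1}\big).$$ $B_{2d}=\{ -(2d-1),-(2d-3),\dots,2d-3,2d-1\}$ (odd integers). Notation: $\mathbb{N}_0=\{0,1,2,\dots\}$; $\mathbf e_\ell$ is the $\ell$-th unit vector of $\mathbb{N}_0^{2d-1}$; for $\mathbf n=(n_1,\dots,n_{2d-1})$ and $m\in\mathbb{Z}$, $\mathbf X^{m\mathbf n}=X_1^{mn_1}\cdots X_{2d-1}^{mn_{2d-1}}$. Each $\alpha_{\mathbf n}$ is an element of $K$ times the monomial $\prod_\ell\alpha_{\mathbf e_\ell}^{n_\ell}$, and $\rho_j,T_j$ are regarded as formal power series in the indeterminates $\alpha_{\mathbf e_1},\dots,\alpha_{\mathbf e_{2d-1}}$ with coefficients in $K$. -}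

module Defs where

open import Level using (Level; 0ℓ; _⊔_)
open import Algebra.Bundles using (AbelianGroup; CommutativeRing)
import Algebra.Construct.DirectProduct as DirectProduct
import Algebra.Construct.Pointwise as Pointwise
import Algebra.Properties.CommutativeMonoid.Sum as FiniteSum
import Algebra.Properties.CommutativeSemiring.Exp as Exp
import Algebra.Properties.Ring as RingProperties
import Algebra.Solver.Ring.NaturalCoefficients.Default as SemiringSolver
open import Data.Bool.Base using (if_then_else_)
open import Data.Empty using (⊥-elim)
open import Data.Fin.Base using (Fin; zero; suc; toℕ)
open import Data.Integer.Base as ℤ using (ℤ; +_; -[1+_])
open import Data.List.Base as List using (List; []; _∷_; _++_)
open import Data.Nat.Base as ℕ using (ℕ; zero; suc; _∸_; NonZero)
open import Data.Nat.Divisibility using (_∣_; _∣?_; divides; ∣⇒≤; ∣m+n∣m⇒∣n; ∣-refl)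
import Data.Nat.Properties as ℕₚ
open import Data.Nat.Tactic.RingSolver using (solve-∀)
open import Data.Product.Base using (∃; ∃₂; _×_; _,_; proj₂)
open import Data.Rational.Base as ℚ using (ℚ; 0ℚ; 1ℚ; ½)
import Data.Rational.Properties as ℚₚ
import Data.Rational.Solver as ℚSolver
open import Data.Sum.Base using (inj₁; inj₂)
open import Data.Vec.Base as Vec using (Vec; []; _∷_; lookup; replicate; _[_]≔_)
open import Data.Vec.Properties using (≡-dec)
open import Relation.Nullary using (¬_; Dec; yes; no; does)
open import Relation.Binary.PropositionalEquality as ≡ using (_≡_; _≢_)
import Relation.Binary.Reasoning.Setoid as SetoidReasoning

private
  variable
    c ℓ : Level

  module BuildRing (G : AbelianGroup c ℓ) where
    open AbelianGroup G renaming (_∙_ to _+_)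

    commutativeRing :
      (_*_ : Carrier → Carrier → Carrier) (1# : Carrier) →
      (∀ {x x′ y y′} → x ≈ x′ → y ≈ y′ → (x * y) ≈ (x′ * y′)) →
      (∀ x y z → ((x * y) * z) ≈ (x * (y * z))) →
      (∀ x y → (x * y) ≈ (y * x)) →
      (∀ x → (1# * x) ≈ x) →
      (∀ x y z → ((y + z) * x) ≈ ((y * x) + (z * x))) →
      CommutativeRing c ℓ
    commutativeRing _*_ 1# *-cong *-assoc *-comm *-identityˡ distribʳ = record
      { Carrier = Carrier ; _≈_ = _≈_ ; _+_ = _+_ ; _*_ = _*_
      ; -_ = _⁻¹ ; 0# = ε ; 1# = 1#
      ; isCommutativeRing = record
        { isRing = record
          { +-isAbelianGroup = isAbelianGroup
          ; *-cong = *-cong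
          ; *-assoc = *-assoc
          ; *-identity = *-identityˡ , λ x → trans (*-comm x 1#) (*-identityˡ x)
          ; distrib = (λ x y z → trans (*-comm x (y + z))
                        (trans (distribʳ x y z) (∙-cong (*-comm y x) (*-comm z x))))
                    , distribʳ
          }
        ; *-comm = *-comm
        }
      }

------------------------------------------------------------------------
-- ℝ: Cauchy sequences of rationals modulo null sequences

module CauchyReals where

  open import Data.Rational.Base using (_+_; _*_; -_; _-_; _<_; _≤_; ∣_∣)

  record ℝ : Set where
    field
      seq    : ℕ → ℚ
      cauchy : ∀ ε → 0ℚ < ε →
               ∃ λ N → ∀ m n → N ℕ.≤ m → N ℕ.≤ n → ∣ seq m - seq n ∣ < ε

  open ℝ public

  infix 4 _≈_

  _≈_ : ℝ → ℝ → Set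
  x ≈ y = ∀ ε → 0ℚ < ε → ∃ λ N → ∀ n → N ℕ.≤ n → ∣ seq x n - seq y n ∣ < ε

  private
    half-pos : ∀ {ε} → 0ℚ < ε → 0ℚ < ε * ½
    half-pos {ε} p = ≡.subst (_< ε * ½) (ℚₚ.*-zeroˡ ½) (ℚₚ.*-monoˡ-<-pos ½ p)

    halves : ∀ ε → ε * ½ + ε * ½ ≡ ε
    halves ε = ≡.trans (≡.sym (ℚₚ.*-distribˡ-+ ε ½ ½)) (ℚₚ.*-identityʳ ε)

    triangle : ∀ {p q r ε} → r ≡ p + q → ∣ p ∣ < ε * ½ → ∣ q ∣ < ε * ½ → ∣ r ∣ < ε
    triangle {p} {q} {r} {ε} ≡.refl p< q< = begin-strict
      ∣ p + q ∣        ≤⟨ ℚₚ.∣p+q∣≤∣p∣+∣q∣ p q ⟩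
      ∣ p ∣ + ∣ q ∣    <⟨ ℚₚ.+-mono-< p< q< ⟩
      ε * ½ + ε * ½    ≡⟨ halves ε ⟩
      ε                ∎
      where open ℚₚ.≤-Reasoning

    ≡⇒close : ∀ {p q ε} → p ≡ q → 0ℚ < ε → ∣ p - q ∣ < ε
    ≡⇒close {p} ≡.refl ε>0 = ≡.subst (_< _) (≡.sym (≡.cong ∣_∣ (ℚₚ.+-inverseʳ p))) ε>0

    close-sym : ∀ {p q ε} → ∣ p - q ∣ < ε → ∣ q - p ∣ < ε
    close-sym {p} {q} = ≡.subst (_< _) (≡.trans (≡.sym (ℚₚ.∣-p∣≡∣p∣ (p - q)))
                          (≡.cong ∣_∣ (solve 2 (λ a b → :- (a :- b) := b :- a) ≡.refl p q)))
      where open ℚSolver.+-*-Solver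

    -‿close : ∀ {p q ε} → ∣ p - q ∣ < ε → ∣ - p - - q ∣ < ε
    -‿close {p} {q} h = ≡.subst (_< _) (≡.cong ∣_∣
        (solve 2 (λ a b → b :- a := :- a :- :- b) ≡.refl p q)) (close-sym {p} {q} h)
      where open ℚSolver.+-*-Solver

    +-close : ∀ {p p′ q q′ ε} → ∣ p - p′ ∣ < ε * ½ → ∣ q - q′ ∣ < ε * ½ →
              ∣ (p + q) - (p′ + q′) ∣ < ε
    +-close {p} {p′} {q} {q′} = triangle
        (solve 4 (λ a a′ b b′ → (a :+ b) :- (a′ :+ b′) := (a :- a′) :+ (b :- b′))
               ≡.refl p p′ q q′)
      where open ℚSolver.+-*-Solver

    close-trans : ∀ {p q r ε} → ∣ p - q ∣ < ε * ½ → ∣ q - r ∣ < ε * ½ → ∣ p - r ∣ < ε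
    close-trans {p} {q} {r} = triangle
        (solve 3 (λ a b c → a :- c := (a :- b) :+ (b :- c)) ≡.refl p q r)
      where open ℚSolver.+-*-Solver

    Small : ℚ → ℚ → Set
    Small A ε = ∃ λ δ → 0ℚ < δ × (∀ {p q} → ∣ p ∣ < A → ∣ q ∣ < δ → ∣ p * q ∣ < ε)

    *-small : ∀ {A ε} → 0ℚ < A → 0ℚ < ε → Small A ε
    *-small {A} {ε} A>0 ε>0 = δ , δ>0 , bound
      where
      instance
        A⁺ : ℚ.Positive A
        A⁺ = ℚ.positive A>0
        A≢0 : ℚ.NonZero A
        A≢0 = ℚₚ.pos⇒nonZero A
        1/A⁺ : ℚ.Positive (ℚ.1/ A)
        1/A⁺ = ℚₚ.1/pos⇒pos A
      δ = ε * ℚ.1/ A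
      δ>0 : 0ℚ < δ
      δ>0 = ≡.subst (_< δ) (ℚₚ.*-zeroˡ (ℚ.1/ A)) (ℚₚ.*-monoˡ-<-pos (ℚ.1/ A) ε>0)
      bound : ∀ {p q} → ∣ p ∣ < A → ∣ q ∣ < δ → ∣ p * q ∣ < ε
      bound {p} {q} p< q< = begin-strict
        ∣ p * q ∣          ≡⟨ ℚₚ.∣p*q∣≡∣p∣*∣q∣ p q ⟩
        ∣ p ∣ * ∣ q ∣      ≤⟨ ℚₚ.*-monoʳ-≤-nonNeg ∣ q ∣ {{ℚₚ.∣-∣-nonNeg q}} (ℚₚ.<⇒≤ p<) ⟩
        A * ∣ q ∣          <⟨ ℚₚ.*-monoʳ-<-pos A q< ⟩
        A * (ε * ℚ.1/ A)   ≡⟨ solve 3 (λ a e i → a :* (e :* i) := e :* (a :* i)) ≡.refl A ε (ℚ.1/ A) ⟩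
        ε * (A * ℚ.1/ A)   ≡⟨ ≡.cong (ε *_) (ℚₚ.*-inverseʳ A) ⟩
        ε * 1ℚ             ≡⟨ ℚₚ.*-identityʳ ε ⟩
        ε                  ∎
        where open ℚₚ.≤-Reasoning
              open ℚSolver.+-*-Solver

    *-close : ∀ {A B ε} → 0ℚ < A → 0ℚ < B → 0ℚ < ε →
      ∃₂ λ δ η → 0ℚ < δ × 0ℚ < η ×
        (∀ {p p′ q q′} → ∣ p ∣ < A → ∣ q′ ∣ < B →
          ∣ p - p′ ∣ < η → ∣ q - q′ ∣ < δ → ∣ p * q - p′ * q′ ∣ < ε)
    *-close {A} {B} {ε} A>0 B>0 ε>0 =
      combine (*-small A>0 (half-pos ε>0)) (*-small B>0 (half-pos ε>0))
      where
      *-distrib-- : ∀ a b c → a * (b - c) ≡ a * b - a * c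
      *-distrib-- a b c = ≡.trans (ℚₚ.*-distribˡ-+ a b (- c))
                            (≡.cong (λ z → a * b + z) (≡.sym (ℚₚ.neg-distribʳ-* a c)))

      split : ∀ a a′ b b′ → a * b - a′ * b′ ≡ b′ * (a - a′) + a * (b - b′)
      split a a′ b b′ = begin
        a * b - a′ * b′                        ≡⟨ solve 3 (λ x y z → x :- z := (y :- z) :+ (x :- y))
                                                    ≡.refl (a * b) (b′ * a) (a′ * b′) ⟩
        (b′ * a - a′ * b′) + (a * b - b′ * a)  ≡⟨ ≡.cong₂ (λ y z → (b′ * a - y) + (a * b - z))
                                                    (ℚₚ.*-comm a′ b′) (ℚₚ.*-comm b′ a) ⟩
        (b′ * a - b′ * a′) + (a * b - a * b′)  ≡⟨ ≡.cong₂ _+_ (*-distrib-- b′ a a′) (*-distrib-- a b b′) ⟨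
        b′ * (a - a′) + a * (b - b′)           ∎
        where open ≡.≡-Reasoning
              open ℚSolver.+-*-Solver

      combine : Small A (ε * ½) → Small B (ε * ½) → _
      combine (δ , δ>0 , small₁) (η , η>0 , small₂) =
        δ , η , δ>0 , η>0 , λ {p} {p′} {q} {q′} p< q′< pp′ qq′ →
          triangle {q′ * (p - p′)} {p * (q - q′)} {p * q - p′ * q′} {ε} (split p p′ q q′)
                   (small₂ {q′} {p - p′} q′< pp′) (small₁ {p} {q - q′} p< qq′)

    bounded : ∀ x → ∃₂ λ A N → 0ℚ < A × (∀ n → N ℕ.≤ n → ∣ seq x n ∣ < A)
    bounded x with N , close ← cauchy x 1ℚ (ℚₚ.positive⁻¹ 1ℚ)
      = 1ℚ + ∣ seq x N ∣ , N ,
        ℚₚ.+-mono-<-≤ (ℚₚ.positive⁻¹ 1ℚ) (ℚₚ.0≤∣p∣ (seq x N)) ,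
        λ n N≤n → begin-strict
          ∣ seq x n ∣
            ≡⟨ ≡.cong ∣_∣ (solve 2 (λ a b → a := (a :- b) :+ b) ≡.refl (seq x n) (seq x N)) ⟩
          ∣ (seq x n - seq x N) + seq x N ∣
            ≤⟨ ℚₚ.∣p+q∣≤∣p∣+∣q∣ (seq x n - seq x N) (seq x N) ⟩
          ∣ seq x n - seq x N ∣ + ∣ seq x N ∣
            <⟨ ℚₚ.+-monoˡ-< ∣ seq x N ∣ (close n N N≤n ℕₚ.≤-refl) ⟩
          1ℚ + ∣ seq x N ∣ ∎
      where open ℚₚ.≤-Reasoning
            open ℚSolver.+-*-Solver

    ⊔ˡ : ∀ {a b c} → a ℕ.⊔ b ℕ.≤ c → a ℕ.≤ c
    ⊔ˡ {a} {b} = ℕₚ.≤-trans (ℕₚ.m≤m⊔n a b)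

    ⊔ʳ : ∀ {a b c} → a ℕ.⊔ b ℕ.≤ c → b ℕ.≤ c
    ⊔ʳ {a} {b} = ℕₚ.≤-trans (ℕₚ.m≤n⊔m a b)

  fromℚ : ℚ → ℝ
  fromℚ q .seq _ = q
  fromℚ q .cauchy ε ε>0 = 0 , λ _ _ _ _ → ≡⇒close {q} ≡.refl ε>0

  infixl 6 _+ᴿ_
  infixl 7 _*ᴿ_

  _+ᴿ_ _*ᴿ_ : ℝ → ℝ → ℝ
  -ᴿ_ : ℝ → ℝ

  (x +ᴿ y) .seq n = seq x n + seq y n
  (x +ᴿ y) .cauchy ε ε>0
    with M , close-x ← cauchy x (ε * ½) (half-pos ε>0)
       | N , close-y ← cauchy y (ε * ½) (half-pos ε>0)
    = M ℕ.⊔ N , λ m n ≤m ≤n →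
        +-close {seq x m} {seq x n} (close-x m n (⊔ˡ ≤m) (⊔ˡ ≤n))
                                    (close-y m n (⊔ʳ {M} ≤m) (⊔ʳ {M} ≤n))

  (-ᴿ x) .seq n = - seq x n
  (-ᴿ x) .cauchy ε ε>0 with N , close ← cauchy x ε ε>0
    = N , λ m n ≤m ≤n → -‿close {seq x m} (close m n ≤m ≤n)

  (x *ᴿ y) .seq n = seq x n * seq y n
  (x *ᴿ y) .cauchy ε ε>0
    = let A , K , A>0 , x<A = bounded x
          B , L , B>0 , y<B = bounded y
          δ , η , δ>0 , η>0 , close = *-close A>0 B>0 ε>0
          M , close-x = cauchy x η η>0
          N , close-y = cauchy y δ δ>0
      in (K ℕ.⊔ L) ℕ.⊔ (M ℕ.⊔ N) , λ m n ≤m ≤n →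
        close {seq x m} {seq x n} {seq y m} {seq y n}
              (x<A m (⊔ˡ (⊔ˡ {K ℕ.⊔ L} ≤m))) (y<B n (⊔ʳ {K} (⊔ˡ {K ℕ.⊔ L} ≤n)))
              (close-x m n (⊔ˡ (⊔ʳ {K ℕ.⊔ L} ≤m)) (⊔ˡ (⊔ʳ {K ℕ.⊔ L} ≤n)))
              (close-y m n (⊔ʳ {M} (⊔ʳ {K ℕ.⊔ L} ≤m)) (⊔ʳ {M} (⊔ʳ {K ℕ.⊔ L} ≤n)))

  private
    pointwise : ∀ {x y} → (∀ n → seq x n ≡ seq y n) → x ≈ y
    pointwise {x} x≡y ε ε>0 = 0 , λ n _ → ≡⇒close {seq x n} (x≡y n) ε>0

    ≈-sym : ∀ {x y} → x ≈ y → y ≈ x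
    ≈-sym {x} x≈y ε ε>0 with N , close ← x≈y ε ε>0
      = N , λ n N≤n → close-sym {seq x n} (close n N≤n)

    ≈-trans : ∀ {x y z} → x ≈ y → y ≈ z → x ≈ z
    ≈-trans {x} {y} x≈y y≈z ε ε>0
      with M , close₁ ← x≈y (ε * ½) (half-pos ε>0)
         | N , close₂ ← y≈z (ε * ½) (half-pos ε>0)
      = M ℕ.⊔ N , λ n ≤n →
          close-trans {seq x n} {seq y n} (close₁ n (⊔ˡ ≤n)) (close₂ n (⊔ʳ {M} ≤n))

    +-cong : ∀ {x x′ y y′} → x ≈ x′ → y ≈ y′ → x +ᴿ y ≈ x′ +ᴿ y′
    +-cong {x} {x′} x≈x′ y≈y′ ε ε>0
      with M , close₁ ← x≈x′ (ε * ½) (half-pos ε>0)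
         | N , close₂ ← y≈y′ (ε * ½) (half-pos ε>0)
      = M ℕ.⊔ N , λ n ≤n →
          +-close {seq x n} {seq x′ n} (close₁ n (⊔ˡ ≤n)) (close₂ n (⊔ʳ {M} ≤n))

    -‿cong : ∀ {x y} → x ≈ y → -ᴿ x ≈ -ᴿ y
    -‿cong {x} x≈y ε ε>0 with N , close ← x≈y ε ε>0
      = N , λ n N≤n → -‿close {seq x n} (close n N≤n)

    *-cong : ∀ {x x′ y y′} → x ≈ x′ → y ≈ y′ → x *ᴿ y ≈ x′ *ᴿ y′
    *-cong {x} {x′} {y} {y′} x≈x′ y≈y′ ε ε>0
      = let A , K , A>0 , x<A = bounded x
            B , L , B>0 , y<B = bounded y′
            δ , η , δ>0 , η>0 , close = *-close A>0 B>0 ε>0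
            M , close-x = x≈x′ η η>0
            N , close-y = y≈y′ δ δ>0
        in (K ℕ.⊔ L) ℕ.⊔ (M ℕ.⊔ N) , λ n ≤n →
          close {seq x n} {seq x′ n} {seq y n} {seq y′ n}
                (x<A n (⊔ˡ (⊔ˡ {K ℕ.⊔ L} ≤n))) (y<B n (⊔ʳ {K} (⊔ˡ {K ℕ.⊔ L} ≤n)))
                (close-x n (⊔ˡ (⊔ʳ {K ℕ.⊔ L} ≤n)))
                (close-y n (⊔ʳ {M} (⊔ʳ {K ℕ.⊔ L} ≤n)))

  commutativeRing : CommutativeRing 0ℓ 0ℓ
  commutativeRing = record
    { Carrier = ℝ ; _≈_ = _≈_ ; _+_ = _+ᴿ_ ; _*_ = _*ᴿ_ ; -_ = -ᴿ_
    ; 0# = fromℚ 0ℚ ; 1# = fromℚ 1ℚ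
    ; isCommutativeRing = record
      { isRing = record
        { +-isAbelianGroup = record
          { isGroup = record
            { isMonoid = record
              { isSemigroup = record
                { isMagma = record
                  { isEquivalence = record
                    { refl  = λ {x} → pointwise {x} {x} λ _ → ≡.refl
                    ; sym   = λ {x} {y} → ≈-sym {x} {y}
                    ; trans = λ {x} {y} {z} → ≈-trans {x} {y} {z}
                    }
                  ; ∙-cong = λ {x} {x′} {y} {y′} → +-cong {x} {x′} {y} {y′}
                  }
                ; assoc = λ x y z → pointwise {(x +ᴿ y) +ᴿ z} {x +ᴿ (y +ᴿ z)}
                            λ n → ℚₚ.+-assoc (seq x n) (seq y n) (seq z n)
                }
              ; identity = (λ x → pointwise {fromℚ 0ℚ +ᴿ x} {x} λ n → ℚₚ.+-identityˡ (seq x n))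
                         , (λ x → pointwise {x +ᴿ fromℚ 0ℚ} {x} λ n → ℚₚ.+-identityʳ (seq x n))
              }
            ; inverse = (λ x → pointwise {(-ᴿ x) +ᴿ x} {fromℚ 0ℚ} λ n → ℚₚ.+-inverseˡ (seq x n))
                      , (λ x → pointwise {x +ᴿ (-ᴿ x)} {fromℚ 0ℚ} λ n → ℚₚ.+-inverseʳ (seq x n))
            ; ⁻¹-cong = λ {x} {y} → -‿cong {x} {y}
            }
          ; comm = λ x y → pointwise {x +ᴿ y} {y +ᴿ x} λ n → ℚₚ.+-comm (seq x n) (seq y n)
          }
        ; *-cong = λ {x} {x′} {y} {y′} → *-cong {x} {x′} {y} {y′}
        ; *-assoc = λ x y z → pointwise {(x *ᴿ y) *ᴿ z} {x *ᴿ (y *ᴿ z)}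
                      λ n → ℚₚ.*-assoc (seq x n) (seq y n) (seq z n)
        ; *-identity = (λ x → pointwise {fromℚ 1ℚ *ᴿ x} {x} λ n → ℚₚ.*-identityˡ (seq x n))
                     , (λ x → pointwise {x *ᴿ fromℚ 1ℚ} {x} λ n → ℚₚ.*-identityʳ (seq x n))
        ; distrib = (λ x y z → pointwise {x *ᴿ (y +ᴿ z)} {x *ᴿ y +ᴿ x *ᴿ z}
                      λ n → ℚₚ.*-distribˡ-+ (seq x n) (seq y n) (seq z n))
                  , (λ x y z → pointwise {(y +ᴿ z) *ᴿ x} {y *ᴿ x +ᴿ z *ᴿ x}
                      λ n → ℚₚ.*-distribʳ-+ (seq x n) (seq y n) (seq z n))
        }
      ; *-comm = λ x y → pointwise {x *ᴿ y} {y *ᴿ x} λ n → ℚₚ.*-comm (seq x n) (seq y n)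
      }
    }

------------------------------------------------------------------------
-- R[i], with (a , b) standing for a + b i

module AdjoinI (R : CommutativeRing c ℓ) where
  open CommutativeRing R
  open RingProperties ring using (-1*x≈-x)
  private module S = SemiringSolver commutativeSemiring

  _*ᶜ_ : Carrier × Carrier → Carrier × Carrier → Carrier × Carrier
  (a , b) *ᶜ (c , d) = a * c - b * d , a * d + b * c

  private
    additive : AbelianGroup _ _
    additive = DirectProduct.abelianGroup +-abelianGroup +-abelianGroup

    -- The semiring solver does not know negation, so -x is written as m x
    -- with m = -1.
    m : Carrier
    m = - 1#

    re : ∀ {a b c d} → a * c - b * d ≈ a * c + m * (b * d)
    re = +-congˡ (sym (-1*x≈-x _))

  commutativeRing : CommutativeRing c ℓ
  commutativeRing = BuildRing.commutativeRing additive _*ᶜ_ (1# , 0#)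
    (λ (a≈ , b≈) (c≈ , d≈) →
      +-cong (*-cong a≈ c≈) (-‿cong (*-cong b≈ d≈)) , +-cong (*-cong a≈ d≈) (*-cong b≈ c≈))
    (λ (a , b) (c , d) (e , f) →
        (begin
          (a * c - b * d) * e - (a * d + b * c) * f
            ≈⟨ trans re (+-congʳ (*-congʳ re)) ⟩
          (a * c + m * (b * d)) * e + m * ((a * d + b * c) * f)
            ≈⟨ solve 7 (λ m a b c d e f →
                 (a :* c :+ m :* (b :* d)) :* e :+ m :* ((a :* d :+ b :* c) :* f)
                 := a :* (c :* e :+ m :* (d :* f)) :+ m :* (b :* (c :* f :+ d :* e)))
                 refl m a b c d e f ⟩
          a * (c * e + m * (d * f)) + m * (b * (c * f + d * e))
            ≈⟨ trans re (+-congʳ (*-congˡ re)) ⟨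
          a * (c * e - d * f) - b * (c * f + d * e) ∎)
      , (begin
          (a * c - b * d) * f + (a * d + b * c) * e
            ≈⟨ +-congʳ (*-congʳ re) ⟩
          (a * c + m * (b * d)) * f + (a * d + b * c) * e
            ≈⟨ solve 7 (λ m a b c d e f →
                 (a :* c :+ m :* (b :* d)) :* f :+ (a :* d :+ b :* c) :* e
                 := a :* (c :* f :+ d :* e) :+ b :* (c :* e :+ m :* (d :* f)))
                 refl m a b c d e f ⟩
          a * (c * f + d * e) + b * (c * e + m * (d * f))
            ≈⟨ +-congˡ (*-congˡ re) ⟨
          a * (c * f + d * e) + b * (c * e - d * f) ∎))
    (λ (a , b) (c , d) →
        +-cong (*-comm a c) (-‿cong (*-comm b d))
      , trans (+-comm _ _) (+-cong (*-comm b c) (*-comm a d)))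
    (λ (a , b) →
        trans re (solve 3 (λ m a b →
          con 1 :* a :+ m :* (con 0 :* b) := a) refl m a b)
      , solve 2 (λ a b → con 1 :* b :+ con 0 :* a := b) refl a b)
    (λ (a , b) (c , d) (e , f) →
        (begin
          (c + e) * a - (d + f) * b
            ≈⟨ re ⟩
          (c + e) * a + m * ((d + f) * b)
            ≈⟨ solve 7 (λ m a b c d e f →
                 (c :+ e) :* a :+ m :* ((d :+ f) :* b)
                 := (c :* a :+ m :* (d :* b)) :+ (e :* a :+ m :* (f :* b)))
                 refl m a b c d e f ⟩
          (c * a + m * (d * b)) + (e * a + m * (f * b))
            ≈⟨ +-cong re re ⟨
          (c * a - d * b) + (e * a - f * b) ∎)
      , solve 6 (λ a b c d e f →
          (c :+ e) :* b :+ (d :+ f) :* a := (c :* b :+ d :* a) :+ (e :* b :+ f :* a))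
          refl a b c d e f)
    where
    open S
    open SetoidReasoning setoid

ℂ : CommutativeRing 0ℓ 0ℓ
ℂ = AdjoinI.commutativeRing CauchyReals.commutativeRing

------------------------------------------------------------------------
-- R[[t]], a series being its sequence of coefficients

module PowerSeries (R : CommutativeRing c ℓ) where
  open CommutativeRing R
  private
    module S = SemiringSolver commutativeSemiring

  Series : Set c
  Series = ℕ → Carrier

  infix  4 _≈ˢ_
  infixl 7 _*ˢ_

  _≈ˢ_ : Series → Series → Set ℓ
  f ≈ˢ g = ∀ n → f n ≈ g n

  _+ˢ_ : Series → Series → Series
  (f +ˢ g) n = f n + g n

  tail : Series → Series
  tail f n = f (suc n)

  -- (f *ˢ g) n = f 0 * g n + f 1 * g (n - 1) + … + f n * g 0
  _*ˢ_ : Series → Series → Series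
  (f *ˢ g) zero    = f 0 * g 0
  (f *ˢ g) (suc n) = f 0 * g (suc n) + (tail f *ˢ g) n

  const : Carrier → Series
  const a zero    = a
  const a (suc n) = 0#

  var : Series
  var zero    = 0#
  var (suc n) = const 1# n

  private
    open SetoidReasoning setoid

    *ˢ-cong : ∀ {f f′ g g′} → f ≈ˢ f′ → g ≈ˢ g′ → f *ˢ g ≈ˢ f′ *ˢ g′
    *ˢ-cong f≈ g≈ zero    = *-cong (f≈ 0) (g≈ 0)
    *ˢ-cong f≈ g≈ (suc n) =
      +-cong (*-cong (f≈ 0) (g≈ (suc n))) (*ˢ-cong (λ i → f≈ (suc i)) g≈ n)

    *ˢ-distribʳ : ∀ h f g → (f +ˢ g) *ˢ h ≈ˢ (f *ˢ h) +ˢ (g *ˢ h)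
    *ˢ-distribʳ h f g zero    = distribʳ (h 0) (f 0) (g 0)
    *ˢ-distribʳ h f g (suc n) = begin
      (f 0 + g 0) * h (suc n) + ((tail f +ˢ tail g) *ˢ h) n
        ≈⟨ +-congˡ (*ˢ-distribʳ h (tail f) (tail g) n) ⟩
      (f 0 + g 0) * h (suc n) + ((tail f *ˢ h) n + (tail g *ˢ h) n)
        ≈⟨ solve 5 (λ a b x y z → (a :+ b) :* x :+ (y :+ z) := (a :* x :+ y) :+ (b :* x :+ z))
             refl (f 0) (g 0) (h (suc n)) ((tail f *ˢ h) n) ((tail g *ˢ h) n) ⟩
      (f *ˢ h) (suc n) + (g *ˢ h) (suc n) ∎
      where open S

    *ˢ-scale : ∀ a f g n → ((λ i → a * f i) *ˢ g) n ≈ a * (f *ˢ g) n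
    *ˢ-scale a f g zero    = *-assoc a (f 0) (g 0)
    *ˢ-scale a f g (suc n) = begin
      a * f 0 * g (suc n) + ((λ i → a * tail f i) *ˢ g) n
        ≈⟨ +-cong (*-assoc _ _ _) (*ˢ-scale a (tail f) g n) ⟩
      a * (f 0 * g (suc n)) + a * (tail f *ˢ g) n
        ≈⟨ distribˡ _ _ _ ⟨
      a * (f *ˢ g) (suc n) ∎

    *ˢ-last : ∀ f g n → (f *ˢ g) (suc n) ≈ (f *ˢ tail g) n + f (suc n) * g 0
    *ˢ-last f g zero    = refl
    *ˢ-last f g (suc n) = trans (+-congˡ (*ˢ-last (tail f) g n)) (sym (+-assoc _ _ _))

    *ˢ-comm : ∀ f g → f *ˢ g ≈ˢ g *ˢ f
    *ˢ-comm f g zero    = *-comm (f 0) (g 0)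
    *ˢ-comm f g (suc n) = begin
      f 0 * g (suc n) + (tail f *ˢ g) n  ≈⟨ +-cong (*-comm _ _) (*ˢ-comm (tail f) g n) ⟩
      g (suc n) * f 0 + (g *ˢ tail f) n  ≈⟨ +-comm _ _ ⟩
      (g *ˢ tail f) n + g (suc n) * f 0  ≈⟨ *ˢ-last g f n ⟨
      (g *ˢ f) (suc n)                   ∎

    *ˢ-assoc : ∀ f g h → (f *ˢ g) *ˢ h ≈ˢ f *ˢ (g *ˢ h)
    *ˢ-assoc f g h zero    = *-assoc (f 0) (g 0) (h 0)
    *ˢ-assoc f g h (suc n) = begin
      f 0 * g 0 * h (suc n) + (tail (f *ˢ g) *ˢ h) n
        ≈⟨ +-congˡ (*ˢ-distribʳ h (λ i → f 0 * tail g i) (tail f *ˢ g) n) ⟩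
      f 0 * g 0 * h (suc n) + (((λ i → f 0 * tail g i) *ˢ h) n + ((tail f *ˢ g) *ˢ h) n)
        ≈⟨ +-congˡ (+-cong (*ˢ-scale (f 0) (tail g) h n) (*ˢ-assoc (tail f) g h n)) ⟩
      f 0 * g 0 * h (suc n) + (f 0 * (tail g *ˢ h) n + (tail f *ˢ (g *ˢ h)) n)
        ≈⟨ solve 5 (λ a b x y z → a :* b :* x :+ (a :* y :+ z) := a :* (b :* x :+ y) :+ z)
             refl (f 0) (g 0) (h (suc n)) ((tail g *ˢ h) n) ((tail f *ˢ (g *ˢ h)) n) ⟩
      f 0 * (g *ˢ h) (suc n) + (tail f *ˢ (g *ˢ h)) n ∎
      where open S

    0*ˢ : ∀ g n → ((λ _ → 0#) *ˢ g) n ≈ 0#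
    0*ˢ g zero    = zeroˡ _
    0*ˢ g (suc n) = trans (+-cong (zeroˡ _) (0*ˢ g n)) (+-identityˡ 0#)

  const-* : ∀ a f n → (const a *ˢ f) n ≈ a * f n
  const-* a f zero    = refl
  const-* a f (suc n) = trans (+-congˡ (0*ˢ f n)) (+-identityʳ _)

  private
    additive : AbelianGroup c ℓ
    additive = record { isAbelianGroup = Pointwise.isAbelianGroup ℕ +-isAbelianGroup }

    1≈const : ∀ f → const 1# *ˢ f ≈ˢ f
    1≈const f n = trans (const-* 1# f n) (*-identityˡ _)

  commutativeRing : CommutativeRing c ℓ
  commutativeRing = BuildRing.commutativeRing additive _*ˢ_ (const 1#)
    *ˢ-cong *ˢ-assoc *ˢ-comm 1≈const *ˢ-distribʳ

  private
    module P = CommutativeRing commutativeRing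
    open Exp P.commutativeSemiring using (_^_; ^-homo-*; ^-assocʳ)

  var-*-suc : ∀ f n → (var *ˢ f) (suc n) ≈ f n
  var-*-suc f n = trans (+-cong (zeroˡ _) (1≈const f n)) (+-identityˡ _)

  var^-*-low : ∀ k f {n} → n ℕ.< k → (var ^ k *ˢ f) n ≈ 0#
  var^-*-low (suc k) f {n} n<k = trans (*ˢ-assoc var (var ^ k) f n) (low n n<k)
    where
    low : ∀ n → n ℕ.< suc k → (var *ˢ (var ^ k *ˢ f)) n ≈ 0#
    low zero    _           = zeroˡ _
    low (suc n) (ℕ.s≤s n<k) = trans (var-*-suc _ n) (var^-*-low k f n<k)

  var^-*-high : ∀ k f n → (var ^ k *ˢ f) (k ℕ.+ n) ≈ f n
  var^-*-high zero    f n = 1≈const f n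
  var^-*-high (suc k) f n = begin
    (var ^ suc k *ˢ f) (suc k ℕ.+ n)      ≈⟨ *ˢ-assoc var (var ^ k) f (suc k ℕ.+ n) ⟩
    (var *ˢ (var ^ k *ˢ f)) (suc k ℕ.+ n) ≈⟨ var-*-suc (var ^ k *ˢ f) (k ℕ.+ n) ⟩
    (var ^ k *ˢ f) (k ℕ.+ n)              ≈⟨ var^-*-high k f n ⟩
    f n                                   ∎

  var^-cancelˡ : ∀ k {f g} → var ^ k *ˢ f ≈ˢ var ^ k *ˢ g → f ≈ˢ g
  var^-cancelˡ k {f} {g} eq n =
    trans (sym (var^-*-high k f n)) (trans (eq (k ℕ.+ n)) (var^-*-high k g n))

  -- The substitution f(t) ↦ f(tᵏ)

  dilate : (k : ℕ) .{{_ : NonZero k}} → Series → Series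
  dilate k f n with k ∣? n
  ... | yes (divides q _) = f q
  ... | no  _             = 0#

  module _ (k : ℕ) .{{k≢0 : NonZero k}} where

    dilate-multiple : ∀ f q {n} → n ≡ q ℕ.* k → dilate k f n ≡ f q
    dilate-multiple f q {n} n≡qk with k ∣? n
    ... | yes (divides q′ n≡q′k) =
            ≡.cong f (ℕₚ.*-cancelʳ-≡ q′ q k (≡.trans (≡.sym n≡q′k) n≡qk))
    ... | no  k∤n = ⊥-elim (k∤n (divides q n≡qk))

    dilate-nonmultiple : ∀ f {n} → ¬ (k ∣ n) → dilate k f n ≡ 0#
    dilate-nonmultiple f {n} k∤n with k ∣? n
    ... | yes k∣n = ⊥-elim (k∤n k∣n)
    ... | no  _   = ≡.refl

    dilate-cong : ∀ {f g} → f ≈ˢ g → dilate k f ≈ˢ dilate k g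
    dilate-cong f≈g n with k ∣? n
    ... | yes (divides q _) = f≈g q
    ... | no  _             = refl

    dilate-+ : ∀ f g → dilate k (f +ˢ g) ≈ˢ (dilate k f +ˢ dilate k g)
    dilate-+ f g n with k ∣? n
    ... | yes _ = refl
    ... | no  _ = sym (+-identityˡ 0#)

    dilate-neg : ∀ f → dilate k (λ i → - f i) ≈ˢ (λ i → - dilate k f i)
    dilate-neg f n with k ∣? n
    ... | yes _ = refl
    ... | no  _ = sym (RingProperties.-0#≈0# ring)

    dilate-injective : ∀ {f g} → dilate k f ≈ˢ dilate k g → f ≈ˢ g
    dilate-injective {f} {g} eq n = begin
      f n                  ≡⟨ dilate-multiple f n ≡.refl ⟨
      dilate k f (n ℕ.* k) ≈⟨ eq (n ℕ.* k) ⟩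
      dilate k g (n ℕ.* k) ≡⟨ dilate-multiple g n ≡.refl ⟩
      g n                  ∎

    private
      dilate-shift : ∀ f n → dilate k f (k ℕ.+ n) ≡ dilate k (tail f) n
      dilate-shift f n = go (k ∣? n)
        where
        go : Dec (k ∣ n) → dilate k f (k ℕ.+ n) ≡ dilate k (tail f) n
        go (yes (divides q n≡qk)) = ≡.trans (dilate-multiple f (suc q) (≡.cong (k ℕ.+_) n≡qk))
                                            (≡.sym (dilate-multiple (tail f) q n≡qk))
        go (no k∤n) = ≡.trans (dilate-nonmultiple f (λ k∣k+n → k∤n (∣m+n∣m⇒∣n k∣k+n ∣-refl)))
                              (≡.sym (dilate-nonmultiple (tail f) k∤n))

      low∤ : ∀ {n} → suc n ℕ.< k → ¬ (k ∣ suc n)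
      low∤ n<k k∣n = ℕₚ.<⇒≱ n<k (∣⇒≤ k∣n)

      data Split : ℕ → Set where
        first : Split 0
        low   : ∀ n → suc n ℕ.< k → Split (suc n)
        high  : ∀ n → Split (k ℕ.+ n)

      split : ∀ n → Split n
      split n with ℕₚ.<-≤-connex n k
      split zero    | inj₁ _   = first
      split (suc n) | inj₁ n<k = low n n<k
      split n       | inj₂ k≤n = ≡.subst Split (ℕₚ.m+[n∸m]≡n k≤n) (high (n ∸ k))

      k>0 : 0 ℕ.< k
      k>0 = ℕ.>-nonZero⁻¹ k

    dilate-uncons : ∀ f → dilate k f ≈ˢ (const (f 0) +ˢ (var ^ k *ˢ dilate k (tail f)))
    dilate-uncons f n = go (split n)
      where
      d = dilate k (tail f)
      go : ∀ {n} → Split n → dilate k f n ≈ (const (f 0) +ˢ (var ^ k *ˢ d)) n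
      go first = begin
        dilate k f 0               ≡⟨ dilate-multiple f 0 ≡.refl ⟩
        f 0                        ≈⟨ +-identityʳ _ ⟨
        f 0 + 0#                   ≈⟨ +-congˡ (var^-*-low k d k>0) ⟨
        f 0 + (var ^ k *ˢ d) 0     ∎
      go (low n n<k) = begin
        dilate k f (suc n)         ≡⟨ dilate-nonmultiple f (low∤ n<k) ⟩
        0#                         ≈⟨ +-identityʳ _ ⟨
        0# + 0#                    ≈⟨ +-congˡ (var^-*-low k d n<k) ⟨
        0# + (var ^ k *ˢ d) (suc n) ∎
      go (high n) = begin
        dilate k f (k ℕ.+ n)       ≡⟨ dilate-shift f n ⟩
        d n                        ≈⟨ var^-*-high k d n ⟨
        (var ^ k *ˢ d) (k ℕ.+ n)   ≈⟨ +-identityˡ _ ⟨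
        0# + (var ^ k *ˢ d) (k ℕ.+ n) ≡⟨ ≡.cong (_+ (var ^ k *ˢ d) (k ℕ.+ n)) (const-high k>0 n) ⟨
        const (f 0) (k ℕ.+ n) + (var ^ k *ˢ d) (k ℕ.+ n) ∎
        where
        const-high : ∀ {k} → 0 ℕ.< k → ∀ n → const (f 0) (k ℕ.+ n) ≡ 0#
        const-high (ℕ.s≤s _) n = ≡.refl

    private
      dilate-scale : ∀ a f n → dilate k (λ i → a * f i) n ≈ a * dilate k f n
      dilate-scale a f n with k ∣? n
      ... | yes _ = refl
      ... | no  _ = sym (zeroʳ a)

      dilate-*-upto : ∀ N f g {n} → n ℕ.< N → dilate k (f *ˢ g) n ≈ (dilate k f *ˢ dilate k g) n
      dilate-*-upto (suc N) f g {n} n<N = trans (go (split n) n<N) (sym (expand n))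
        where
        F = dilate k (tail f)
        G = dilate k g

        expand : dilate k f *ˢ G ≈ˢ (λ i → f 0 * G i + (var ^ k *ˢ (F *ˢ G)) i)
        expand i = begin
          (dilate k f *ˢ G) i
            ≈⟨ *ˢ-cong (dilate-uncons f) (λ _ → refl) i ⟩
          ((const (f 0) +ˢ (var ^ k *ˢ F)) *ˢ G) i
            ≈⟨ *ˢ-distribʳ G (const (f 0)) (var ^ k *ˢ F) i ⟩
          (const (f 0) *ˢ G) i + ((var ^ k *ˢ F) *ˢ G) i
            ≈⟨ +-cong (const-* (f 0) G i) (*ˢ-assoc (var ^ k) F G i) ⟩
          f 0 * G i + (var ^ k *ˢ (F *ˢ G)) i ∎

        go : ∀ {n} → Split n → n ℕ.< suc N →
             dilate k (f *ˢ g) n ≈ f 0 * G n + (var ^ k *ˢ (F *ˢ G)) n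
        go first _ = begin
          dilate k (f *ˢ g) 0                   ≡⟨ dilate-multiple (f *ˢ g) 0 ≡.refl ⟩
          f 0 * g 0                             ≡⟨ ≡.cong (f 0 *_) (dilate-multiple g 0 ≡.refl) ⟨
          f 0 * G 0                             ≈⟨ +-identityʳ _ ⟨
          f 0 * G 0 + 0#                        ≈⟨ +-congˡ (var^-*-low k (F *ˢ G) k>0) ⟨
          f 0 * G 0 + (var ^ k *ˢ (F *ˢ G)) 0   ∎
        go (low n n<k) _ = begin
          dilate k (f *ˢ g) (suc n)             ≡⟨ dilate-nonmultiple (f *ˢ g) (low∤ n<k) ⟩
          0#                                    ≈⟨ zeroʳ (f 0) ⟨
          f 0 * 0#                              ≡⟨ ≡.cong (f 0 *_) (dilate-nonmultiple g (low∤ n<k)) ⟨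
          f 0 * G (suc n)                       ≈⟨ +-identityʳ _ ⟨
          f 0 * G (suc n) + 0#                  ≈⟨ +-congˡ (var^-*-low k (F *ˢ G) n<k) ⟨
          f 0 * G (suc n) + (var ^ k *ˢ (F *ˢ G)) (suc n) ∎
        go (high n) (ℕ.s≤s k+n≤N) = begin
          dilate k (f *ˢ g) (k ℕ.+ n)
            ≡⟨ dilate-shift (f *ˢ g) n ⟩
          dilate k (tail (f *ˢ g)) n
            ≈⟨ dilate-+ (λ i → f 0 * tail g i) (tail f *ˢ g) n ⟩
          dilate k (λ i → f 0 * tail g i) n + dilate k (tail f *ˢ g) n
            ≈⟨ +-cong (dilate-scale (f 0) (tail g) n)
                      (dilate-*-upto N (tail f) g
                        (ℕₚ.<-≤-trans (ℕₚ.m<n+m n k>0) k+n≤N)) ⟩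
          f 0 * dilate k (tail g) n + (F *ˢ G) n
            ≈⟨ +-cong (*-congˡ (reflexive (dilate-shift g n))) (var^-*-high k (F *ˢ G) n) ⟨
          f 0 * G (k ℕ.+ n) + (var ^ k *ˢ (F *ˢ G)) (k ℕ.+ n) ∎

    dilate-* : ∀ f g → dilate k (f *ˢ g) ≈ˢ dilate k f *ˢ dilate k g
    dilate-* f g n = dilate-*-upto (suc n) f g (ℕₚ.n<1+n n)

    dilate-0 : dilate k (λ _ → 0#) ≈ˢ (λ _ → 0#)
    dilate-0 n with k ∣? n
    ... | yes _ = refl
    ... | no  _ = refl

    dilate-1 : dilate k (const 1#) ≈ˢ const 1#
    dilate-1 n = begin
      dilate k (const 1#) n                        ≈⟨ dilate-uncons (const 1#) n ⟩
      const 1# n + (var ^ k *ˢ dilate k (λ _ → 0#)) n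
        ≈⟨ +-congˡ (trans (*ˢ-cong (λ _ → refl) dilate-0 n)
                          (trans (*ˢ-comm (var ^ k) (λ _ → 0#) n) (0*ˢ (var ^ k) n))) ⟩
      const 1# n + 0#                              ≈⟨ +-identityʳ _ ⟩
      const 1# n                                   ∎

    dilate-var^ : ∀ s → dilate k (var ^ s) ≈ˢ var ^ (k ℕ.* s)
    dilate-var^ s = P.trans (power s) (^-assocʳ var k s)
      where
      dilate-var : dilate k var ≈ˢ var ^ k
      dilate-var n = begin
        dilate k var n                                 ≈⟨ dilate-uncons var n ⟩
        const 0# n + (var ^ k *ˢ dilate k (const 1#)) n
          ≈⟨ +-cong (const-0 n) (trans (*ˢ-cong (λ _ → refl) dilate-1 n) (P.*-identityʳ (var ^ k) n)) ⟩
        0# + (var ^ k) n                               ≈⟨ +-identityˡ _ ⟩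
        (var ^ k) n                                    ∎
        where
        const-0 : ∀ n → const 0# n ≈ 0#
        const-0 zero    = refl
        const-0 (suc n) = refl

      power : ∀ s → dilate k (var ^ s) ≈ˢ (var ^ k) ^ s
      power zero    = dilate-1
      power (suc s) = P.trans (dilate-* var (var ^ s)) (*ˢ-cong dilate-var (power s))

  dilate-dilate : ∀ a b .{{_ : NonZero a}} .{{_ : NonZero b}} .{{_ : NonZero (a ℕ.* b)}} f →
                  dilate a (dilate b f) ≈ˢ dilate (a ℕ.* b) f
  dilate-dilate a b f n = reflexive (go (a ∣? n))
    where
    go′ : ∀ q → n ≡ q ℕ.* a → Dec (b ∣ q) → dilate b f q ≡ dilate (a ℕ.* b) f n
    go′ q n≡qa (yes (divides p q≡pb)) = ≡.trans (dilate-multiple b f p q≡pb)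
      (≡.sym (dilate-multiple (a ℕ.* b) f p (≡.trans n≡qa (≡.trans (≡.cong (ℕ._* a) q≡pb)
        (≡.trans (ℕₚ.*-assoc p b a) (≡.cong (p ℕ.*_) (ℕₚ.*-comm b a)))))))
    go′ q n≡qa (no b∤q) = ≡.trans (dilate-nonmultiple b f b∤q)
      (≡.sym (dilate-nonmultiple (a ℕ.* b) f λ (divides p n≡pab) →
        b∤q (divides p (ℕₚ.*-cancelʳ-≡ q (p ℕ.* b) a (≡.trans (≡.sym n≡qa) (≡.trans n≡pab
          (≡.trans (≡.cong (p ℕ.*_) (ℕₚ.*-comm a b)) (≡.sym (ℕₚ.*-assoc p b a)))))))))

    go : Dec (a ∣ n) → dilate a (dilate b f) n ≡ dilate (a ℕ.* b) f n
    go (yes (divides q n≡qa)) = ≡.trans (dilate-multiple a (dilate b f) q n≡qa) (go′ q n≡qa (b ∣? q))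
    go (no a∤n) = ≡.trans (dilate-nonmultiple a (dilate b f) a∤n)
      (≡.sym (dilate-nonmultiple (a ℕ.* b) f λ (divides p n≡pab) →
        a∤n (divides (p ℕ.* b) (≡.trans n≡pab
          (≡.trans (≡.cong (p ℕ.*_) (ℕₚ.*-comm a b)) (≡.sym (ℕₚ.*-assoc p b a)))))))

------------------------------------------------------------------------
-- R((t)) = R[[t]][1/t], with f /t^ s standing for f(t) / tˢ

module Laurent (R : CommutativeRing c ℓ) where
  module PS = PowerSeries R

  private
    module R = CommutativeRing R
    S = PS.commutativeRing
    module S = CommutativeRing S

  open S using (_+_; _*_; -_; 0#; 1#)
  open Exp S.commutativeSemiring using (_^_; ^-homo-*)
  open RingProperties S.ring using (-‿distribˡ-*)
  open PS using (var)

  infix 5 _/t^_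

  record Laurent : Set c where
    constructor _/t^_
    field
      numerator : PS.Series
      shift     : ℕ

  infix 4 _≈_

  record _≈_ (x y : Laurent) : Set ℓ where
    constructor cross
    open Laurent x renaming (numerator to f; shift to s)
    open Laurent y renaming (numerator to g; shift to u)
    field
      equal : f * var ^ u S.≈ g * var ^ s

  _+ᴸ_ _*ᴸ_ : Laurent → Laurent → Laurent
  (f /t^ s) +ᴸ (g /t^ u) = f * var ^ u + g * var ^ s /t^ s ℕ.+ u
  (f /t^ s) *ᴸ (g /t^ u) = f * g /t^ s ℕ.+ u

  -ᴸ_ : Laurent → Laurent
  -ᴸ (f /t^ s) = - f /t^ s

  0ᴸ 1ᴸ : Laurent
  0ᴸ = 0# /t^ 0
  1ᴸ = 1# /t^ 0

  private
    open SetoidReasoning S.setoid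
    open SemiringSolver S.commutativeSemiring using (solve; _:=_; _:+_; _:*_)

    T^+ : ∀ m n → var ^ (m ℕ.+ n) S.≈ var ^ m * var ^ n
    T^+ = ^-homo-* var

    *-cancel-var^ : ∀ k {f g} → f * var ^ k S.≈ g * var ^ k → f S.≈ g
    *-cancel-var^ k {f} {g} eq = PS.var^-cancelˡ k
      (S.trans (S.*-comm (var ^ k) f) (S.trans eq (S.*-comm g (var ^ k))))

    swapʳ : ∀ f g h → f * g * h S.≈ f * h * g
    swapʳ = solve 3 (λ f g h → f :* g :* h := f :* h :* g) S.refl

    ≈-trans : ∀ {x y z} → x ≈ y → y ≈ z → x ≈ z
    ≈-trans {f /t^ s} {g /t^ u} {h /t^ v} (cross eq₁) (cross eq₂) = cross (*-cancel-var^ u (begin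
      f * var ^ v * var ^ u  ≈⟨ swapʳ _ _ _ ⟩
      f * var ^ u * var ^ v  ≈⟨ S.*-congʳ eq₁ ⟩
      g * var ^ s * var ^ v  ≈⟨ swapʳ _ _ _ ⟩
      g * var ^ v * var ^ s  ≈⟨ S.*-congʳ eq₂ ⟩
      h * var ^ u * var ^ s  ≈⟨ swapʳ _ _ _ ⟩
      h * var ^ s * var ^ u  ∎))

    +-cong : ∀ {x x′ y y′} → x ≈ x′ → y ≈ y′ → x +ᴸ y ≈ x′ +ᴸ y′
    +-cong {f /t^ s} {f′ /t^ s′} {g /t^ u} {g′ /t^ u′} (cross eq₁) (cross eq₂) = cross (begin
      (f * var ^ u + g * var ^ s) * var ^ (s′ ℕ.+ u′)
        ≈⟨ S.*-congˡ (T^+ s′ u′) ⟩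
      (f * var ^ u + g * var ^ s) * (var ^ s′ * var ^ u′)
        ≈⟨ expand f g (var ^ s) (var ^ u) (var ^ s′) (var ^ u′) ⟩
      f * var ^ s′ * (var ^ u * var ^ u′) + g * var ^ u′ * (var ^ s * var ^ s′)
        ≈⟨ S.+-cong (S.*-congʳ eq₁) (S.*-congʳ eq₂) ⟩
      f′ * var ^ s * (var ^ u * var ^ u′) + g′ * var ^ u * (var ^ s * var ^ s′)
        ≈⟨ collect f′ g′ (var ^ s) (var ^ u) (var ^ s′) (var ^ u′) ⟩
      (f′ * var ^ u′ + g′ * var ^ s′) * (var ^ s * var ^ u)
        ≈⟨ S.*-congˡ (T^+ s u) ⟨
      (f′ * var ^ u′ + g′ * var ^ s′) * var ^ (s ℕ.+ u) ∎)
      where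
      expand = solve 6 (λ f g s u s′ u′ → (f :* u :+ g :* s) :* (s′ :* u′)
                 := f :* s′ :* (u :* u′) :+ g :* u′ :* (s :* s′)) S.refl
      collect = solve 6 (λ f g s u s′ u′ → f :* s :* (u :* u′) :+ g :* u :* (s :* s′)
                  := (f :* u′ :+ g :* s′) :* (s :* u)) S.refl

    *-cong : ∀ {x x′ y y′} → x ≈ x′ → y ≈ y′ → x *ᴸ y ≈ x′ *ᴸ y′
    *-cong {f /t^ s} {f′ /t^ s′} {g /t^ u} {g′ /t^ u′} (cross eq₁) (cross eq₂) = cross (begin
      f * g * var ^ (s′ ℕ.+ u′)      ≈⟨ S.*-congˡ (T^+ s′ u′) ⟩
      f * g * (var ^ s′ * var ^ u′)  ≈⟨ interchange _ _ _ _ ⟩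
      f * var ^ s′ * (g * var ^ u′)  ≈⟨ S.*-cong eq₁ eq₂ ⟩
      f′ * var ^ s * (g′ * var ^ u)  ≈⟨ interchange _ _ _ _ ⟨
      f′ * g′ * (var ^ s * var ^ u)  ≈⟨ S.*-congˡ (T^+ s u) ⟨
      f′ * g′ * var ^ (s ℕ.+ u)      ∎)
      where interchange = solve 4 (λ a b c d → a :* b :* (c :* d) := a :* c :* (b :* d)) S.refl

    -‿cong : ∀ {x y} → x ≈ y → -ᴸ x ≈ -ᴸ y
    -‿cong {f /t^ s} {g /t^ u} (cross eq) = cross (begin
      - f * var ^ u    ≈⟨ -‿distribˡ-* f (var ^ u) ⟨
      - (f * var ^ u)  ≈⟨ S.-‿cong eq ⟩
      - (g * var ^ s)  ≈⟨ -‿distribˡ-* g (var ^ s) ⟩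
      - g * var ^ s    ∎)

    same : ∀ {f g m n} → f S.≈ g → m ≡ n → (f /t^ m) ≈ (g /t^ n)
    same f≈g ≡.refl = cross (S.*-congʳ f≈g)

    +-assoc : ∀ x y z → (x +ᴸ y) +ᴸ z ≈ x +ᴸ (y +ᴸ z)
    +-assoc (f /t^ s) (g /t^ u) (h /t^ v) = same (begin
      (f * var ^ u + g * var ^ s) * var ^ v + h * var ^ (s ℕ.+ u)
        ≈⟨ S.+-congˡ (S.*-congˡ (T^+ s u)) ⟩
      (f * var ^ u + g * var ^ s) * var ^ v + h * (var ^ s * var ^ u)
        ≈⟨ solve 6 (λ f g h s u v → (f :* u :+ g :* s) :* v :+ h :* (s :* u)
             := f :* (u :* v) :+ (g :* v :+ h :* u) :* s) S.refl f g h (var ^ s) (var ^ u) (var ^ v) ⟩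
      f * (var ^ u * var ^ v) + (g * var ^ v + h * var ^ u) * var ^ s
        ≈⟨ S.+-congʳ (S.*-congˡ (T^+ u v)) ⟨
      f * var ^ (u ℕ.+ v) + (g * var ^ v + h * var ^ u) * var ^ s ∎)
      (ℕₚ.+-assoc s u v)

    +-comm : ∀ x y → x +ᴸ y ≈ y +ᴸ x
    +-comm (f /t^ s) (g /t^ u) = same (S.+-comm _ _) (ℕₚ.+-comm s u)

    +-identityˡ : ∀ x → 0ᴸ +ᴸ x ≈ x
    +-identityˡ (f /t^ s) = same {m = s} (begin
      0# * var ^ s + f * 1#  ≈⟨ S.+-cong (S.zeroˡ _) (S.*-identityʳ f) ⟩
      0# + f                 ≈⟨ S.+-identityˡ f ⟩
      f                      ∎) ≡.refl

    -‿inverseˡ : ∀ x → (-ᴸ x) +ᴸ x ≈ 0ᴸ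
    -‿inverseˡ (f /t^ s) = cross (begin
      (- f * var ^ s + f * var ^ s) * 1#  ≈⟨ S.*-identityʳ _ ⟩
      - f * var ^ s + f * var ^ s         ≈⟨ S.distribʳ _ _ _ ⟨
      (- f + f) * var ^ s                 ≈⟨ S.*-congʳ (S.-‿inverseˡ f) ⟩
      0# * var ^ s                        ≈⟨ S.zeroˡ _ ⟩
      0#                                  ≈⟨ S.zeroˡ _ ⟨
      0# * var ^ (s ℕ.+ s)                ∎)

    distribʳ : ∀ x y z → (y +ᴸ z) *ᴸ x ≈ (y *ᴸ x) +ᴸ (z *ᴸ x)
    distribʳ (f /t^ s) (g /t^ u) (h /t^ v) = cross (begin
      (g * var ^ v + h * var ^ u) * f * var ^ ((u ℕ.+ s) ℕ.+ (v ℕ.+ s))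
        ≈⟨ S.*-congˡ (S.trans (S.reflexive (≡.cong (var ^_) (index u s v))) (T^+ ((u ℕ.+ v) ℕ.+ s) s)) ⟩
      (g * var ^ v + h * var ^ u) * f * (var ^ ((u ℕ.+ v) ℕ.+ s) * var ^ s)
        ≈⟨ solve 7 (λ f g h s u v w → (g :* v :+ h :* u) :* f :* (w :* s)
             := (g :* f :* (v :* s) :+ h :* f :* (u :* s)) :* w) S.refl
             f g h (var ^ s) (var ^ u) (var ^ v) (var ^ ((u ℕ.+ v) ℕ.+ s)) ⟩
      (g * f * (var ^ v * var ^ s) + h * f * (var ^ u * var ^ s)) * var ^ ((u ℕ.+ v) ℕ.+ s)
        ≈⟨ S.*-congʳ (S.+-cong (S.*-congˡ (T^+ v s)) (S.*-congˡ (T^+ u s))) ⟨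
      (g * f * var ^ (v ℕ.+ s) + h * f * var ^ (u ℕ.+ s)) * var ^ ((u ℕ.+ v) ℕ.+ s) ∎)
      where
      index : ∀ u s v → (u ℕ.+ s) ℕ.+ (v ℕ.+ s) ≡ ((u ℕ.+ v) ℕ.+ s) ℕ.+ s
      index = solve-∀

    additive : AbelianGroup c ℓ
    additive = record
      { Carrier = Laurent ; _≈_ = _≈_ ; _∙_ = _+ᴸ_ ; ε = 0ᴸ ; _⁻¹ = -ᴸ_
      ; isAbelianGroup = record
        { isGroup = record
          { isMonoid = record
            { isSemigroup = record
              { isMagma = record
                { isEquivalence = record
                  { refl  = cross S.refl
                  ; sym   = λ (cross eq) → cross (S.sym eq)
                  ; trans = ≈-trans
                  }
                ; ∙-cong = +-cong
                }
              ; assoc = +-assoc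
              }
            ; identity = +-identityˡ
                       , λ x → ≈-trans (+-comm x 0ᴸ) (+-identityˡ x)
            }
          ; inverse = -‿inverseˡ
                    , λ x → ≈-trans (+-comm x (-ᴸ x)) (-‿inverseˡ x)
          ; ⁻¹-cong = -‿cong
          }
        ; comm = +-comm
        }
      }

  commutativeRing : CommutativeRing c ℓ
  commutativeRing = BuildRing.commutativeRing additive _*ᴸ_ 1ᴸ
    *-cong
    (λ { (f /t^ s) (g /t^ u) (h /t^ v) → same (S.*-assoc f g h) (ℕₚ.+-assoc s u v) })
    (λ { (f /t^ s) (g /t^ u) → same (S.*-comm f g) (ℕₚ.+-comm s u) })
    (λ { (f /t^ s) → same {m = s} (S.*-identityˡ f) ≡.refl })
    distribʳ

  -- Only the powers t, t², … occur.  The zero series, of order ∞, is included.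

  PositiveOrder : Laurent → Set ℓ
  PositiveOrder (f /t^ s) = ∀ i → i ℕ.≤ s → f i R.≈ R.0#

  dilate : (k : ℕ) .{{_ : NonZero k}} → Laurent → Laurent
  dilate k (f /t^ s) = PS.dilate k f /t^ k ℕ.* s

  private
    dilate-*-var^ : ∀ k .{{_ : NonZero k}} f s →
                    PS.dilate k (f * var ^ s) S.≈ PS.dilate k f * var ^ (k ℕ.* s)
    dilate-*-var^ k f s = S.trans (PS.dilate-* k f (var ^ s)) (S.*-congˡ (PS.dilate-var^ k s))

  module _ (k : ℕ) .{{_ : NonZero k}} where

    dilate-cong : ∀ {x y} → x ≈ y → dilate k x ≈ dilate k y
    dilate-cong {f /t^ s} {g /t^ u} (cross eq) = cross (begin
      PS.dilate k f * var ^ (k ℕ.* u)  ≈⟨ dilate-*-var^ k f u ⟨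
      PS.dilate k (f * var ^ u)        ≈⟨ PS.dilate-cong k eq ⟩
      PS.dilate k (g * var ^ s)        ≈⟨ dilate-*-var^ k g s ⟩
      PS.dilate k g * var ^ (k ℕ.* s)  ∎)

    dilate-injective : ∀ {x y} → dilate k x ≈ dilate k y → x ≈ y
    dilate-injective {f /t^ s} {g /t^ u} (cross eq) = cross (PS.dilate-injective k (begin
      PS.dilate k (f * var ^ u)        ≈⟨ dilate-*-var^ k f u ⟩
      PS.dilate k f * var ^ (k ℕ.* u)  ≈⟨ eq ⟩
      PS.dilate k g * var ^ (k ℕ.* s)  ≈⟨ dilate-*-var^ k g s ⟨
      PS.dilate k (g * var ^ s)        ∎))

    dilate-+ : ∀ x y → dilate k (x +ᴸ y) ≈ dilate k x +ᴸ dilate k y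
    dilate-+ (f /t^ s) (g /t^ u) = same
      (S.trans (PS.dilate-+ k (f * var ^ u) (g * var ^ s))
               (S.+-cong (dilate-*-var^ k f u) (dilate-*-var^ k g s)))
      (ℕₚ.*-distribˡ-+ k s u)

    dilate-* : ∀ x y → dilate k (x *ᴸ y) ≈ dilate k x *ᴸ dilate k y
    dilate-* (f /t^ s) (g /t^ u) = same (PS.dilate-* k f g) (ℕₚ.*-distribˡ-+ k s u)

    dilate-neg : ∀ x → dilate k (-ᴸ x) ≈ -ᴸ dilate k x
    dilate-neg (f /t^ s) = same {m = k ℕ.* s} (PS.dilate-neg k f) ≡.refl

    dilate-0 : dilate k 0ᴸ ≈ 0ᴸ
    dilate-0 = same (PS.dilate-0 k) (ℕₚ.*-zeroʳ k)

    dilate-1 : dilate k 1ᴸ ≈ 1ᴸ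
    dilate-1 = same (PS.dilate-1 k) (ℕₚ.*-zeroʳ k)

  dilate-dilate : ∀ a b .{{_ : NonZero a}} .{{_ : NonZero b}} .{{_ : NonZero (a ℕ.* b)}} x →
                  dilate a (dilate b x) ≈ dilate (a ℕ.* b) x
  dilate-dilate a b (f /t^ s) = same (PS.dilate-dilate a b f) (≡.sym (ℕₚ.*-assoc a b s))

------------------------------------------------------------------------
-- ⋃ₘ R((z^{1/m})), with x at m standing for x(z^{1/m})

module Puiseux (R : CommutativeRing c ℓ) where
  module La = Laurent R
  module L = CommutativeRing La.commutativeRing

  open La using (dilate)
  open L using (_+_; _*_; -_; 0#; 1#)
  open SetoidReasoning L.setoid

  infix 5 _at_

  record Puiseux : Set c where
    constructor _at_
    field
      expansion       : La.Laurent
      ramification    : ℕ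
      .{{positive}}   : NonZero ramification

  infix 4 _≈_

  record _≈_ (p q : Puiseux) : Set ℓ where
    constructor cross
    open Puiseux p renaming (expansion to x; ramification to m)
    open Puiseux q renaming (expansion to y; ramification to n)
    field
      equal : dilate n x L.≈ dilate m y

  private
    product≢0 : ∀ m n .{{_ : NonZero m}} .{{_ : NonZero n}} → NonZero (m ℕ.* n)
    product≢0 m n = ℕₚ.m*n≢0 m n

  _+ᴾ_ _*ᴾ_ : Puiseux → Puiseux → Puiseux
  (x at m) +ᴾ (y at n) = _at_ (dilate n x + dilate m y) (m ℕ.* n) {{product≢0 m n}}
  (x at m) *ᴾ (y at n) = _at_ (dilate n x * dilate m y) (m ℕ.* n) {{product≢0 m n}}

  -ᴾ_ : Puiseux → Puiseux
  -ᴾ (x at m) = - x at m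

  0ᴾ 1ᴾ : Puiseux
  0ᴾ = 0# at 1
  1ᴾ = 1# at 1

  PositiveOrder : Puiseux → Set ℓ
  PositiveOrder (x at m) = La.PositiveOrder x

  private
    -- Equality of composites of dilations, by comparing the total dilation factor.
    dilate² : ∀ a b a′ b′ .{{_ : NonZero a}} .{{_ : NonZero b}}
              .{{_ : NonZero a′}} .{{_ : NonZero b′}} →
              a ℕ.* b ≡ a′ ℕ.* b′ → ∀ x → dilate a (dilate b x) L.≈ dilate a′ (dilate b′ x)
    dilate² a b a′ b′ eq x = begin
      dilate a (dilate b x)    ≈⟨ La.dilate-dilate a b x ⟩
      dilate (a ℕ.* b) x       ≡⟨ index eq ⟩
      dilate (a′ ℕ.* b′) x     ≈⟨ La.dilate-dilate a′ b′ x ⟨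
      dilate a′ (dilate b′ x)  ∎
      where
      instance
        ab≢0   = product≢0 a b
        a′b′≢0 = product≢0 a′ b′
      index : ∀ {m n} → m ≡ n → .{{_ : NonZero m}} .{{_ : NonZero n}} → dilate m x ≡ dilate n x
      index ≡.refl = ≡.refl

    ≈-refl : ∀ {x} → x ≈ x
    ≈-refl = cross L.refl

    ≈-sym : ∀ {x y} → x ≈ y → y ≈ x
    ≈-sym (cross eq) = cross (L.sym eq)

    ≈-trans : ∀ {x y z} → x ≈ y → y ≈ z → x ≈ z
    ≈-trans {x at m} {y at n} {z at k} (cross eq₁) (cross eq₂) = cross (La.dilate-injective n (begin
      dilate n (dilate k x)  ≈⟨ dilate² n k k n (ℕₚ.*-comm n k) x ⟩
      dilate k (dilate n x)  ≈⟨ La.dilate-cong k eq₁ ⟩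
      dilate k (dilate m y)  ≈⟨ dilate² k m m k (ℕₚ.*-comm k m) y ⟩
      dilate m (dilate k y)  ≈⟨ La.dilate-cong m eq₂ ⟩
      dilate m (dilate n z)  ≈⟨ dilate² m n n m (ℕₚ.*-comm m n) z ⟩
      dilate n (dilate m z)  ∎))

    rescaleˡ : ∀ m m′ n n′ .{{_ : NonZero m}} .{{_ : NonZero m′}} .{{_ : NonZero n}} .{{_ : NonZero n′}}
               .{{_ : NonZero (m ℕ.* n)}} .{{_ : NonZero (m′ ℕ.* n′)}} →
               ∀ {x x′} → dilate m′ x L.≈ dilate m x′ →
               dilate (m′ ℕ.* n′) (dilate n x) L.≈ dilate (m ℕ.* n) (dilate n′ x′)
    rescaleˡ m m′ n n′ {x} {x′} eq = begin
      dilate (m′ ℕ.* n′) (dilate n x)  ≈⟨ dilate² (m′ ℕ.* n′) n (n ℕ.* n′) m′ (reorder m′ n′ n) x ⟩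
      dilate (n ℕ.* n′) (dilate m′ x)  ≈⟨ La.dilate-cong (n ℕ.* n′) eq ⟩
      dilate (n ℕ.* n′) (dilate m x′)  ≈⟨ dilate² (n ℕ.* n′) m (m ℕ.* n) n′ (rotate m n n′) x′ ⟩
      dilate (m ℕ.* n) (dilate n′ x′)  ∎
      where
      instance nn′≢0 = product≢0 n n′
      reorder : ∀ a b c → (a ℕ.* b) ℕ.* c ≡ (c ℕ.* b) ℕ.* a
      reorder = solve-∀
      rotate : ∀ a b c → (b ℕ.* c) ℕ.* a ≡ (a ℕ.* b) ℕ.* c
      rotate = solve-∀

    rescaleʳ : ∀ m m′ n n′ .{{_ : NonZero m}} .{{_ : NonZero m′}} .{{_ : NonZero n}} .{{_ : NonZero n′}}
               .{{_ : NonZero (m ℕ.* n)}} .{{_ : NonZero (m′ ℕ.* n′)}} →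
               ∀ {y y′} → dilate n′ y L.≈ dilate n y′ →
               dilate (m′ ℕ.* n′) (dilate m y) L.≈ dilate (m ℕ.* n) (dilate m′ y′)
    rescaleʳ m m′ n n′ {y} {y′} eq = begin
      dilate (m′ ℕ.* n′) (dilate m y)  ≈⟨ dilate² (m′ ℕ.* n′) m (m′ ℕ.* m) n′ (reorder m′ n′ m) y ⟩
      dilate (m′ ℕ.* m) (dilate n′ y)  ≈⟨ La.dilate-cong (m′ ℕ.* m) eq ⟩
      dilate (m′ ℕ.* m) (dilate n y′)  ≈⟨ dilate² (m′ ℕ.* m) n (m ℕ.* n) m′ (rotate m′ m n) y′ ⟩
      dilate (m ℕ.* n) (dilate m′ y′)  ∎
      where
      instance m′m≢0 = product≢0 m′ m
      reorder : ∀ a b c → (a ℕ.* b) ℕ.* c ≡ (a ℕ.* c) ℕ.* b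
      reorder = solve-∀
      rotate : ∀ a b c → (a ℕ.* b) ℕ.* c ≡ (b ℕ.* c) ℕ.* a
      rotate = solve-∀

    +-cong : ∀ {x x′ y y′} → x ≈ x′ → y ≈ y′ → x +ᴾ y ≈ x′ +ᴾ y′
    +-cong {x at m} {x′ at m′} {y at n} {y′ at n′} (cross eq₁) (cross eq₂) = cross (begin
      dilate (m′ ℕ.* n′) (dilate n x + dilate m y)
        ≈⟨ La.dilate-+ (m′ ℕ.* n′) (dilate n x) (dilate m y) ⟩
      dilate (m′ ℕ.* n′) (dilate n x) + dilate (m′ ℕ.* n′) (dilate m y)
        ≈⟨ L.+-cong (rescaleˡ m m′ n n′ eq₁) (rescaleʳ m m′ n n′ eq₂) ⟩
      dilate (m ℕ.* n) (dilate n′ x′) + dilate (m ℕ.* n) (dilate m′ y′)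
        ≈⟨ La.dilate-+ (m ℕ.* n) (dilate n′ x′) (dilate m′ y′) ⟨
      dilate (m ℕ.* n) (dilate n′ x′ + dilate m′ y′) ∎)
      where
      instance
        mn≢0   = product≢0 m n
        m′n′≢0 = product≢0 m′ n′

    *-cong : ∀ {x x′ y y′} → x ≈ x′ → y ≈ y′ → x *ᴾ y ≈ x′ *ᴾ y′
    *-cong {x at m} {x′ at m′} {y at n} {y′ at n′} (cross eq₁) (cross eq₂) = cross (begin
      dilate (m′ ℕ.* n′) (dilate n x * dilate m y)
        ≈⟨ La.dilate-* (m′ ℕ.* n′) (dilate n x) (dilate m y) ⟩
      dilate (m′ ℕ.* n′) (dilate n x) * dilate (m′ ℕ.* n′) (dilate m y)
        ≈⟨ L.*-cong (rescaleˡ m m′ n n′ eq₁) (rescaleʳ m m′ n n′ eq₂) ⟩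
      dilate (m ℕ.* n) (dilate n′ x′) * dilate (m ℕ.* n) (dilate m′ y′)
        ≈⟨ La.dilate-* (m ℕ.* n) (dilate n′ x′) (dilate m′ y′) ⟨
      dilate (m ℕ.* n) (dilate n′ x′ * dilate m′ y′) ∎)
      where
      instance
        mn≢0   = product≢0 m n
        m′n′≢0 = product≢0 m′ n′

    -‿cong : ∀ {x y} → x ≈ y → -ᴾ x ≈ -ᴾ y
    -‿cong {x at m} {y at n} (cross eq) = cross (begin
      dilate n (- x)  ≈⟨ La.dilate-neg n x ⟩
      - dilate n x    ≈⟨ L.-‿cong eq ⟩
      - dilate m y    ≈⟨ La.dilate-neg m y ⟨
      dilate m (- y)  ∎)

    -- The remaining laws need only be checked for elements of the same
    -- ramification m, where they are those of Laurent series in z^{1/m}.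

    bring : ∀ x m k N .{{_ : NonZero m}} .{{_ : NonZero k}} .{{_ : NonZero N}} →
            N ≡ k ℕ.* m → (x at m) ≈ (dilate k x at N)
    bring x m k N N≡km = cross (begin
      dilate N x             ≈⟨ La.dilate-cong N dilate-1-x ⟨
      dilate N (dilate 1 x)  ≈⟨ dilate² N 1 m k N*1≡m*k x ⟩
      dilate m (dilate k x)  ∎)
      where
      N*1≡m*k : N ℕ.* 1 ≡ m ℕ.* k
      N*1≡m*k = ≡.trans (ℕₚ.*-identityʳ N) (≡.trans N≡km (ℕₚ.*-comm k m))
      dilate-1-x : dilate 1 x L.≈ x
      dilate-1-x = La.dilate-injective 1 (La.dilate-dilate 1 1 x)

    +-at : ∀ {x y} m .{{_ : NonZero m}} u v →
           x ≈ (u at m) → y ≈ (v at m) → x +ᴾ y ≈ (u + v at m)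
    +-at m u v eq₁ eq₂ = ≈-trans (+-cong eq₁ eq₂) (cross (begin
        dilate m (dilate m u + dilate m v)  ≈⟨ La.dilate-cong m (La.dilate-+ m u v) ⟨
        dilate m (dilate m (u + v))         ≈⟨ La.dilate-dilate m m (u + v) ⟩
        dilate (m ℕ.* m) (u + v)            ∎))
      where instance mm≢0 = product≢0 m m

    *-at : ∀ {x y} m .{{_ : NonZero m}} u v →
           x ≈ (u at m) → y ≈ (v at m) → x *ᴾ y ≈ (u * v at m)
    *-at m u v eq₁ eq₂ = ≈-trans (*-cong eq₁ eq₂) (cross (begin
        dilate m (dilate m u * dilate m v)  ≈⟨ La.dilate-cong m (La.dilate-* m u v) ⟨
        dilate m (dilate m (u * v))         ≈⟨ La.dilate-dilate m m (u * v) ⟩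
        dilate (m ℕ.* m) (u * v)            ∎))
      where instance mm≢0 = product≢0 m m

    0-at : ∀ m .{{_ : NonZero m}} → 0ᴾ ≈ (0# at m)
    0-at m = cross (L.trans (La.dilate-0 m) (L.sym (La.dilate-0 1)))

    1-at : ∀ m .{{_ : NonZero m}} → 1ᴾ ≈ (1# at m)
    1-at m = cross (L.trans (La.dilate-1 m) (L.sym (La.dilate-1 1)))

    via : ∀ {x y} m .{{_ : NonZero m}} u v →
          x ≈ (u at m) → y ≈ (v at m) → u L.≈ v → x ≈ y
    via m u v x≈u y≈v u≈v =
      ≈-trans x≈u (≈-trans {y = v at m} (cross (La.dilate-cong m {u} {v} u≈v)) (≈-sym y≈v))

    record Common (x y z : Puiseux) : Set (c ⊔ ℓ) where
      field
        m : ℕ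
        m≢0 : NonZero m
      private instance _ = m≢0
      field
        u v w      : La.Laurent
        x≈ : x ≈ (u at m)
        y≈ : y ≈ (v at m)
        z≈ : z ≈ (w at m)

    common : ∀ x y z → Common x y z
    common (x at m) (y at n) (z at k) = record
      { m  = m ℕ.* n ℕ.* k
      ; m≢0 = mnk≢0
      ; x≈ = bring x m (n ℕ.* k) (m ℕ.* n ℕ.* k) (first m n k)
      ; y≈ = bring y n (m ℕ.* k) (m ℕ.* n ℕ.* k) (second m n k)
      ; z≈ = bring z k (m ℕ.* n) (m ℕ.* n ℕ.* k) ≡.refl
      }
      where
      instance
        mn≢0  = product≢0 m n
        mk≢0  = product≢0 m k
        nk≢0  = product≢0 n k
        mnk≢0 = product≢0 (m ℕ.* n) k
      first : ∀ m n k → m ℕ.* n ℕ.* k ≡ (n ℕ.* k) ℕ.* m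
      first = solve-∀
      second : ∀ m n k → m ℕ.* n ℕ.* k ≡ (m ℕ.* k) ℕ.* n
      second = solve-∀

    +-assoc : ∀ x y z → (x +ᴾ y) +ᴾ z ≈ x +ᴾ (y +ᴾ z)
    +-assoc x y z =
      via m ((u + v) + w) (u + (v + w))
        (+-at m (u + v) w (+-at m u v x≈ y≈) z≈)
        (+-at m u (v + w) x≈ (+-at m v w y≈ z≈))
        (L.+-assoc u v w)
      where
      open Common (common x y z)
      instance _ = m≢0

    *-assoc : ∀ x y z → (x *ᴾ y) *ᴾ z ≈ x *ᴾ (y *ᴾ z)
    *-assoc x y z =
      via m ((u * v) * w) (u * (v * w))
        (*-at m (u * v) w (*-at m u v x≈ y≈) z≈)
        (*-at m u (v * w) x≈ (*-at m v w y≈ z≈))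
        (L.*-assoc u v w)
      where
      open Common (common x y z)
      instance _ = m≢0

    +-comm : ∀ x y → x +ᴾ y ≈ y +ᴾ x
    +-comm x y =
      via m (u + v) (v + u)
        (+-at m u v x≈ y≈) (+-at m v u y≈ x≈) (L.+-comm u v)
      where
      open Common (common x y x)
      instance _ = m≢0

    *-comm : ∀ x y → x *ᴾ y ≈ y *ᴾ x
    *-comm x y =
      via m (u * v) (v * u)
        (*-at m u v x≈ y≈) (*-at m v u y≈ x≈) (L.*-comm u v)
      where
      open Common (common x y x)
      instance _ = m≢0

    distribʳ : ∀ x y z → (y +ᴾ z) *ᴾ x ≈ (y *ᴾ x) +ᴾ (z *ᴾ x)
    distribʳ x y z =
      via m ((v + w) * u) (v * u + w * u)
        (*-at m (v + w) u (+-at m v w y≈ z≈) x≈)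
        (+-at m (v * u) (w * u)
          (*-at m v u y≈ x≈) (*-at m w u z≈ x≈))
        (L.distribʳ u v w)
      where
      open Common (common x y z)
      instance _ = m≢0

    +-identityˡ : ∀ x → 0ᴾ +ᴾ x ≈ x
    +-identityˡ (x at m) =
      via m (0# + x) x
        (+-at m 0# x (0-at m) ≈-refl) ≈-refl (L.+-identityˡ x)

    *-identityˡ : ∀ x → 1ᴾ *ᴾ x ≈ x
    *-identityˡ (x at m) =
      via m (1# * x) x
        (*-at m 1# x (1-at m) ≈-refl) ≈-refl (L.*-identityˡ x)

    -‿inverseˡ : ∀ x → (-ᴾ x) +ᴾ x ≈ 0ᴾ
    -‿inverseˡ (x at m) =
      via m (- x + x) 0#
        (+-at m (- x) x ≈-refl ≈-refl) (0-at m) (L.-‿inverseˡ x)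

    additive : AbelianGroup c ℓ
    additive = record
      { Carrier = Puiseux ; _≈_ = _≈_ ; _∙_ = _+ᴾ_ ; ε = 0ᴾ ; _⁻¹ = -ᴾ_
      ; isAbelianGroup = record
        { isGroup = record
          { isMonoid = record
            { isSemigroup = record
              { isMagma = record
                { isEquivalence = record
                  { refl  = ≈-refl
                  ; sym   = ≈-sym
                  ; trans = ≈-trans
                  }
                ; ∙-cong = +-cong
                }
              ; assoc = +-assoc
              }
            ; identity = +-identityˡ
                       , λ x → ≈-trans (+-comm x 0ᴾ) (+-identityˡ x)
            }
          ; inverse = -‿inverseˡ
                    , λ x → ≈-trans (+-comm x (-ᴾ x)) (-‿inverseˡ x)
          ; ⁻¹-cong = -‿cong
          }
        ; comm = +-comm
        }
      }

  commutativeRing : CommutativeRing c ℓ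
  commutativeRing = BuildRing.commutativeRing additive _*ᴾ_ 1ᴾ
    *-cong *-assoc *-comm *-identityˡ distribʳ

  fromSeries : La.PS.Series → Puiseux
  fromSeries f = (f La./t^ 0) at 1

  fromSeries-* : ∀ f g → fromSeries (f La.PS.*ˢ g) ≈ fromSeries f *ᴾ fromSeries g
  fromSeries-* f g = ≈-sym (*-at 1 (f La./t^ 0) (g La./t^ 0) ≈-refl ≈-refl)

  fromSeries-cong : ∀ {f g} → f La.PS.≈ˢ g → fromSeries f ≈ fromSeries g
  fromSeries-cong f≈g = cross (La.dilate-cong 1 (La.cross (P.*-congʳ f≈g)))
    where module P = CommutativeRing La.PS.commutativeRing

  z z⁻¹ : Puiseux
  z   = fromSeries La.PS.var
  z⁻¹ = (La.PS.const (CommutativeRing.1# R) La./t^ 1) at 1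

  z-inverse : z *ᴾ z⁻¹ ≈ 1ᴾ
  z-inverse = ≈-trans
    (*-at 1 (La.PS.var La./t^ 0) (La.PS.const (CommutativeRing.1# R) La./t^ 1) ≈-refl ≈-refl)
    (cross (La.dilate-cong 1 {y = 1#} (La.cross
      (P.trans (P.*-identityʳ _) (P.trans (P.*-identityʳ _)
        (P.sym (P.trans (P.*-identityˡ _) (P.*-identityʳ _))))))))
    where module P = CommutativeRing La.PS.commutativeRing

------------------------------------------------------------------------
-- R[[y₁]]…[[yᵣ]]

module Multivariate (R : CommutativeRing c ℓ) where
  open CommutativeRing using (Carrier)

  ring : ℕ → CommutativeRing c ℓ
  ring zero    = R
  ring (suc r) = PowerSeries.commutativeRing (ring r)

  constant : ∀ r → Carrier R → Carrier (ring r)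
  constant zero    a = a
  constant (suc r) a = PowerSeries.const (ring r) (constant r a)

  indeterminate : ∀ {r} → Fin r → Carrier (ring r)
  indeterminate {suc r} zero    = PowerSeries.var (ring r)
  indeterminate {suc r} (suc i) = PowerSeries.const (ring r) (indeterminate i)

  coefficient : ∀ {r} → Vec ℕ r → Carrier (ring r) → Carrier R
  coefficient []       f = f
  coefficient (n ∷ ns) f = coefficient ns (f n)

  fromCoefficients : ∀ {r} → (Vec ℕ r → Carrier R) → Carrier (ring r)
  fromCoefficients {zero}  a   = a []
  fromCoefficients {suc r} a n = fromCoefficients λ ns → a (n ∷ ns)

module BigOperators (R : CommutativeRing c ℓ) where
  open CommutativeRing R

  ∑ ∏ : ∀ {n} → (Fin n → Carrier) → Carrier
  ∑ = FiniteSum.sum +-commutativeMonoid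
  ∏ = FiniteSum.sum *-commutativeMonoid

  ∑ₗ : ∀ {a} {A : Set a} → List A → (A → Carrier) → Carrier
  ∑ₗ xs f = List.foldr _+_ 0# (List.map f xs)

module Units (R : CommutativeRing c ℓ) where
  open CommutativeRing R
  open Exp commutativeSemiring using (_^_)
  open SemiringSolver commutativeSemiring using (solve; _:=_; _:*_)

  record Unit : Set (c ⊔ ℓ) where
    field
      value   : Carrier
      inverse : Carrier
      inverts : value * inverse ≈ 1#

  open Unit public

  infixl 7 _*ᵘ_
  infixr 8 _^ᵘ_ _^ᶻ_

  _*ᵘ_ : Unit → Unit → Unit
  x *ᵘ y = record
    { value   = value x * value y
    ; inverse = inverse x * inverse y
    ; inverts = trans
        (solve 4 (λ a b c d → a :* b :* (c :* d) := a :* c :* (b :* d)) refl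
          (value x) (value y) (inverse x) (inverse y))
        (trans (*-cong (inverts x) (inverts y)) (*-identityˡ 1#))
    }

  _^ᵘ_ : Unit → ℕ → Unit
  x ^ᵘ zero  = record { value = 1# ; inverse = 1# ; inverts = *-identityˡ 1# }
  x ^ᵘ suc n = x *ᵘ (x ^ᵘ n)

  _^ᶻ_ : Unit → ℤ → Carrier
  x ^ᶻ (+ n)    = value x ^ n
  x ^ᶻ -[1+ n ] = inverse x ^ suc n

------------------------------------------------------------------------

private
  _≟ⱽ_ : ∀ {r} (m n : Vec ℕ r) → Dec (m ≡ n)
  _≟ⱽ_ = ≡-dec ℕₚ._≟_

𝟎 : ∀ {r} → Vec ℕ r
𝟎 = replicate _ 0

-- axis ℓ k is k times the unit vector e_ℓ.

axis : ∀ {r} → Fin r → ℕ → Vec ℕ r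
axis ℓ k = 𝟎 [ ℓ ]≔ k

AtLeastTwoNonzero : ∀ {r} → Vec ℕ r → Set
AtLeastTwoNonzero n = ∃₂ λ i j → i ≢ j × lookup n i ≢ 0 × lookup n j ≢ 0

-- All pairs (g , h) with g + h = n.

splittings : ∀ {r} → Vec ℕ r → List (Vec ℕ r × Vec ℕ r)
splittings []       = ([] , []) ∷ []
splittings (n ∷ ns) = List.concatMap
  (λ a → List.map (λ (g , h) → a ∷ g , (n ∸ a) ∷ h) (splittings ns))
  (List.upTo (suc n))

-- All ordered k-tuples of nonzero vectors with sum n.

compositions : ∀ {r} (k : ℕ) → Vec ℕ r → List (Vec (Vec ℕ r) k)
compositions zero    n = if does (n ≟ⱽ 𝟎) then [] ∷ [] else []
compositions (suc k) n = List.concatMap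
  (λ (g , h) → if does (g ≟ⱽ 𝟎) then [] else List.map (g ∷_) (compositions k h))
  (splittings n)

-- The k-element subsequences; for an increasing list of integers these
-- are its k-element subsets, listed in increasing order.

choose : ∀ {a} {A : Set a} (k : ℕ) → List A → List (Vec A k)
choose zero    _        = [] ∷ []
choose (suc k) []       = []
choose (suc k) (x ∷ xs) = List.map (x ∷_) (choose k xs) ++ choose (suc k) xs

-- B d = { -(2d-1), -(2d-3), …, 2d-3, 2d-1 }, in increasing order

B : ℕ → List ℤ
B d = List.map (λ i → + (2 ℕ.* i) ℤ.- + (2 ℕ.* d ∸ 1)) (List.upTo (2 ℕ.* d))

-- The ℓ-th positive odd number 2ℓ-1, where i : Fin d stands for ℓ = i + 1.

odd : ∀ {d} → Fin d → ℤ
odd i = + suc (2 ℕ.* toℕ i)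

------------------------------------------------------------------------

module TreeSeries (F : CommutativeRing c ℓ) where

  module Z = PowerSeries F
  module P = Puiseux F

  F⟦z⟧ K : CommutativeRing c ℓ
  F⟦z⟧ = Z.commutativeRing
  K    = P.commutativeRing

  IsTreeSeries : ℕ → Z.Series → Set ℓ
  IsTreeSeries d T = (T 0 F.≈ F.1#) × (T ≈ 1# + Z.var * T ^ (2 ℕ.* d))
    where
    module F = CommutativeRing F
    open CommutativeRing F⟦z⟧
    open Exp commutativeSemiring

  open Units K using (Unit; _*ᵘ_; _^ᵘ_)

  zᵘ : Unit
  zᵘ = record { value = P.z ; inverse = P.z⁻¹ ; inverts = P.z-inverse }

  module _ (d : ℕ) .{{_ : NonZero d}} (T : Z.Series) (T-tree : IsTreeSeries d T) where

    -- T is invertible because T (1 - z T²ᵈ⁻¹) = 1.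

    Tᵘ : Unit
    Tᵘ = record
      { value   = P.fromSeries T
      ; inverse = P.fromSeries (1# - Z.var * T ^ (2 ℕ.* d ∸ 1))
      ; inverts = K.trans (K.sym (P.fromSeries-* T _)) (P.fromSeries-cong T-invertible)
      }
      where
      open CommutativeRing F⟦z⟧
      module K = CommutativeRing K
      open Exp commutativeSemiring using (_^_)
      open RingProperties (CommutativeRing.ring F⟦z⟧) using (-‿distribʳ-*)
      open SemiringSolver commutativeSemiring using (solve; _:=_; _:*_)
      open SetoidReasoning setoid
      q = 2 ℕ.* d ∸ 1
      2d≡1+q : 2 ℕ.* d ≡ suc q
      2d≡1+q = ≡.sym (ℕₚ.m+[n∸m]≡n (ℕ.>-nonZero⁻¹ (2 ℕ.* d) {{ℕₚ.m*n≢0 2 d}}))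
      T-invertible : T * (1# - Z.var * T ^ q) ≈ 1#
      T-invertible = begin
        T * (1# - Z.var * T ^ q)             ≈⟨ distribˡ T 1# (- (Z.var * T ^ q)) ⟩
        T * 1# + T * - (Z.var * T ^ q)       ≈⟨ +-cong (*-identityʳ T) (sym (-‿distribʳ-* T _)) ⟩
        T - T * (Z.var * T ^ q)              ≈⟨ +-cong (proj₂ T-tree) (-‿cong
                                                  (solve 3 (λ t z p → t :* (z :* p) := z :* (t :* p))
                                                    refl T Z.var (T ^ q))) ⟩
        (1# + Z.var * T ^ (2 ℕ.* d)) - Z.var * T ^ suc q
          ≡⟨ ≡.cong (λ n → (1# + Z.var * T ^ n) - Z.var * T ^ suc q) 2d≡1+q ⟩
        (1# + Z.var * T ^ suc q) - Z.var * T ^ suc q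
                                             ≈⟨ +-assoc _ _ _ ⟩
        1# + (Z.var * T ^ suc q - Z.var * T ^ suc q)
                                             ≈⟨ +-congˡ (-‿inverseʳ (Z.var * T ^ suc q)) ⟩
        1# + 0#                              ≈⟨ +-identityʳ 1# ⟩
        1#                                   ∎

    zT²ᵈ⁻¹ : Unit
    zT²ᵈ⁻¹ = zᵘ *ᵘ Tᵘ ^ᵘ (2 ℕ.* d ∸ 1)

-- K stands for the field of Puiseux series, Small for the predicate of
-- having positive order, T for the tree series as an element of K, and
-- zT²ᵈ⁻¹ for that product as a unit.

module TreeEquation
  (K : CommutativeRing c ℓ)
  (Small : CommutativeRing.Carrier K → Set ℓ)
  (d : ℕ) (T : CommutativeRing.Carrier K) (zT²ᵈ⁻¹ : Units.Unit K)
  where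

  r : ℕ
  r = 2 ℕ.* d ∸ 1

  module K where
    open CommutativeRing K public
    open Exp commutativeSemiring public using (_^_)
    open BigOperators K public
    open Units K public

  IsSmallSolution : K.Unit → Set ℓ
  IsSmallSolution X = Small (value X) ×
    1# ≈ value zT²ᵈ⁻¹ * ∑ λ (i : Fin d) → X ^ᶻ odd i + X ^ᶻ (ℤ.- odd i)
    where open K

  record AreTheSmallSolutions (X : Fin r → K.Unit) : Set (c ⊔ ℓ) where
    open K using (_≈_; value)
    field
      small    : ∀ ℓ → IsSmallSolution (X ℓ)
      distinct : ∀ {ℓ ℓ′} → value (X ℓ) ≈ value (X ℓ′) → ℓ ≡ ℓ′
      complete : ∀ Y → IsSmallSolution Y → ∃ λ ℓ → value Y ≈ value (X ℓ)

  open Multivariate K public using (constant; indeterminate; coefficient; fromCoefficients)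

  K⟦α⟧ : CommutativeRing c ℓ
  K⟦α⟧ = Multivariate.ring K r

  module A where
    open CommutativeRing K⟦α⟧ public
    open Exp commutativeSemiring public using (_^_)
    open BigOperators K⟦α⟧ public

  ⟨_⟩ : K.Carrier → A.Carrier
  ⟨_⟩ = constant r

  -- The sum of all fₙ, for a family in which fₙ is a multiple of the
  -- monomial with exponent n: to the coefficient at m only the finitely
  -- many n ≤ m contribute.

  ∑∞ : (Vec ℕ r → A.Carrier) → A.Carrier
  ∑∞ f = fromCoefficients λ m → K.∑ₗ (splittings m) λ (n , _) → coefficient m (f n)

  module Labels (X : Fin r → K.Unit) (α : Vec ℕ r → A.Carrier) where

    -- 𝐗^ m n is the monomial X₁^(m n₁) ⋯ Xᵣ^(m nᵣ).

    𝐗^ : ℤ → Vec ℕ r → K.Carrier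
    𝐗^ m n = ∏ λ ℓ → X ℓ ^ᶻ (m ℤ.* + lookup n ℓ)
      where open K

    kernel : Vec ℕ r → K.Carrier
    kernel n = - inverse zT²ᵈ⁻¹ + ∑ λ (i : Fin d) → 𝐗^ (odd i) n + 𝐗^ (ℤ.- odd i) n
      where open K

    record IsCoefficientFamily : Set (c ⊔ ℓ) where
      open A

      private
        x^ : Fin r → ℕ → K.Carrier
        x^ ℓ k = K.value (X ℓ) K.^ k

        1-x^ : Fin r → ℕ → A.Carrier
        1-x^ ℓ k = ⟨ K.1# K.- x^ ℓ k ⟩

      field
        monomial : ∀ n → ∃ λ a → α n ≈ ⟨ a ⟩ * ∏ λ ℓ → α (axis ℓ 1) ^ lookup n ℓ

        unit-vector : ∀ ℓ → α (axis ℓ 1) ≈ indeterminate ℓ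

        zero-vector : α 𝟎 ≈ 0#

        -- The quotient defining αₙ for n = (1 + k) e_ℓ, with the denominator
        -- (nonzero since X_ℓ has positive order) multiplied out.
        one-nonzero : ∀ ℓ k →
          α (axis ℓ (suc k)) *
            (1-x^ ℓ (2 ℕ.* d ∸ 1) * 1-x^ ℓ 2 ^ k * 1-x^ ℓ (2 ℕ.* d ℕ.+ 1) ^ k)
          ≈ α (axis ℓ 1) ^ suc k * ⟨ x^ ℓ (2 ℕ.* k) ⟩ * 1-x^ ℓ (suc k ℕ.* (2 ℕ.* d ∸ 1))

        -- i stands for the summation index ℓ = 2 + i of the recursion.
        recursion : ∀ n → AtLeastTwoNonzero n →
          α n * ⟨ kernel n ⟩ ≈
          ∑ λ (i : Fin (2 ℕ.* d ∸ 1)) → let ℓ = 2 ℕ.+ toℕ i in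
            (- 1#) ^ ℓ *
            ∑ₗ (compositions ℓ n) λ g →
              ∏ (λ k → α (lookup g k)) *
              ⟨ K.∑ₗ (choose ℓ (B d)) (λ b → K.∏ λ k → 𝐗^ (lookup b k) (lookup g k)) ⟩

    ρ : ℤ → A.Carrier
    ρ j = ∑∞ λ n → α n * ⟨ 𝐗^ j n ⟩
      where open A

    T[_] : ℤ → A.Carrier
    T[ j ] = ⟨ T ⟩ * (1# - ρ j)
      where open A

module ℂTrees = TreeSeries ℂ

-- Compare the coefficients of the monomials αⁿ on both sides. The coefficient
-- of ρⱼ at n is aₙ 𝐗^{jn}, so expanding ∏_b (1 - ρ_{j+b}) in elementary symmetric
-- polynomials turns the coefficient at n into 𝐗^{jn} times the recursion for αₙ.
-- This settles every n with two nonzero coordinates.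
--
-- On the axis of X = X_ℓ the coefficients are explicit. Put y = X², Q = X²ᵈ⁻¹,
-- D = (1 - y)(1 - yQ), p = Xʲ and substitute D t for the indeterminate. Then ρⱼ
-- becomes a rational function of t with
--   1 - ρⱼ = (1 - pt)(1 - y²Qpt) / ((1 - ypt)(1 - yQpt)),
-- the product over B telescopes, and what remains is an identity between
-- polynomials of degree 2 in t, which follows from the characteristic equation.
-- All divisions are cancellations: 1 - Xᵏ with k ≥ 1 is no zero divisor because
-- X has positive order.

module Submission where

open import Algebra.Bundles using (CommutativeMonoid; CommutativeRing)
import Algebra.Properties.AbelianGroup as AbelianGroupProperties
import Algebra.Properties.CommutativeMonoid.Sum as FiniteSum
import Algebra.Properties.CommutativeSemiring.Exp as Exp
import Algebra.Properties.Group as GroupProperties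
import Algebra.Properties.Ring as RingProperties
import Algebra.Properties.Semiring.Mult.TCOptimised as Mult
import Algebra.Properties.Semiring.Sum as SemiringSum
import Algebra.Solver.Ring
open import Algebra.Solver.Ring.AlmostCommutativeRing using (fromCommutativeRing; _-Raw-AlmostCommutative⟶_)
open import Data.Bool.Base using (if_then_else_)
open import Data.Empty using (⊥-elim)
open import Data.Fin.Base as Fin using (Fin; zero; suc; toℕ)
import Data.Fin.Properties as Finₚ
open import Data.Integer.Base as ℤ using (ℤ; +_; -[1+_])
import Data.Integer.Properties as ℤₚ
open import Data.List.Base as List using (List; []; _∷_; _++_)
import Data.List.Properties as Listₚ
open import Data.List.Relation.Unary.All as All using (All; []; _∷_)
import Data.List.Relation.Unary.All.Properties as Allₚ
open import Data.Maybe.Base using (Maybe; just; nothing)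
open import Data.Nat.Base as ℕ using (ℕ; zero; suc; _∸_; NonZero; s≤s; z≤n)
open import Data.Nat.Divisibility using (divides; _∣?_)
import Data.Nat.Properties as ℕₚ
open import Data.Nat.Tactic.RingSolver using (solve-∀)
open import Data.Product.Base using (∃₂; _×_; _,_; proj₁; proj₂)
open import Data.Sum.Base using (_⊎_; inj₁; inj₂)
open import Data.Vec.Base as Vec using (Vec; []; _∷_; lookup; zipWith)
open import Data.Vec.Properties using (≡-dec; zipWith-identityʳ; lookup-zipWith; lookup-replicate)
open import Defs
open import Function.Base using (_∘_; id)
open import Level using (Level; _⊔_)
open import Relation.Binary.PropositionalEquality as ≡ using (_≡_; _≢_)
import Relation.Binary.Reasoning.Setoid as SetoidReasoning
open import Relation.Nullary using (yes; no; does)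

-- No decision procedure for equality is available in the coefficient ring, so an element that is
-- merely nonzero cannot be inverted. Fractions therefore stay cross-multiplied throughout, and this
-- shapes the statements of the one-variable identities.
--
-- The quantity w = zT²ᵈ⁻¹ links the two cases. The tree equation gives T = 1 + wT, and pulling T
-- out of every factor of the product turns the claim into T(1 - ρⱼ) = 1 + wT ∏ (1 - ρⱼ₊ᵦ), b in B.
-- Its inverse 1/w is the constant on the left of the recursion.
--
-- The denominators of 1 - ρⱼ on an axis come from writing 1 - Qᵏ⁺¹ as 1 - Q · Qᵏ in the explicit
-- coefficients: (1 - Q) ρⱼ is then a combination of two geometric series, of ratios yp and yQp.
-- Raising j by 2 multiplies p by y, so a numerator factor at one index is a denominator factor at a
-- neighbouring one; hence the telescoping along B, whose elements differ by 2.

private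
  variable
    ι c ℓ c′ ℓ′ : Level
    I : Set ι

-- The ring solver needs decidable coefficients to cancel x - x in an
-- arbitrary ring; the integers supply them.

module IntegerSolver (R : CommutativeRing c ℓ) where
  open CommutativeRing R
  open Mult semiring using (1+×; ×-homo-+; ×1-homo-*) renaming (_×_ to _×′_)
  open RingProperties ring using (-‿distribˡ-*; -‿distribʳ-*; -‿involutive; -0#≈0#)
  open AbelianGroupProperties +-abelianGroup using (⁻¹-∙-comm)
  open SetoidReasoning setoid

  private
    ⟦_⟧ℤ : ℤ → Carrier
    ⟦ + n ⟧ℤ      = n ×′ 1#
    ⟦ -[1+ n ] ⟧ℤ = - (suc n ×′ 1#)

    cancel-1 : ∀ x y → x - y ≈ (1# + x) - (1# + y)
    cancel-1 x y = sym (begin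
      (1# + x) - (1# + y)     ≈⟨ +-cong (+-comm 1# x) (sym (⁻¹-∙-comm 1# y)) ⟩
      (x + 1#) + (- 1# - y)   ≈⟨ +-assoc x 1# _ ⟩
      x + (1# + (- 1# - y))   ≈⟨ +-congˡ (+-assoc 1# (- 1#) (- y)) ⟨
      x + ((1# - 1#) - y)     ≈⟨ +-congˡ (+-congʳ (-‿inverseʳ 1#)) ⟩
      x + (0# - y)            ≈⟨ +-congˡ (+-identityˡ (- y)) ⟩
      x - y                   ∎)

    ⊖-homo : ∀ m n → ⟦ m ℤ.⊖ n ⟧ℤ ≈ m ×′ 1# - n ×′ 1#
    ⊖-homo m       zero    = sym (trans (+-congˡ -0#≈0#) (+-identityʳ _))
    ⊖-homo zero    (suc n) = sym (+-identityˡ _)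
    ⊖-homo (suc m) (suc n) = begin
      ⟦ suc m ℤ.⊖ suc n ⟧ℤ  ≡⟨ ≡.cong ⟦_⟧ℤ (ℤₚ.[1+m]⊖[1+n]≡m⊖n m n) ⟩
      ⟦ m ℤ.⊖ n ⟧ℤ          ≈⟨ ⊖-homo m n ⟩
      m ×′ 1# - n ×′ 1#       ≈⟨ cancel-1 _ _ ⟩
      (1# + m ×′ 1#) - (1# + n ×′ 1#)
        ≈⟨ +-cong (1+× m 1#) (-‿cong (1+× n 1#)) ⟨
      suc m ×′ 1# - suc n ×′ 1# ∎

    -‿homoℤ : ∀ i → ⟦ ℤ.- i ⟧ℤ ≈ - ⟦ i ⟧ℤ
    -‿homoℤ (+ zero)  = sym -0#≈0#
    -‿homoℤ (+ suc n) = refl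
    -‿homoℤ -[1+ n ]  = sym (-‿involutive _)

    +-homoℤ : ∀ i j → ⟦ i ℤ.+ j ⟧ℤ ≈ ⟦ i ⟧ℤ + ⟦ j ⟧ℤ
    +-homoℤ (+ m)    (+ n)    = ×-homo-+ 1# m n
    +-homoℤ (+ m)    -[1+ n ] = ⊖-homo m (suc n)
    +-homoℤ -[1+ m ] (+ n)    = trans (⊖-homo n (suc m)) (+-comm _ _)
    +-homoℤ -[1+ m ] -[1+ n ] = begin
      - (suc (suc (m ℕ.+ n)) ×′ 1#)     ≡⟨ ≡.cong (λ k → - (suc k ×′ 1#)) (ℕₚ.+-suc m n) ⟨
      - ((suc m ℕ.+ suc n) ×′ 1#)       ≈⟨ -‿cong (×-homo-+ 1# (suc m) (suc n)) ⟩
      - (suc m ×′ 1# + suc n ×′ 1#)      ≈⟨ ⁻¹-∙-comm _ _ ⟨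
      - (suc m ×′ 1#) - suc n ×′ 1#      ∎

    *-homo⁺ : ∀ m j → ⟦ + m ℤ.* j ⟧ℤ ≈ m ×′ 1# * ⟦ j ⟧ℤ
    *-homo⁺ m (+ n)    = trans (reflexive (≡.cong ⟦_⟧ℤ (≡.sym (ℤₚ.pos-* m n)))) (×1-homo-* m n)
    *-homo⁺ m -[1+ n ] = begin
      ⟦ + m ℤ.* ℤ.- (+ suc n) ⟧ℤ     ≡⟨ ≡.cong ⟦_⟧ℤ (ℤₚ.neg-distribʳ-* (+ m) (+ suc n)) ⟨
      ⟦ ℤ.- (+ m ℤ.* + suc n) ⟧ℤ     ≈⟨ -‿homoℤ (+ m ℤ.* + suc n) ⟩
      - ⟦ + m ℤ.* + suc n ⟧ℤ         ≈⟨ -‿cong (*-homo⁺ m (+ suc n)) ⟩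
      - (m ×′ 1# * (suc n ×′ 1#))      ≈⟨ -‿distribʳ-* _ _ ⟩
      m ×′ 1# * - (suc n ×′ 1#)        ∎

    *-homoℤ : ∀ i j → ⟦ i ℤ.* j ⟧ℤ ≈ ⟦ i ⟧ℤ * ⟦ j ⟧ℤ
    *-homoℤ (+ m)    j = *-homo⁺ m j
    *-homoℤ -[1+ m ] j = begin
      ⟦ ℤ.- (+ suc m) ℤ.* j ⟧ℤ       ≡⟨ ≡.cong ⟦_⟧ℤ (ℤₚ.neg-distribˡ-* (+ suc m) j) ⟨
      ⟦ ℤ.- (+ suc m ℤ.* j) ⟧ℤ       ≈⟨ -‿homoℤ (+ suc m ℤ.* j) ⟩
      - ⟦ + suc m ℤ.* j ⟧ℤ           ≈⟨ -‿cong (*-homo⁺ (suc m) j) ⟩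
      - (suc m ×′ 1# * ⟦ j ⟧ℤ)        ≈⟨ -‿distribˡ-* _ _ ⟩
      - (suc m ×′ 1#) * ⟦ j ⟧ℤ        ∎

    morphism : ℤ.+-*-rawRing -Raw-AlmostCommutative⟶ fromCommutativeRing R
    morphism = record
      { ⟦_⟧    = ⟦_⟧ℤ
      ; +-homo = +-homoℤ
      ; *-homo = *-homoℤ
      ; -‿homo = -‿homoℤ
      ; 0-homo = refl
      ; 1-homo = refl
      }

    _≟ᶜ_ : ∀ i j → Maybe (⟦ i ⟧ℤ ≈ ⟦ j ⟧ℤ)
    i ≟ᶜ j with i ℤₚ.≟ j
    ... | yes i≡j = just (reflexive (≡.cong ⟦_⟧ℤ i≡j))
    ... | no _    = nothing

  open Algebra.Solver.Ring ℤ.+-*-rawRing (fromCommutativeRing R) morphism _≟ᶜ_ public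
    using (Polynomial; solve; _:=_; _:+_; _:*_; _:-_; :-_; con)

  :1 : ∀ {n} → Polynomial n
  :1 = con (+ 1)

-- Folds over B as folds over the pairs of odd numbers ±(2i + 1)

module MonoidFold (M : CommutativeMonoid c ℓ) where
  open CommutativeMonoid M
  open FiniteSum M using (sum; sum-init-last; sum-cong-≗)
  open SetoidReasoning setoid

  fold : List I → (I → Carrier) → Carrier
  fold xs f = List.foldr _∙_ ε (List.map f xs)

  -- `sum` splits off the smallest index by computation, but the inductions below append the
  -- largest: passing from d to d + 1 leaves the earlier terms unchanged.
  sum-toℕ-last : ∀ (f : ℕ → Carrier) n → sum {suc n} (f ∘ toℕ) ≈ sum {n} (f ∘ toℕ) ∙ f n
  sum-toℕ-last f n = begin
    sum {suc n} (f ∘ toℕ)                              ≈⟨ sum-init-last (f ∘ toℕ) ⟩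
    sum {n} (f ∘ toℕ ∘ Fin.inject₁) ∙ f (toℕ (Fin.fromℕ n))
      ≡⟨ ≡.cong₂ _∙_ (sum-cong-≗ {n} (λ i → ≡.cong f (Finₚ.toℕ-inject₁ i)))
                     (≡.cong f (Finₚ.toℕ-fromℕ n)) ⟩
    sum {n} (f ∘ toℕ) ∙ f n                            ∎

  private
    foldUpTo : (ℕ → Carrier) → ℕ → Carrier
    foldUpTo h n = List.foldr _∙_ ε (List.applyUpTo h n)

    foldUpTo-cong : ∀ {g h} n → (∀ i → g i ≡ h i) → foldUpTo g n ≈ foldUpTo h n
    foldUpTo-cong zero    _  = refl
    foldUpTo-cong (suc n) eq = ∙-cong (reflexive (eq 0)) (foldUpTo-cong n (eq ∘ suc))

    foldUpTo-last : ∀ h n → foldUpTo h (suc n) ≈ foldUpTo h n ∙ h n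
    foldUpTo-last h zero    = comm _ _
    foldUpTo-last h (suc n) = trans (∙-congˡ (foldUpTo-last (h ∘ suc) n)) (sym (assoc _ _ _))

    -- The i-th element of B in a form free of truncated subtraction. It is invariant under raising
    -- d and i together, which drives the induction on d.
    centred : ℕ → ℕ → ℤ
    centred d i = suc (2 ℕ.* i) ℤ.⊖ 2 ℕ.* d

    centred-first : ∀ d → centred (suc d) 0 ≡ ℤ.- (+ suc (2 ℕ.* d))
    centred-first d = ≡.cong (1 ℤ.⊖_) (ℕₚ.*-suc 2 d)

    centred-suc : ∀ d i → centred (suc d) (suc i) ≡ centred d i
    centred-suc d i = ≡.trans (≡.cong₂ (λ m n → suc m ℤ.⊖ n) (ℕₚ.*-suc 2 i) (ℕₚ.*-suc 2 d))
      (≡.trans (ℤₚ.[1+m]⊖[1+n]≡m⊖n (2 ℕ.+ 2 ℕ.* i) (suc (2 ℕ.* d)))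
              (ℤₚ.[1+m]⊖[1+n]≡m⊖n (suc (2 ℕ.* i)) (2 ℕ.* d)))

    centred-last : ∀ d → centred (suc d) (suc (2 ℕ.* d)) ≡ + suc (2 ℕ.* d)
    centred-last d = ≡.trans (ℤₚ.⊖-≥ 2+2d≤) (≡.cong +_ (≡.trans (≡.cong (_∸ 2 ℕ.* suc d) (eq d))
                       (ℕₚ.m+n∸n≡m (suc (2 ℕ.* d)) (2 ℕ.* suc d))))
      where
      eq : ∀ d → suc (2 ℕ.* suc (2 ℕ.* d)) ≡ suc (2 ℕ.* d) ℕ.+ 2 ℕ.* suc d
      eq = solve-∀
      2+2d≤ : 2 ℕ.* suc d ℕ.≤ suc (2 ℕ.* suc (2 ℕ.* d))
      2+2d≤ = ≡.subst (2 ℕ.* suc d ℕ.≤_) (≡.sym (eq d)) (ℕₚ.m≤n+m (2 ℕ.* suc d) (suc (2 ℕ.* d)))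

    -- Passing from d to d + 1 adds one element at each end of the increasing list, -(2d + 1) and 2d
    -- + 1, and these two form the new pair.
    foldUpTo-centred : ∀ (f : ℤ → Carrier) d → foldUpTo (f ∘ centred d) (2 ℕ.* d) ≈
                       sum {d} λ i → f (odd i) ∙ f (ℤ.- odd i)
    foldUpTo-centred f zero    = refl
    foldUpTo-centred f (suc d) = begin
      foldUpTo g (2 ℕ.* suc d)                     ≡⟨ ≡.cong (foldUpTo g) (ℕₚ.*-suc 2 d) ⟩
      g 0 ∙ foldUpTo (g ∘ suc) (suc (2 ℕ.* d))     ≈⟨ ∙-congˡ (foldUpTo-last (g ∘ suc) (2 ℕ.* d)) ⟩
      g 0 ∙ (foldUpTo (g ∘ suc) (2 ℕ.* d) ∙ g (suc (2 ℕ.* d)))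
        ≈⟨ ∙-cong (reflexive (≡.cong f (centred-first d)))
             (∙-cong (foldUpTo-cong (2 ℕ.* d) (≡.cong f ∘ centred-suc d))
                     (reflexive (≡.cong f (centred-last d)))) ⟩
      f (ℤ.- (+ suc (2 ℕ.* d))) ∙ (foldUpTo (f ∘ centred d) (2 ℕ.* d) ∙ f (+ suc (2 ℕ.* d)))
        ≈⟨ comm _ _ ⟩
      (foldUpTo (f ∘ centred d) (2 ℕ.* d) ∙ f (+ suc (2 ℕ.* d))) ∙ f (ℤ.- (+ suc (2 ℕ.* d)))
        ≈⟨ assoc _ _ _ ⟩
      foldUpTo (f ∘ centred d) (2 ℕ.* d) ∙ pair d  ≈⟨ ∙-congʳ (foldUpTo-centred f d) ⟩
      sum {d} (pair ∘ toℕ) ∙ pair d                ≈⟨ sum-toℕ-last pair d ⟨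
      sum {suc d} (pair ∘ toℕ)                     ∎
      where
      g = f ∘ centred (suc d)
      pair = λ n → f (+ suc (2 ℕ.* n)) ∙ f (ℤ.- (+ suc (2 ℕ.* n)))

  -- The generality of a commutative monoid serves two purposes: the product of the 1 - ρⱼ₊ᵦ, and
  -- the sum of the 𝐗ᵇⁿ in the kernel of the recursion.
  fold-B : ∀ d .{{_ : NonZero d}} (f : ℤ → Carrier) →
           fold (B d) f ≈ sum {d} λ i → f (odd i) ∙ f (ℤ.- odd i)
  fold-B d@(suc d′) f = begin
    fold (B d) f
      ≡⟨ ≡.cong (List.foldr _∙_ ε) (≡.trans (≡.sym (Listₚ.map-∘ (List.upTo (2 ℕ.* d))))
                                            (Listₚ.map-upTo _ (2 ℕ.* d))) ⟩
    foldUpTo (λ i → f (+ (2 ℕ.* i) ℤ.- + (2 ℕ.* d ∸ 1))) (2 ℕ.* d)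
      ≈⟨ foldUpTo-cong (2 ℕ.* d) (λ i → ≡.cong f (shift i)) ⟩
    foldUpTo (f ∘ centred d) (2 ℕ.* d)
      ≈⟨ foldUpTo-centred f d ⟩
    sum {d} (λ i → f (odd i) ∙ f (ℤ.- odd i)) ∎
    where
    shift : ∀ i → + (2 ℕ.* i) ℤ.- + (2 ℕ.* d ∸ 1) ≡ centred d i
    -- As `d` is a successor, `2 ℕ.* d` computes to the successor of `2 ℕ.* d ∸ 1`, so both
    -- arguments of `⊖` can be raised by one.
    shift i = ≡.trans (ℤₚ.m-n≡m⊖n (2 ℕ.* i) (2 ℕ.* d ∸ 1))
                (≡.sym (ℤₚ.[1+m]⊖[1+n]≡m⊖n (2 ℕ.* i) (2 ℕ.* d ∸ 1)))

-- Sums over lists and elementary symmetric polynomials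

module ListSums (R : CommutativeRing c ℓ) where
  open CommutativeRing R
  open BigOperators R
  open Exp commutativeSemiring using (_^_)
  open SemiringSum semiring using (sum-cong-≋; ∑-distrib-+; *-distribˡ-sum; sum-replicate-zero)
  open IntegerSolver R
  open SetoidReasoning setoid

  ∑ₗ-cong-All : ∀ {xs : List I} {f g} → All (λ x → f x ≈ g x) xs → ∑ₗ xs f ≈ ∑ₗ xs g
  ∑ₗ-cong-All []         = refl
  ∑ₗ-cong-All (eq ∷ eqs) = +-cong eq (∑ₗ-cong-All eqs)

  ∑ₗ-cong : ∀ (xs : List I) {f g} → (∀ x → f x ≈ g x) → ∑ₗ xs f ≈ ∑ₗ xs g
  ∑ₗ-cong xs eq = ∑ₗ-cong-All (All.universal eq xs)

  ∑ₗ-++ : ∀ (xs ys : List I) f → ∑ₗ (xs ++ ys) f ≈ ∑ₗ xs f + ∑ₗ ys f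
  ∑ₗ-++ []       ys f = sym (+-identityˡ _)
  ∑ₗ-++ (x ∷ xs) ys f = trans (+-congˡ (∑ₗ-++ xs ys f)) (sym (+-assoc _ _ _))

  ∑ₗ-map : ∀ {b} {J : Set b} (g : I → J) xs f → ∑ₗ (List.map g xs) f ≈ ∑ₗ xs (f ∘ g)
  ∑ₗ-map g []       f = refl
  ∑ₗ-map g (x ∷ xs) f = +-congˡ (∑ₗ-map g xs f)

  ∑ₗ-concatMap : ∀ {b} {J : Set b} (g : I → List J) xs f →
                 ∑ₗ (List.concatMap g xs) f ≈ ∑ₗ xs λ x → ∑ₗ (g x) f
  ∑ₗ-concatMap g []       f = refl
  ∑ₗ-concatMap g (x ∷ xs) f =
    trans (∑ₗ-++ (g x) (List.concatMap g xs) f) (+-congˡ (∑ₗ-concatMap g xs f))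

  ∑ₗ-distribˡ : ∀ x (xs : List I) f → x * ∑ₗ xs f ≈ ∑ₗ xs λ i → x * f i
  ∑ₗ-distribˡ x []       f = zeroʳ x
  ∑ₗ-distribˡ x (i ∷ xs) f = trans (distribˡ _ _ _) (+-congˡ (∑ₗ-distribˡ x xs f))

  ∑ₗ-+ : ∀ (xs : List I) f g → ∑ₗ xs (λ i → f i + g i) ≈ ∑ₗ xs f + ∑ₗ xs g
  ∑ₗ-+ []       f g = sym (+-identityˡ 0#)
  ∑ₗ-+ (i ∷ xs) f g = trans (+-congˡ (∑ₗ-+ xs f g))
    (solve 4 (λ a b x y → (a :+ b) :+ (x :+ y) := (a :+ x) :+ (b :+ y)) refl _ _ _ _)

  ∑ₗ-zero : ∀ (xs : List I) → ∑ₗ xs (λ _ → 0#) ≈ 0#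
  ∑ₗ-zero []       = refl
  ∑ₗ-zero (_ ∷ xs) = trans (+-identityˡ _) (∑ₗ-zero xs)

  ∑ₗ-swap : ∀ {b} {J : Set b} (xs : List I) (ys : List J) (f : I → J → Carrier) →
            ∑ₗ xs (λ x → ∑ₗ ys (f x)) ≈ ∑ₗ ys λ y → ∑ₗ xs λ x → f x y
  ∑ₗ-swap []       ys f = sym (∑ₗ-zero ys)
  ∑ₗ-swap (x ∷ xs) ys f = trans (+-congˡ (∑ₗ-swap xs ys f)) (sym (∑ₗ-+ ys _ _))

  ∏ₗ : List I → (I → Carrier) → Carrier
  ∏ₗ = MonoidFold.fold *-commutativeMonoid

  module _ {I : Set ι} (f : I → Carrier) where

    elementarySymmetric : ℕ → List I → Carrier
    elementarySymmetric k xs = ∑ₗ (choose k xs) λ b → ∏ λ i → f (lookup b i)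

    elementarySymmetric-∷ : ∀ k x xs → elementarySymmetric (suc k) (x ∷ xs) ≈
                            f x * elementarySymmetric k xs + elementarySymmetric (suc k) xs
    elementarySymmetric-∷ k x xs = begin
      elementarySymmetric (suc k) (x ∷ xs)
        ≈⟨ ∑ₗ-++ (List.map (x ∷_) (choose k xs)) (choose (suc k) xs) _ ⟩
      ∑ₗ (List.map (x ∷_) (choose k xs)) (λ b → ∏ λ i → f (lookup b i)) + elementarySymmetric (suc k) xs
        ≈⟨ +-congʳ (∑ₗ-map (x ∷_) (choose k xs) _) ⟩
      ∑ₗ (choose k xs) (λ b → f x * ∏ λ i → f (lookup b i)) + elementarySymmetric (suc k) xs
        ≈⟨ +-congʳ (∑ₗ-distribˡ (f x) (choose k xs) _) ⟨
      f x * elementarySymmetric k xs + elementarySymmetric (suc k) xs ∎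

    private
      alternating : ℕ → List I → Carrier
      alternating n xs = ∑ {n} λ i → (- 1#) ^ toℕ i * elementarySymmetric (toℕ i) xs

      alternating-∷ : ∀ n x xs → alternating (suc n) (x ∷ xs) ≈
                      alternating (suc n) xs - f x * alternating n xs
      alternating-∷ n x xs = begin
        1# * e 0 + ∑ {n} (λ i → - 1# * m i * elementarySymmetric (suc (toℕ i)) (x ∷ xs))
          ≈⟨ +-congˡ (trans (sum-cong-≋ {n} (λ i →
               trans (*-congˡ (elementarySymmetric-∷ (toℕ i) x xs)) (step (m i) (f x) _ _)))
               (∑-distrib-+ {n} _ _)) ⟩
        1# * e 0 + (∑ {n} (λ i → - 1# * m i * e (suc (toℕ i))) + ∑ {n} (λ i → - f x * (m i * e (toℕ i))))
          ≈⟨ +-assoc _ _ _ ⟨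
        alternating (suc n) xs + ∑ {n} (λ i → - f x * (m i * e (toℕ i)))
          ≈⟨ +-congˡ (*-distribˡ-sum {n} (- f x) _) ⟨
        alternating (suc n) xs + - f x * alternating n xs
          ≈⟨ solve 3 (λ a x b → a :+ (:- x) :* b := a :- x :* b) refl _ (f x) _ ⟩
        alternating (suc n) xs - f x * alternating n xs ∎
        where
        e = λ k → elementarySymmetric k xs
        m : Fin n → Carrier
        m i = (- 1#) ^ toℕ i
        step : ∀ m x a b → - 1# * m * (x * a + b) ≈ - 1# * m * b + - x * (m * a)
        step = solve 4 (λ m x a b → :- con (+ 1) :* m :* (x :* a :+ b)
                 := :- con (+ 1) :* m :* b :+ (:- x) :* (m :* a)) refl

    -- Terms beyond the length vanish because no subset is that large. Leaving the number of terms
    -- free makes the induction work: adjoining x requires the hypothesis for `xs` with n + 1 terms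
    -- and, for the part divisible by f x, with n terms.
    ∏ₗ-expand : ∀ xs n → List.length xs ℕ.< n → ∏ₗ xs (λ x → 1# - f x) ≈
                ∑ {n} λ i → (- 1#) ^ toℕ i * elementarySymmetric (toℕ i) xs
    ∏ₗ-expand []       (suc n) _ = sym (begin
      1# * (1# + 0#) + ∑ {n} (λ i → (- 1#) ^ suc (toℕ i) * 0#)
        ≈⟨ +-cong (trans (*-identityˡ _) (+-identityʳ 1#))
             (trans (sum-cong-≋ {n} (λ i → zeroʳ _)) (sum-replicate-zero n)) ⟩
      1# + 0#  ≈⟨ +-identityʳ 1# ⟩
      1#       ∎)
    ∏ₗ-expand (x ∷ xs) (suc n) (s≤s ∣xs∣<n) = sym (begin
      alternating (suc n) (x ∷ xs)                       ≈⟨ alternating-∷ n x xs ⟩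
      alternating (suc n) xs - f x * alternating n xs
        ≈⟨ +-cong (∏ₗ-expand xs (suc n) (ℕₚ.m<n⇒m<1+n ∣xs∣<n))
             (-‿cong (*-congˡ (∏ₗ-expand xs n ∣xs∣<n))) ⟨
      ∏ₗ xs (λ x → 1# - f x) - f x * ∏ₗ xs (λ x → 1# - f x)
        ≈⟨ solve 2 (λ p x → p :- x :* p := (con (+ 1) :- x) :* p) refl _ (f x) ⟩
      (1# - f x) * ∏ₗ xs (λ x → 1# - f x) ∎)

-- Ring homomorphisms

record RingHom (R : CommutativeRing c ℓ) (S : CommutativeRing c′ ℓ′) : Set (c ⊔ ℓ ⊔ c′ ⊔ ℓ′) where
  private
    module R = CommutativeRing R
    module S = CommutativeRing S
  field
    ⟦_⟧    : R.Carrier → S.Carrier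
    ⟦⟧-cong : ∀ {x y} → x R.≈ y → ⟦ x ⟧ S.≈ ⟦ y ⟧
    +-homo  : ∀ x y → ⟦ x R.+ y ⟧ S.≈ ⟦ x ⟧ S.+ ⟦ y ⟧
    *-homo  : ∀ x y → ⟦ x R.* y ⟧ S.≈ ⟦ x ⟧ S.* ⟦ y ⟧
    1-homo  : ⟦ R.1# ⟧ S.≈ S.1#

  open GroupProperties S.+-group using (identityˡ-unique; inverseˡ-unique)

  0-homo : ⟦ R.0# ⟧ S.≈ S.0#
  0-homo = identityˡ-unique _ _ (S.trans (S.sym (+-homo R.0# R.0#)) (⟦⟧-cong (R.+-identityˡ R.0#)))

  -‿homo : ∀ x → ⟦ R.- x ⟧ S.≈ S.- ⟦ x ⟧
  -‿homo x = inverseˡ-unique _ _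
    (S.trans (S.sym (+-homo (R.- x) x)) (S.trans (⟦⟧-cong (R.-‿inverseˡ x)) 0-homo))

  minus-homo : ∀ x y → ⟦ x R.- y ⟧ S.≈ ⟦ x ⟧ S.- ⟦ y ⟧
  minus-homo x y = S.trans (+-homo x (R.- y)) (S.+-congˡ (-‿homo y))

  ∏-homo : ∀ {n} (f : Fin n → R.Carrier) →
           ⟦ BigOperators.∏ R f ⟧ S.≈ BigOperators.∏ S (λ i → ⟦ f i ⟧)
  ∏-homo {zero}  f = 1-homo
  ∏-homo {suc n} f = S.trans (*-homo _ _) (S.*-congˡ (∏-homo (f ∘ suc)))

  open Exp R.commutativeSemiring using () renaming (_^_ to _^ᴿ_)
  open Exp S.commutativeSemiring using () renaming (_^_ to _^ˢ_)

  ^-homo : ∀ x n → ⟦ x ^ᴿ n ⟧ S.≈ ⟦ x ⟧ ^ˢ n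
  ^-homo x zero    = 1-homo
  ^-homo x (suc n) = S.trans (*-homo _ _) (S.*-congˡ (^-homo x n))

infixr 9 _∘ʰ_

_∘ʰ_ : ∀ {c ℓ c′ ℓ′ c″ ℓ″} {R : CommutativeRing c ℓ} {S : CommutativeRing c′ ℓ′}
       {U : CommutativeRing c″ ℓ″} → RingHom S U → RingHom R S → RingHom R U
_∘ʰ_ {U = U} g f = record
  { ⟦_⟧     = λ x → G.⟦ F.⟦ x ⟧ ⟧
  ; ⟦⟧-cong = λ eq → G.⟦⟧-cong (F.⟦⟧-cong eq)
  ; +-homo  = λ x y → U.trans (G.⟦⟧-cong (F.+-homo x y)) (G.+-homo _ _)
  ; *-homo  = λ x y → U.trans (G.⟦⟧-cong (F.*-homo x y)) (G.*-homo _ _)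
  ; 1-homo  = U.trans (G.⟦⟧-cong F.1-homo) G.1-homo
  }
  where
  module F = RingHom f
  module G = RingHom g
  module U = CommutativeRing U

-- Cancellable elements

module Cancellation (R : CommutativeRing c ℓ) where
  open CommutativeRing R
  open Exp commutativeSemiring using (_^_)
  open IntegerSolver R
  open GroupProperties +-group using () renaming (x∙y⁻¹≈ε⇒x≈y to x-y≈0⇒x≈y; x≈y⇒x∙y⁻¹≈ε to x≈y⇒x-y≈0)

  Cancellable : Carrier → Set (c ⊔ ℓ)
  Cancellable u = ∀ {x y} → u * x ≈ u * y → x ≈ y

  *-cancellable : ∀ {u v} → Cancellable u → Cancellable v → Cancellable (u * v)
  *-cancellable cu cv eq = cv (cu (trans (sym (*-assoc _ _ _)) (trans eq (*-assoc _ _ _))))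

  ^-cancellable : ∀ {u} n → Cancellable u → Cancellable (u ^ n)
  ^-cancellable zero    cu eq = trans (sym (*-identityˡ _)) (trans eq (*-identityˡ _))
  ^-cancellable (suc n) cu    = *-cancellable cu (^-cancellable n cu)

  -- If (1 - x) y = (1 - x) z, then y - z is fixed under multiplication by x. In the applications
  -- such multiplication raises the order, which forces a fixed element to be 0.
  1-x-cancellable : ∀ {x} → (∀ y → y ≈ x * y → y ≈ 0#) → Cancellable (1# - x)
  1-x-cancellable {x} fixed {y} {z} eq = x-y≈0⇒x≈y y z (fixed (y - z) (x-y≈0⇒x≈y _ _
    (trans (solve 3 (λ x y z → (y :- z) :- x :* (y :- z) :=
        (con (+ 1) :- x) :* y :- (con (+ 1) :- x) :* z) refl x y z)
      (x≈y⇒x-y≈0 eq))))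

-- Power series in one variable: orders, rescaling, geometric series

module SeriesProperties (R : CommutativeRing c ℓ) where
  open CommutativeRing R
  open PowerSeries R
  open ListSums R
  open BigOperators R using (∑ₗ)
  open Exp commutativeSemiring using (_^_)
  private
    module S = CommutativeRing commutativeRing
  open Exp S.commutativeSemiring using (^-homo-*) renaming (_^_ to _^ˢ_)
  private
    module I = IntegerSolver R
    module IS = IntegerSolver commutativeRing
    module C = Cancellation R
    module CS = Cancellation commutativeRing

  constʰ : RingHom R commutativeRing
  constʰ = record
    { ⟦_⟧     = const
    ; ⟦⟧-cong = λ { eq zero → eq ; eq (suc n) → refl }
    ; +-homo  = λ { x y zero → refl ; x y (suc n) → sym (+-identityˡ 0#) }
    ; *-homo  = λ { x y zero → refl ; x y (suc n) → sym (trans (const-* x (const y) (suc n)) (zeroʳ x)) }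
    ; 1-homo  = S.refl
    }

  headʰ : RingHom commutativeRing R
  headʰ = record
    { ⟦_⟧     = λ f → f 0
    ; ⟦⟧-cong = λ eq → eq 0
    ; +-homo  = λ _ _ → refl
    ; *-homo  = λ _ _ → refl
    ; 1-homo  = refl
    }

  -- Passes from the recursive product to the sum over i ≤ n, the form in which `splittings`
  -- enumerates each coordinate.
  convolution : ∀ f g n → (f *ˢ g) n ≈ ∑ₗ (List.upTo (suc n)) λ i → f i * g (n ∸ i)
  convolution f g n = trans (go f n) (reflexive (≡.cong (List.foldr _+_ 0#)
                        (≡.sym (Listₚ.map-upTo (λ i → f i * g (n ∸ i)) (suc n)))))
    where
    go : ∀ f n → (f *ˢ g) n ≈ List.foldr _+_ 0# (List.applyUpTo (λ i → f i * g (n ∸ i)) (suc n))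
    go f zero    = sym (+-identityʳ _)
    go f (suc n) = +-congˡ (go (tail f) n)

  -- The substitution t ↦ x t. Taken at x = D, it clears the denominators of the coefficients on an
  -- axis.
  scaleʰ : Carrier → RingHom commutativeRing commutativeRing
  scaleʰ x = record
    { ⟦_⟧     = scale
    ; ⟦⟧-cong = λ eq n → *-congˡ (eq n)
    ; +-homo  = λ f g n → distribˡ _ _ _
    ; *-homo  = scale-*
    ; 1-homo  = λ { zero → *-identityˡ 1# ; (suc n) → zeroʳ _ }
    }
    where
    scale : Series → Series
    scale f n = x ^ n * f n

    scale-* : ∀ f g → scale (f *ˢ g) ≈ˢ scale f *ˢ scale g
    scale-* f g zero    = solve 2 (λ a b → con (+ 1) :* (a :* b) := con (+ 1) :* a :* (con (+ 1) :* b))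
                            refl (f 0) (g 0)
      where open I
    scale-* f g (suc n) = begin
      x * x ^ n * (f 0 * g (suc n) + (tail f *ˢ g) n)
        ≈⟨ solve 5 (λ x p a b t → x :* p :* (a :* b :+ t)
             := con (+ 1) :* a :* (x :* p :* b) :+ x :* (p :* t)) refl x (x ^ n) (f 0) (g (suc n)) _ ⟩
      1# * f 0 * (x * x ^ n * g (suc n)) + x * (x ^ n * (tail f *ˢ g) n)
        ≈⟨ +-congˡ (*-congˡ (scale-* (tail f) g n)) ⟩
      1# * f 0 * (x * x ^ n * g (suc n)) + x * (scale (tail f) *ˢ scale g) n
        ≈⟨ +-congˡ (const-* x _ n) ⟨
      1# * f 0 * (x * x ^ n * g (suc n)) + (const x *ˢ (scale (tail f) *ˢ scale g)) n
        ≈⟨ +-congˡ (S.trans (S.sym (S.*-assoc (const x) (scale (tail f)) (scale g)))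
                            (S.*-congʳ tail-scale) n) ⟩
      1# * f 0 * (x * x ^ n * g (suc n)) + (tail (scale f) *ˢ scale g) n ∎
      where
      open I
      open SetoidReasoning setoid
      tail-scale : const x *ˢ scale (tail f) ≈ˢ tail (scale f)
      tail-scale i = trans (const-* x (scale (tail f)) i) (sym (*-assoc _ _ _))

  const-cancellable : ∀ {x} → C.Cancellable x → CS.Cancellable (const x)
  const-cancellable cx eq n = cx (trans (sym (const-* _ _ n)) (trans (eq n) (const-* _ _ n)))

  -- Order at least k. A lower bound is used in place of the order itself, which could not be
  -- computed without deciding which coefficients vanish.
  Low : ℕ → Series → Set ℓ
  Low k f = ∀ {i} → i ℕ.< k → f i ≈ 0#

  low-cong : ∀ {k f g} → f ≈ˢ g → Low k f → Low k g
  low-cong eq low i<k = trans (sym (eq _)) (low i<k)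

  low-weaken : ∀ {k m f} → k ℕ.≤ m → Low m f → Low k f
  low-weaken k≤m low i<k = low (ℕₚ.<-≤-trans i<k k≤m)

  low-var^-* : ∀ k f → Low k (var ^ˢ k *ˢ f)
  low-var^-* k f = var^-*-low k f

  low⇒var^-* : ∀ {k f} → Low k f → f ≈ˢ var ^ˢ k *ˢ (λ i → f (k ℕ.+ i))
  low⇒var^-* {k} {f} low n with ℕₚ.<-≤-connex n k
  ... | inj₁ n<k = trans (low n<k) (sym (var^-*-low k _ n<k))
  ... | inj₂ k≤n = ≡.subst (λ m → f m ≈ (var ^ˢ k *ˢ (λ i → f (k ℕ.+ i))) m) (ℕₚ.m+[n∸m]≡n k≤n)
                     (sym (var^-*-high k _ (n ∸ k)))

  low-* : ∀ {k m f g} → Low k f → Low m g → Low (k ℕ.+ m) (f *ˢ g)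
  low-* {k} {m} {f} {g} low-f low-g = low-cong (S.sym (begin
      f *ˢ g
        ≈⟨ S.*-cong (low⇒var^-* low-f) (low⇒var^-* low-g) ⟩
      (var ^ˢ k *ˢ f′) *ˢ (var ^ˢ m *ˢ g′)
        ≈⟨ IS.solve 4 (λ a f b g → (a IS.:* f) IS.:* (b IS.:* g) IS.:= (a IS.:* b) IS.:* (f IS.:* g))
             S.refl (var ^ˢ k) f′ (var ^ˢ m) g′ ⟩
      (var ^ˢ k *ˢ var ^ˢ m) *ˢ (f′ *ˢ g′)
        ≈⟨ S.*-congʳ (^-homo-* var k m) ⟨
      var ^ˢ (k ℕ.+ m) *ˢ (f′ *ˢ g′) ∎))
    (low-var^-* (k ℕ.+ m) (f′ *ˢ g′))
    where
    open SetoidReasoning S.setoid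
    f′ = λ i → f (k ℕ.+ i)
    g′ = λ i → g (m ℕ.+ i)

  -- If h has order at least N, the product f h has order at least e + 1 + N, so the equation raises
  -- the bound for h to N + 1; by induction every coefficient of h is 0. The power tᵉ absorbs the
  -- denominators of Laurent series.
  low-shift-fixed : ∀ {e f h} → Low (suc e) f → var ^ˢ e *ˢ h ≈ˢ f *ˢ h → ∀ n → h n ≈ 0#
  low-shift-fixed {e} {f} {h} low-f eq n = low-h (suc n) (ℕₚ.n<1+n n)
    where
    low-h : ∀ N → Low N h
    low-h (suc N) {i} (s≤s i≤N) = trans (sym (var^-*-high e h i)) (trans (eq (e ℕ.+ i))
      (low-* low-f (low-h N) (s≤s (ℕₚ.+-monoʳ-≤ e i≤N))))

  linear : Carrier → Series
  linear x = S.1# S.- const x *ˢ var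

  linear-cong : ∀ {x y} → x ≈ y → linear x ≈ˢ linear y
  linear-cong eq = S.+-congˡ (S.-‿cong (S.*-congʳ (RingHom.⟦⟧-cong constʰ eq)))

  linear-cancellable : ∀ x → CS.Cancellable (linear x)
  linear-cancellable x = CS.1-x-cancellable λ h eq → low-shift-fixed {0} {const x *ˢ var} low
    (S.trans (S.*-identityˡ h) eq)
    where
    low : Low 1 (const x *ˢ var)
    low (s≤s z≤n) = zeroʳ x

  geometric : Carrier → Series
  geometric x n = x ^ n

  linear-geometric : ∀ x → linear x *ˢ geometric x ≈ˢ S.1#
  linear-geometric x n = trans (expand n) (go n)
    where
    expand : linear x *ˢ geometric x ≈ˢ geometric x S.- const x *ˢ (var *ˢ geometric x)
    expand = IS.solve 3 (λ c t g → (IS.con (+ 1) IS.:- c IS.:* t) IS.:* g IS.:= g IS.:- c IS.:* (t IS.:* g))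
               S.refl (const x) var (geometric x)
    go : ∀ n → (geometric x S.- const x *ˢ (var *ˢ geometric x)) n ≈ S.1# n
    go zero    = I.solve 1 (λ x → I.con (+ 1) I.:- x I.:* (I.con (+ 0) I.:* I.con (+ 1)) I.:= I.con (+ 1))
                   refl x
    go (suc n) = trans (+-congˡ (-‿cong (trans (const-* x _ (suc n)) (*-congˡ (var-*-suc (geometric x) n)))))
                   (-‿inverseʳ _)

mapʰ : ∀ {R : CommutativeRing c ℓ} {S : CommutativeRing c′ ℓ′} →
       RingHom R S → RingHom (PowerSeries.commutativeRing R) (PowerSeries.commutativeRing S)
mapʰ {R = R} {S = S} h = record
  { ⟦_⟧     = λ f n → ⟦ f n ⟧
  ; ⟦⟧-cong = λ eq n → ⟦⟧-cong (eq n)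
  ; +-homo  = λ f g n → +-homo (f n) (g n)
  ; *-homo  = map-*
  ; 1-homo  = λ { zero → 1-homo ; (suc n) → 0-homo }
  }
  where
  open RingHom h
  module R = PowerSeries R
  module S = PowerSeries S
  open CommutativeRing S
  map-* : ∀ f g n → ⟦ (f R.*ˢ g) n ⟧ ≈ ((λ i → ⟦ f i ⟧) S.*ˢ (λ i → ⟦ g i ⟧)) n
  map-* f g zero    = *-homo (f 0) (g 0)
  map-* f g (suc n) = trans (+-homo _ _) (+-cong (*-homo _ _) (map-* (R.tail f) g n))

-- Orders of Puiseux series

module PuiseuxProperties (R : CommutativeRing c ℓ) where
  open Puiseux R
  private
    module R = CommutativeRing R
    module S = CommutativeRing La.PS.commutativeRing
    module K = CommutativeRing commutativeRing
    module LP = SeriesProperties R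
  open Exp K.commutativeSemiring using (_^_)
  open Cancellation commutativeRing
  open La using (_/t^_)
  open La.PS using (var; _*ˢ_)
  open Exp S.commutativeSemiring using (^-homo-*) renaming (_^_ to _^ˢ_)

  NonnegativeOrder : Puiseux → Set ℓ
  NonnegativeOrder ((f /t^ s) at _) = LP.Low s f

  low-dilate : ∀ m .{{_ : NonZero m}} {k f} → LP.Low k f → LP.Low (m ℕ.* k) (La.PS.dilate m f)
  low-dilate m {k} low {i} i<mk with m ∣? i
  ... | yes (divides q ≡.refl) = low (ℕₚ.*-cancelˡ-< m q k (≡.subst (ℕ._< m ℕ.* k) (ℕₚ.*-comm q m) i<mk))
  ... | no _ = R.refl

  positive⇒low : ∀ {f s} → La.PositiveOrder (f /t^ s) → LP.Low (suc s) f
  positive⇒low pos (s≤s i≤s) = pos _ i≤s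

  positive⇒nonnegative : ∀ {x} → PositiveOrder x → NonnegativeOrder x
  positive⇒nonnegative pos i<s = pos _ (ℕₚ.<⇒≤ i<s)

  low-dilate-suc : ∀ m .{{_ : NonZero m}} {s f} → LP.Low (suc s) f → LP.Low (suc (m ℕ.* s)) (La.PS.dilate m f)
  low-dilate-suc m {s} low = LP.low-weaken
    (≡.subst (suc (m ℕ.* s) ℕ.≤_) (≡.sym (ℕₚ.*-suc m s)) (ℕₚ.+-monoˡ-≤ (m ℕ.* s) (ℕ.>-nonZero⁻¹ m)))
    (low-dilate m low)

  -- The hypotheses are asymmetric so that powers can be treated by induction: in x · xⁿ the second
  -- factor may be x⁰ = 1, of order 0.
  positive-* : ∀ x y → PositiveOrder x → NonnegativeOrder y → PositiveOrder (x *ᴾ y)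
  positive-* ((f /t^ s) at m) ((g /t^ u) at n) pos nonneg i i≤ =
    LP.low-* {suc (n ℕ.* s)} {m ℕ.* u} {La.PS.dilate n f} {La.PS.dilate m g}
      (low-dilate-suc n {s} {f} (positive⇒low {f} {s} pos)) (low-dilate m {u} {g} nonneg) (s≤s i≤)

  nonnegative-^ : ∀ x n → PositiveOrder x → NonnegativeOrder (x ^ n)
  positive-^ : ∀ x n → PositiveOrder x → PositiveOrder (x ^ suc n)
  nonnegative-^ x zero    pos ()
  nonnegative-^ x (suc n) pos = positive⇒nonnegative {x ^ suc n} (positive-^ x n pos)
  positive-^ x n pos = positive-* x (x ^ n) pos (nonnegative-^ x n pos)

  -- At a common ramification and with denominators cleared, y = x y reads tᵉ H = F H with H a
  -- dilation of the numerator of y. Positivity of the order of x says that the order of F exceeds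
  -- e, and `low-shift-fixed` applies.
  positive-fixed : ∀ x → PositiveOrder x → ∀ y → y ≈ x *ᴾ y → y ≈ 0ᴾ
  positive-fixed ((f /t^ s) at m) pos ((h /t^ u) at n) (cross (La.cross eq)) =
    cross (La.cross (S.trans (zero-* (var ^ˢ (n ℕ.* 0)) (S.trans (La.PS.dilate-cong 1 h≈0) (La.PS.dilate-0 1)))
                              (S.sym (zero-* (var ^ˢ (1 ℕ.* u)) (La.PS.dilate-0 n)))))
    where
    instance
      _ = ℕₚ.m*n≢0 m n
      _ = ℕₚ.m*n≢0 n m
    D = La.PS.dilate
    F = D n (D n f)
    H = D (m ℕ.* n) h
    e = n ℕ.* (n ℕ.* s)

    exponent : ∀ m n s u → n ℕ.* (n ℕ.* s ℕ.+ m ℕ.* u) ≡ m ℕ.* n ℕ.* u ℕ.+ n ℕ.* (n ℕ.* s)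
    exponent = solve-∀

    dilate-≡ : ∀ {k l} .{{_ : NonZero k}} .{{_ : NonZero l}} → k ≡ l → D k h S.≈ D l h
    dilate-≡ ≡.refl = S.refl

    fixed : var ^ˢ e *ˢ H S.≈ F *ˢ H
    fixed = La.PS.var^-cancelˡ (m ℕ.* n ℕ.* u) (begin
      var ^ˢ (m ℕ.* n ℕ.* u) *ˢ (var ^ˢ e *ˢ H)
        ≈⟨ S.*-assoc (var ^ˢ (m ℕ.* n ℕ.* u)) (var ^ˢ e) H ⟨
      var ^ˢ (m ℕ.* n ℕ.* u) *ˢ var ^ˢ e *ˢ H
        ≈⟨ S.*-congʳ {H} (^-homo-* var (m ℕ.* n ℕ.* u) e) ⟨
      var ^ˢ (m ℕ.* n ℕ.* u ℕ.+ e) *ˢ H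
        ≡⟨ ≡.cong (λ k → var ^ˢ k *ˢ H) (exponent m n s u) ⟨
      var ^ˢ (n ℕ.* (n ℕ.* s ℕ.+ m ℕ.* u)) *ˢ H
        ≈⟨ S.*-comm _ H ⟩
      H *ˢ var ^ˢ (n ℕ.* (n ℕ.* s ℕ.+ m ℕ.* u))
        ≈⟨ eq ⟩
      D n (D n f *ˢ D m h) *ˢ var ^ˢ (m ℕ.* n ℕ.* u)
        ≈⟨ S.*-congʳ {var ^ˢ (m ℕ.* n ℕ.* u)} (S.trans (La.PS.dilate-* n (D n f) (D m h))
             (S.*-congˡ {F} (S.trans (La.PS.dilate-dilate n m h) (dilate-≡ (ℕₚ.*-comm n m))))) ⟩
      F *ˢ H *ˢ var ^ˢ (m ℕ.* n ℕ.* u)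
        ≈⟨ S.*-comm (F *ˢ H) _ ⟩
      var ^ˢ (m ℕ.* n ℕ.* u) *ˢ (F *ˢ H) ∎)
      where open SetoidReasoning S.setoid

    H≈0 : ∀ i → H i R.≈ R.0#
    H≈0 = LP.low-shift-fixed {e} {F} {H} (low-dilate-suc n {n ℕ.* s} {D n f} (low-dilate-suc n {s} {f}
            (positive⇒low {f} {s} pos))) fixed

    h≈0 : h S.≈ S.0#
    h≈0 = La.PS.dilate-injective (m ℕ.* n) {h} {S.0#} (S.trans H≈0 (S.sym (La.PS.dilate-0 (m ℕ.* n))))

    zero-* : ∀ {g} t → g S.≈ S.0# → g *ˢ t S.≈ S.0#
    zero-* t g≈0 = S.trans (S.*-congʳ {t} g≈0) (S.zeroˡ t)

  1-positive^-cancellable : ∀ x n → PositiveOrder x → Cancellable (K.1# K.- x ^ suc n)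
  1-positive^-cancellable x n pos = 1-x-cancellable {x ^ suc n} (positive-fixed (x ^ suc n) (positive-^ x n pos))

-- Exponent vectors

infixl 6 _⊕_

_⊕_ : ∀ {r} → Vec ℕ r → Vec ℕ r → Vec ℕ r
_⊕_ = zipWith ℕ._+_

⊕-identityʳ : ∀ {r} (n : Vec ℕ r) → n ⊕ 𝟎 ≡ n
⊕-identityʳ = zipWith-identityʳ ℕₚ.+-identityʳ

total : ∀ {r k} → Vec (Vec ℕ r) k → Vec ℕ r
total []       = 𝟎
total (g ∷ gs) = g ⊕ total gs

splittings-sum : ∀ {r} (n : Vec ℕ r) → All (λ (g , h) → g ⊕ h ≡ n) (splittings n)
splittings-sum []       = ≡.refl ∷ []
splittings-sum (n ∷ ns) = Allₚ.concat⁺ (Allₚ.map⁺ (Allₚ.applyUpTo⁺₁ id (suc n) λ where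
  (s≤s i≤n) → Allₚ.map⁺ (All.map (≡.cong₂ _∷_ (ℕₚ.m+[n∸m]≡n i≤n)) (splittings-sum ns))))

compositions-total : ∀ {r} k (n : Vec ℕ r) → All (λ g → total g ≡ n) (compositions k n)
compositions-total zero    n with ≡-dec ℕₚ._≟_ n 𝟎
... | yes n≡𝟎 = ≡.sym n≡𝟎 ∷ []
... | no  _   = []
compositions-total (suc k) n = Allₚ.concat⁺ (Allₚ.map⁺ (All.map step (splittings-sum n)))
  where
  step : ∀ {s} → proj₁ s ⊕ proj₂ s ≡ n → All (λ g → total g ≡ n)
    (if does (≡-dec ℕₚ._≟_ (proj₁ s) 𝟎) then [] else List.map (proj₁ s ∷_) (compositions k (proj₂ s)))
  step {g , h} g⊕h≡n with ≡-dec ℕₚ._≟_ g 𝟎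
  ... | yes _ = []
  ... | no  _ = Allₚ.map⁺ (All.map (λ eq → ≡.trans (≡.cong (g ⊕_) eq) g⊕h≡n) (compositions-total k h))

data Shape : ∀ {r} → Vec ℕ r → Set where
  isZero  : ∀ {r} → Shape (𝟎 {r})
  isAxis  : ∀ {r} (i : Fin r) k → Shape (axis i (suc k))
  isMixed : ∀ {r} {n : Vec ℕ r} → AtLeastTwoNonzero n → Shape n

shape : ∀ {r} (n : Vec ℕ r) → Shape n
shape []       = isZero
shape (m ∷ ns) with m | shape ns
... | zero  | isZero     = isZero
... | suc k | isZero     = isAxis zero k
... | zero  | isAxis i k = isAxis (suc i) k
... | suc m | isAxis i k = isMixed (zero , suc i , (λ ()) , (λ ()) , lookup-axis i)
  where
  lookup-axis : ∀ {r} (i : Fin r) → lookup (axis i (suc k)) i ≢ 0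
  lookup-axis zero    ()
  lookup-axis (suc i) eq = lookup-axis i eq
... | m     | isMixed (i , j , i≢j , nᵢ≢0 , nⱼ≢0) =
  isMixed (suc i , suc j , (λ { ≡.refl → i≢j ≡.refl }) , nᵢ≢0 , nⱼ≢0)

mixed⇒≢𝟎 : ∀ {r} {n : Vec ℕ r} → AtLeastTwoNonzero n → n ≢ 𝟎
mixed⇒≢𝟎 (i , _ , _ , nᵢ≢0 , _) ≡.refl = nᵢ≢0 (lookup-𝟎 i)
  where
  lookup-𝟎 : ∀ {r} (i : Fin r) → lookup 𝟎 i ≡ 0
  lookup-𝟎 zero    = ≡.refl
  lookup-𝟎 (suc i) = lookup-𝟎 i

axis-0 : ∀ {r} (i : Fin r) → axis i 0 ≡ 𝟎
axis-0 zero    = ≡.refl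
axis-0 (suc i) = ≡.cong (0 ∷_) (axis-0 i)

-- The zero vector counts as the multiple 0 on the axis i₀, so that its coefficient is handled
-- together with those of that axis.
axis-or-mixed : ∀ {r} → Fin r → (n : Vec ℕ r) → (∃₂ λ i k → n ≡ axis i k) ⊎ AtLeastTwoNonzero n
axis-or-mixed i₀ n = split (shape n)
  where
  split : ∀ {n : Vec ℕ _} → Shape n → (∃₂ λ i k → n ≡ axis i k) ⊎ AtLeastTwoNonzero n
  split isZero        = inj₁ (i₀ , 0 , ≡.sym (axis-0 i₀))
  split (isAxis i k)  = inj₁ (i , suc k , ≡.refl)
  split (isMixed mix) = inj₂ mix

idʰ : ∀ {R : CommutativeRing c ℓ} → RingHom R R
idʰ {R = R} = record
  { ⟦_⟧ = id ; ⟦⟧-cong = id ; +-homo = λ _ _ → refl ; *-homo = λ _ _ → refl ; 1-homo = refl }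
  where open CommutativeRing R

module _ {R : CommutativeRing c ℓ} {S : CommutativeRing c′ ℓ′} where
  private
    module R = CommutativeRing R
  open CommutativeRing S

  -- Compatibility with the operations is easiest for composites built by recursion on the number of
  -- variables. This transfers it to the maps that occur in the statements, `constant` and
  -- `coefficient`.
  replaceMap : ∀ (h : RingHom R S) (f : R.Carrier → Carrier) →
               (∀ x → f x ≈ RingHom.⟦_⟧ h x) → RingHom R S
  replaceMap h f f≈h = record
    { ⟦_⟧     = f
    ; ⟦⟧-cong = λ eq → trans (f≈h _) (trans (⟦⟧-cong eq) (sym (f≈h _)))
    ; +-homo  = λ x y → trans (f≈h _) (trans (+-homo x y) (sym (+-cong (f≈h x) (f≈h y))))
    ; *-homo  = λ x y → trans (f≈h _) (trans (*-homo x y) (sym (*-cong (f≈h x) (f≈h y))))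
    ; 1-homo  = trans (f≈h _) 1-homo
    }
    where open RingHom h

-- Coefficients of power series in several variables

module MultivariateProperties (K : CommutativeRing c ℓ) where
  open CommutativeRing K hiding (ring; zero)
  open Multivariate K
  open BigOperators K using (∑; ∑ₗ; ∏)
  open ListSums K
  open SetoidReasoning setoid
  private
    module A r = CommutativeRing (ring r)
    module BigA r = BigOperators (ring r)
    module Pow r = Exp (A.commutativeSemiring r)
    module SP r = SeriesProperties (ring r)
    module PS r = PowerSeries (ring r)

    constant-hom : ∀ r → RingHom K (ring r)
    constant-hom zero    = idʰ
    constant-hom (suc r) = SP.constʰ r ∘ʰ constant-hom r

    constant-same : ∀ r x → let open A r renaming (_≈_ to _≈ᴬ_) in
                    constant r x ≈ᴬ RingHom.⟦_⟧ (constant-hom r) x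
    constant-same zero    x = refl
    constant-same (suc r) x = RingHom.⟦⟧-cong (SP.constʰ r) (constant-same r x)

  constantʰ : ∀ r → RingHom K (ring r)
  constantʰ r = replaceMap (constant-hom r) (constant r) (constant-same r)

  coefficient-cong : ∀ {r} (n : Vec ℕ r) {f g} → A._≈_ r f g → coefficient n f ≈ coefficient n g
  coefficient-cong []       eq = eq
  coefficient-cong (n ∷ ns) eq = coefficient-cong ns (eq n)

  coefficient-ext : ∀ r {f g} → (∀ (n : Vec ℕ r) → coefficient n f ≈ coefficient n g) → A._≈_ r f g
  coefficient-ext zero    eq   = eq []
  coefficient-ext (suc r) eq n = coefficient-ext r λ ns → eq (n ∷ ns)

  coefficient-+ : ∀ {r} (n : Vec ℕ r) f g → coefficient n (A._+_ r f g) ≈ coefficient n f + coefficient n g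
  coefficient-+ []       f g = refl
  coefficient-+ (n ∷ ns) f g = coefficient-+ ns (f n) (g n)

  coefficient-0 : ∀ {r} (n : Vec ℕ r) → coefficient n (A.0# r) ≈ 0#
  coefficient-0 []       = refl
  coefficient-0 (n ∷ ns) = coefficient-0 ns

  coefficient-neg : ∀ {r} (n : Vec ℕ r) f → coefficient n (A.-_ r f) ≈ - coefficient n f
  coefficient-neg []       f = refl
  coefficient-neg (n ∷ ns) f = coefficient-neg ns (f n)

  coefficient-∑ₗ : ∀ {I : Set ι} {r} (n : Vec ℕ r) (xs : List I) f →
                   coefficient n (BigA.∑ₗ r xs f) ≈ ∑ₗ xs λ x → coefficient n (f x)
  coefficient-∑ₗ n []       f = coefficient-0 n
  coefficient-∑ₗ n (x ∷ xs) f = trans (coefficient-+ n _ _) (+-congˡ (coefficient-∑ₗ n xs f))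

  coefficient-∑ : ∀ {r} (n : Vec ℕ r) {m} (f : Fin m → A.Carrier r) →
                  coefficient n (BigA.∑ r f) ≈ ∑ λ i → coefficient n (f i)
  coefficient-∑ n {zero}  f = coefficient-0 n
  coefficient-∑ n {suc m} f = trans (coefficient-+ n _ _) (+-congˡ (coefficient-∑ n (f ∘ suc)))

  coefficient-constant-* : ∀ {r} (n : Vec ℕ r) x f → coefficient n (A._*_ r (constant r x) f) ≈ x * coefficient n f
  coefficient-constant-* []               x f = refl
  coefficient-constant-* {suc r} (n ∷ ns) x f =
    trans (coefficient-cong ns (PS.const-* r (constant r x) f n)) (coefficient-constant-* ns x (f n))

  coefficient-* : ∀ {r} (n : Vec ℕ r) f g → coefficient n (A._*_ r f g) ≈
                  ∑ₗ (splittings n) λ (h , k) → coefficient h f * coefficient k g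
  coefficient-* []               f g = sym (+-identityʳ _)
  coefficient-* {suc r} (n ∷ ns) f g = begin
    coefficient ns ((f *ˢ g) n)
      ≈⟨ coefficient-cong ns (SP.convolution r f g n) ⟩
    coefficient ns (BigA.∑ₗ r (List.upTo (suc n)) λ i → A._*_ r (f i) (g (n ∸ i)))
      ≈⟨ coefficient-∑ₗ ns (List.upTo (suc n)) _ ⟩
    ∑ₗ (List.upTo (suc n)) (λ i → coefficient ns (A._*_ r (f i) (g (n ∸ i))))
      ≈⟨ ∑ₗ-cong (List.upTo (suc n)) (λ i → trans (coefficient-* ns (f i) (g (n ∸ i)))
           (sym (∑ₗ-map (extend i) (splittings ns) F))) ⟩
    ∑ₗ (List.upTo (suc n)) (λ i → ∑ₗ (List.map (extend i) (splittings ns)) F)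
      ≈⟨ ∑ₗ-concatMap (λ i → List.map (extend i) (splittings ns)) (List.upTo (suc n)) F ⟨
    ∑ₗ (splittings (n ∷ ns)) F ∎
    where
    open PS r using (_*ˢ_)
    extend : ℕ → Vec ℕ r × Vec ℕ r → Vec ℕ (suc r) × Vec ℕ (suc r)
    extend i (g , h) = i ∷ g , (n ∸ i) ∷ h
    F : Vec ℕ (suc r) × Vec ℕ (suc r) → Carrier
    F (h , k) = coefficient h f * coefficient k g

  coefficient-fromCoefficients : ∀ {r} (a : Vec ℕ r → Carrier) n → coefficient n (fromCoefficients a) ≡ a n
  coefficient-fromCoefficients a []       = ≡.refl
  coefficient-fromCoefficients a (n ∷ ns) = coefficient-fromCoefficients (λ ms → a (n ∷ ms)) ns

  constantTermʰ : ∀ r → RingHom (ring r) K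
  constantTermʰ r = replaceMap (hom r) (coefficient (𝟎 {r})) (same r)
    where
    hom : ∀ r → RingHom (ring r) K
    hom zero    = idʰ
    hom (suc r) = hom r ∘ʰ SP.headʰ r
    same : ∀ r f → coefficient (𝟎 {r}) f ≈ RingHom.⟦_⟧ (hom r) f
    same zero    f = refl
    same (suc r) f = same r (f 0)

  coefficient-1-≢𝟎 : ∀ {r} {n : Vec ℕ r} → n ≢ 𝟎 → coefficient n (A.1# r) ≈ 0#
  coefficient-1-≢𝟎 {n = []}         n≢𝟎 = ⊥-elim (n≢𝟎 ≡.refl)
  coefficient-1-≢𝟎 {n = zero ∷ ns}  n≢𝟎 = coefficient-1-≢𝟎 {n = ns} λ { ≡.refl → n≢𝟎 ≡.refl }
  coefficient-1-≢𝟎 {n = suc n ∷ ns} n≢𝟎 = coefficient-0 ns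

  -- Multiplying out gives all ordered k-tuples with sum n. A tuple with a zero part contributes
  -- nothing, by the hypothesis on constant terms, and the remaining ones are those of the
  -- recursion.
  coefficient-∏ : ∀ {r} k (f : Fin k → A.Carrier r) → (∀ i → coefficient (𝟎 {r}) (f i) ≈ 0#) → ∀ (n : Vec ℕ r) →
                  coefficient n (BigA.∏ r f) ≈
                  ∑ₗ (compositions k n) λ g → ∏ λ i → coefficient (lookup g i) (f i)
  coefficient-∏ {r} zero f _ n with ≡-dec ℕₚ._≟_ n 𝟎
  ... | yes ≡.refl = trans (RingHom.1-homo (constantTermʰ r)) (sym (+-identityʳ 1#))
  ... | no  n≢𝟎    = coefficient-1-≢𝟎 n≢𝟎
  coefficient-∏ {r} (suc k) f f₀≈0 n = begin
    coefficient n (A._*_ r (f zero) (BigA.∏ r (f ∘ suc)))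
      ≈⟨ coefficient-* n (f zero) _ ⟩
    ∑ₗ (splittings n) (λ (g , h) → coefficient g (f zero) * coefficient h (BigA.∏ r (f ∘ suc)))
      ≈⟨ ∑ₗ-cong (splittings n) step ⟩
    ∑ₗ (splittings n) (λ s → ∑ₗ (extend s) F)
      ≈⟨ ∑ₗ-concatMap extend (splittings n) F ⟨
    ∑ₗ (compositions (suc k) n) F ∎
    where
    F : Vec (Vec ℕ r) (suc k) → Carrier
    F g = ∏ λ i → coefficient (lookup g i) (f i)
    extend : Vec ℕ r × Vec ℕ r → List (Vec (Vec ℕ r) (suc k))
    extend (g , h) = if does (≡-dec ℕₚ._≟_ g 𝟎) then [] else List.map (g ∷_) (compositions k h)
    step : ∀ s → coefficient (proj₁ s) (f zero) * coefficient (proj₂ s) (BigA.∏ r (f ∘ suc)) ≈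
                 ∑ₗ (extend s) F
    step (g , h) with ≡-dec ℕₚ._≟_ g 𝟎
    ... | yes ≡.refl = trans (*-congʳ (f₀≈0 zero)) (zeroˡ _)
    ... | no _ = begin
      coefficient g (f zero) * coefficient h (BigA.∏ r (f ∘ suc))
        ≈⟨ *-congˡ (coefficient-∏ k (f ∘ suc) (f₀≈0 ∘ suc) h) ⟩
      coefficient g (f zero) * ∑ₗ (compositions k h) (λ gs → ∏ λ i → coefficient (lookup gs i) (f (suc i)))
        ≈⟨ ∑ₗ-distribˡ _ (compositions k h) _ ⟩
      ∑ₗ (compositions k h) (λ gs → F (g ∷ gs))
        ≈⟨ ∑ₗ-map (g ∷_) (compositions k h) F ⟨
      ∑ₗ (List.map (g ∷_) (compositions k h)) F ∎

  monomial : ∀ {r} → Vec ℕ r → A.Carrier r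
  monomial {r} n = BigA.∏ r λ i → Pow._^_ r (indeterminate i) (lookup n i)

  coefficient-monomial-* : ∀ {r} (n h : Vec ℕ r) f → coefficient (n ⊕ h) (A._*_ r (monomial n) f) ≈ coefficient h f
  coefficient-monomial-* []       []       f = *-identityˡ f
  coefficient-monomial-* {suc r} (n ∷ ns) (h ∷ hs) f = begin
    coefficient (ns ⊕ hs) ((monomial (n ∷ ns) *ˢ f) (n ℕ.+ h))
      ≈⟨ coefficient-cong (ns ⊕ hs) (S.trans (S.*-congʳ monomial-∷) (S.*-assoc _ _ f) (n ℕ.+ h)) ⟩
    coefficient (ns ⊕ hs) ((var ^ˢ n *ˢ (const (monomial ns) *ˢ f)) (n ℕ.+ h))
      ≈⟨ coefficient-cong (ns ⊕ hs) (var^-*-high n _ h) ⟩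
    coefficient (ns ⊕ hs) ((const (monomial ns) *ˢ f) h)
      ≈⟨ coefficient-cong (ns ⊕ hs) (const-* (monomial ns) f h) ⟩
    coefficient (ns ⊕ hs) (A._*_ r (monomial ns) (f h))
      ≈⟨ coefficient-monomial-* ns hs (f h) ⟩
    coefficient hs (f h) ∎
    where
    open PS r
    module S = A (suc r)
    open Pow (suc r) renaming (_^_ to _^ˢ_)
    module H = RingHom (SP.constʰ r)
    monomial-∷ : monomial (n ∷ ns) S.≈ var ^ˢ n *ˢ const (monomial ns)
    monomial-∷ = S.*-congˡ (S.sym (S.trans (H.∏-homo {r} _)
      (FiniteSum.sum-cong-≋ S.*-commutativeMonoid {r} λ i → H.^-homo (indeterminate i) (lookup ns i))))

  coefficient-monomial : ∀ {r} (n : Vec ℕ r) → coefficient {r} n (monomial n) ≈ 1#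
  coefficient-monomial {r} n = begin
    coefficient n (monomial n)
      ≡⟨ ≡.cong (λ m → coefficient m (monomial n)) (⊕-identityʳ n) ⟨
    coefficient (n ⊕ 𝟎) (monomial n)
      ≈⟨ coefficient-cong (n ⊕ 𝟎) (A.*-identityʳ r (monomial n)) ⟨
    coefficient (n ⊕ 𝟎) (A._*_ r (monomial n) (A.1# r))
      ≈⟨ coefficient-monomial-* n 𝟎 (A.1# r) ⟩
    coefficient {r} 𝟎 (A.1# r)
      ≈⟨ RingHom.1-homo (constantTermʰ r) ⟩
    1# ∎

  monomial-⊕ : ∀ {r} (n m : Vec ℕ r) → A._≈_ r (monomial (n ⊕ m)) (A._*_ r (monomial n) (monomial m))
  monomial-⊕ {r} n m = A.trans r (sum-cong-≋ {r} λ i → A.trans r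
      (A.reflexive r (≡.cong (Pow._^_ r (indeterminate i)) (lookup-zipWith ℕ._+_ i n m)))
      (Pow.^-homo-* r (indeterminate i) (lookup n i) (lookup m i)))
    (∑-distrib-+ {r} _ _)
    where open FiniteSum (A.*-commutativeMonoid r)

  monomial-𝟎 : ∀ r → A._≈_ r (monomial (𝟎 {r})) (A.1# r)
  monomial-𝟎 r = A.trans r (sum-cong-≋ {r} λ i →
      A.reflexive r (≡.cong (Pow._^_ r (indeterminate i)) (lookup-replicate i 0)))
    (sum-replicate-zero r)
    where open FiniteSum (A.*-commutativeMonoid r)

  module _ where
    private
      module PK = PowerSeries K
      hom : ∀ {r} → Fin r → RingHom (ring r) PK.commutativeRing
      hom {suc r} zero    = mapʰ (constantTermʰ r)
      hom {suc r} (suc i) = hom i ∘ʰ SP.headʰ r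
      same : ∀ {r} (i : Fin r) f k → coefficient (axis i k) f ≈ RingHom.⟦_⟧ (hom i) f k
      same zero    f k = refl
      same (suc i) f k = same i (f 0) k

    -- Setting every other indeterminate to 0. As a ring homomorphism it turns the comparison of all
    -- coefficients on one axis into a single identity in one variable.
    restrictʰ : ∀ {r} → Fin r → RingHom (ring r) PK.commutativeRing
    restrictʰ i = replaceMap (hom i) (λ f k → coefficient (axis i k) f) (same i)

    restrict-constant : ∀ {r} (i : Fin r) x → RingHom.⟦_⟧ (restrictʰ i) (constant r x) PK.≈ˢ PK.const x
    restrict-constant {suc r} zero x zero    = constant-term r x
      where
      constant-term : ∀ r x → coefficient (𝟎 {r}) (constant r x) ≈ x
      constant-term zero    x = refl
      constant-term (suc r) x = constant-term r x
    restrict-constant {suc r} zero    x (suc n) = coefficient-0 {r} (𝟎 {r})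
    restrict-constant (suc i) x n = restrict-constant i x n

    restrict-indeterminate : ∀ {r} (i : Fin r) → RingHom.⟦_⟧ (restrictʰ i) (indeterminate i) PK.≈ˢ PK.var
    restrict-indeterminate {suc r} zero zero          = coefficient-0 {r} (𝟎 {r})
    restrict-indeterminate {suc r} zero (suc zero)    = RingHom.1-homo (constantTermʰ r)
    restrict-indeterminate {suc r} zero (suc (suc n)) = coefficient-0 {r} (𝟎 {r})
    restrict-indeterminate (suc i) n = restrict-indeterminate i n

-- Integer powers of units

module UnitPowers (R : CommutativeRing c ℓ) where
  open CommutativeRing R
  open Exp commutativeSemiring
  open Units R
  open IntegerSolver R
  open SetoidReasoning setoid

  ^ᶻ-⊖ : ∀ x m n → x ^ᶻ (m ℤ.⊖ n) ≈ value x ^ m * inverse x ^ n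
  ^ᶻ-⊖ x m       zero    = sym (*-identityʳ _)
  ^ᶻ-⊖ x zero    (suc n) = sym (*-identityˡ _)
  ^ᶻ-⊖ x (suc m) (suc n) = begin
    x ^ᶻ (suc m ℤ.⊖ suc n)            ≡⟨ ≡.cong (x ^ᶻ_) (ℤₚ.[1+m]⊖[1+n]≡m⊖n m n) ⟩
    x ^ᶻ (m ℤ.⊖ n)                    ≈⟨ ^ᶻ-⊖ x m n ⟩
    value x ^ m * inverse x ^ n       ≈⟨ *-identityˡ _ ⟨
    1# * (value x ^ m * inverse x ^ n)
      ≈⟨ *-congʳ (inverts x) ⟨
    value x * inverse x * (value x ^ m * inverse x ^ n)
      ≈⟨ solve 4 (λ a b c d → a :* b :* (c :* d) := a :* c :* (b :* d)) refl _ _ _ _ ⟩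
    value x ^ suc m * inverse x ^ suc n ∎

  ^ᶻ-+ : ∀ x i j → x ^ᶻ (i ℤ.+ j) ≈ x ^ᶻ i * x ^ᶻ j
  ^ᶻ-+ x (+ m)    (+ n)    = ^-homo-* (value x) m n
  ^ᶻ-+ x (+ m)    -[1+ n ] = ^ᶻ-⊖ x m (suc n)
  ^ᶻ-+ x -[1+ m ] (+ n)    = trans (^ᶻ-⊖ x n (suc m)) (*-comm _ _)
  ^ᶻ-+ x -[1+ m ] -[1+ n ] = trans
    (reflexive (≡.cong (λ k → inverse x ^ suc k) (≡.sym (ℕₚ.+-suc m n))))
    (^-homo-* (inverse x) (suc m) (suc n))

  ^ᶻ-*ℕ : ∀ x i n → x ^ᶻ (i ℤ.* + n) ≈ (x ^ᶻ i) ^ n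
  ^ᶻ-*ℕ x i zero    = reflexive (≡.cong (x ^ᶻ_) (ℤₚ.*-zeroʳ i))
  ^ᶻ-*ℕ x i (suc n) = begin
    x ^ᶻ (i ℤ.* + suc n)          ≡⟨ ≡.cong (x ^ᶻ_) (ℤₚ.*-suc i (+ n)) ⟩
    x ^ᶻ (i ℤ.+ i ℤ.* + n)        ≈⟨ ^ᶻ-+ x i (i ℤ.* + n) ⟩
    x ^ᶻ i * x ^ᶻ (i ℤ.* + n)     ≈⟨ *-congˡ (^ᶻ-*ℕ x i n) ⟩
    (x ^ᶻ i) ^ suc n              ∎

  ^-even : ∀ x n → x ^ (2 ℕ.* n) ≈ (x * x) ^ n
  ^-even x n = trans (sym (^-assocʳ x 2 n)) (^-congˡ n (*-congˡ (*-identityʳ x)))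

  ^ᶻ-odd : ∀ x {d} (i : Fin d) → x ^ᶻ odd i ≈ value x * (value x * value x) ^ toℕ i
  ^ᶻ-odd x i = *-congˡ (^-even (value x) (toℕ i))

  ^ᶻ-neg-odd : ∀ x {d} (i : Fin d) → x ^ᶻ (ℤ.- odd i) ≈ inverse x * (inverse x * inverse x) ^ toℕ i
  ^ᶻ-neg-odd x i = *-congˡ (^-even (inverse x) (toℕ i))

  value-^ᵘ : ∀ x n → value (x ^ᵘ n) ≈ value x ^ n
  value-^ᵘ x zero    = refl
  value-^ᵘ x (suc n) = *-congˡ (value-^ᵘ x n)

  value-*ᵘ-^ᵘ : ∀ x y n → value (x *ᵘ y ^ᵘ n) ≈ value x * value y ^ n
  value-*ᵘ-^ᵘ x y n = *-congˡ (value-^ᵘ y n)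

-- The algebraic identities of the one-variable case

module RingIdentities (R : CommutativeRing c ℓ) where
  open CommutativeRing R
  open Exp commutativeSemiring
  open BigOperators R
  open Cancellation R
  open IntegerSolver R
  open SetoidReasoning setoid

  -- These are two geometric sums, of ratios x² and x⁻². Multiplied by 1 - x² each telescopes, and
  -- their contributions x and -x from the common start cancel. With n = d this removes the sum from
  -- the characteristic equation.
  odd-powers-sum : ∀ x x̄ → x * x̄ ≈ 1# → ∀ n →
    (1# - x * x) * ∑ {n} (λ i → x * (x * x) ^ toℕ i + x̄ * (x̄ * x̄) ^ toℕ i) ≈
    x * (x̄ * x̄) ^ n - x * (x * x) ^ n
  odd-powers-sum x x̄ xx̄≈1 zero    = trans (zeroʳ _) (sym (-‿inverseʳ _))
  odd-powers-sum x x̄ xx̄≈1 (suc n) = begin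
    (1# - y) * ∑ {suc n} (term ∘ toℕ)
      ≈⟨ *-congˡ (MonoidFold.sum-toℕ-last +-commutativeMonoid term n) ⟩
    (1# - y) * (∑ {n} (term ∘ toℕ) + term n)
      ≈⟨ distribˡ _ _ _ ⟩
    (1# - y) * ∑ {n} (term ∘ toℕ) + (1# - y) * term n
      ≈⟨ +-congʳ (odd-powers-sum x x̄ xx̄≈1 n) ⟩
    -- The solver cannot use x x̄ = 1, so the surplus is collected as a multiple of 1 - x x̄, which
    -- the next rewriting turns into 1 - 1.
    (x * ȳⁿ - x * yⁿ) + (1# - y) * (x * yⁿ + x̄ * ȳⁿ)
      ≈⟨ solve 4 (λ x x̄ b a →
           (x :* b :- x :* a) :+ (:1 :- x :* x) :* (x :* a :+ x̄ :* b) :=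
           (:1 :- x :* x̄) :* (x :* b) :+ x̄ :* b :- x :* (x :* x :* a)) refl x x̄ ȳⁿ yⁿ ⟩
    (1# - x * x̄) * (x * ȳⁿ) + x̄ * ȳⁿ - x * (y * yⁿ)
      ≈⟨ +-congʳ (+-cong (*-congʳ (+-congˡ (-‿cong xx̄≈1))) (*-congʳ (sym (*-identityˡ x̄)))) ⟩
    (1# - 1#) * (x * ȳⁿ) + 1# * x̄ * ȳⁿ - x * (y * yⁿ)
      ≈⟨ +-congʳ (+-congˡ (*-congʳ (*-congʳ xx̄≈1))) ⟨
    (1# - 1#) * (x * ȳⁿ) + x * x̄ * x̄ * ȳⁿ - x * (y * yⁿ)
      ≈⟨ solve 4 (λ x x̄ b a →
           (:1 :- :1) :* (x :* b) :+ x :* x̄ :* x̄ :* b :- x :* (x :* x :* a) :=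
           x :* (x̄ :* x̄ :* b) :- x :* (x :* x :* a)) refl x x̄ ȳⁿ yⁿ ⟩
    x * (ȳ * ȳⁿ) - x * (y * yⁿ) ∎
    where
    y = x * x
    ȳ = x̄ * x̄
    yⁿ = y ^ n
    ȳⁿ = ȳ ^ n
    term : ℕ → Carrier
    term i = x * y ^ i + x̄ * ȳ ^ i

  -- As fractions, s n = (a n / a (n+1)) (a′ (n+1) / a′ n) and t n = (b (n+1) / b n) (b′ n / b′
  -- (n+1)). Only the end values survive in the product, since the values at 0 agree. In the
  -- cross-multiplied form each step costs the cancellation of four factors.
  telescope : ∀ (a a′ b b′ s t : ℕ → Carrier) →
    (∀ n → Cancellable (a n)) → (∀ n → Cancellable (a′ n)) →
    (∀ n → Cancellable (b n)) → (∀ n → Cancellable (b′ n)) →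
    (∀ n → a (suc n) * a′ n * s n ≈ a n * a′ (suc n)) →
    (∀ n → b n * b′ (suc n) * t n ≈ b (suc n) * b′ n) →
    a 0 ≈ b 0 → a′ 0 ≈ b′ 0 →
    ∀ n → a n * b′ n * ∏ {n} (λ i → s (toℕ i) * t (toℕ i)) ≈ b n * a′ n
  telescope a a′ b b′ s t ca ca′ cb cb′ up down a≈b a′≈b′ zero =
    trans (*-identityʳ _) (*-cong a≈b (sym a′≈b′))
  telescope a a′ b b′ s t ca ca′ cb cb′ up down a≈b a′≈b′ (suc n) =
    *-cancellable (*-cancellable (ca′ n) (cb n)) (*-cancellable (ca n) (cb′ n)) (begin
      (a′ n * b n) * (a n * b′ n) * (a (suc n) * b′ (suc n) * ∏ {suc n} (st ∘ toℕ))
        ≈⟨ *-congˡ (*-congˡ (MonoidFold.sum-toℕ-last *-commutativeMonoid st n)) ⟩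
      (a′ n * b n) * (a n * b′ n) * (a (suc n) * b′ (suc n) * (p * (s n * t n)))
        ≈⟨ solve 9 (λ a a′ b b′ a₁ b₁′ p s t →
             (a′ :* b) :* (a :* b′) :* (a₁ :* b₁′ :* (p :* (s :* t))) :=
             (a₁ :* a′ :* s) :* (b :* b₁′ :* t) :* (a :* b′ :* p)) refl
             (a n) (a′ n) (b n) (b′ n) (a (suc n)) (b′ (suc n)) p (s n) (t n) ⟩
      (a (suc n) * a′ n * s n) * (b n * b′ (suc n) * t n) * (a n * b′ n * p)
        ≈⟨ *-cong (*-cong (up n) (down n)) (telescope a a′ b b′ s t ca ca′ cb cb′ up down a≈b a′≈b′ n) ⟩
      (a n * a′ (suc n)) * (b (suc n) * b′ n) * (b n * a′ n)
        ≈⟨ solve 6 (λ a a′ b b′ a₁′ b₁ →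
             (a :* a₁′) :* (b₁ :* b′) :* (b :* a′) := (a′ :* b) :* (a :* b′) :* (b₁ :* a₁′)) refl
             (a n) (a′ n) (b n) (b′ n) (a′ (suc n)) (b (suc n)) ⟩
      (a′ n * b n) * (a n * b′ n) * (b (suc n) * a′ (suc n)) ∎)
    where
    st : ℕ → Carrier
    st i = s i * t i
    p = ∏ {n} (st ∘ toℕ)

  -- Let E = (1 - yτ)(1 - yQτ). It exceeds the quadratic on the left by (1 - y)(1 - yQ)τ and the
  -- last quadratic on the right by (Q̄ - yQ)(1 - yQ)τ. The hypothesis on w makes the first gap w
  -- times the second, and T = 1 + wT accounts for the remaining multiples of E.
  quadratic-balance : ∀ T w y Q Q̄ τ → T ≈ 1# + w * T → Q * Q̄ ≈ 1# → w * (Q̄ - y * Q) ≈ 1# - y →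
    T * ((1# - τ) * (1# - y * y * Q * τ)) ≈
    (1# - y * τ) * (1# - y * Q * τ) + w * T * ((1# - Q̄ * τ) * (1# - y * y * Q * Q * τ))
  quadratic-balance T w y Q Q̄ τ T≈ QQ̄≈1 wκ≈ = begin
    T * ((1# - τ) * (1# - y * y * Q * τ))
      ≈⟨ solve 4 (λ T y Q τ → T :* ((:1 :- τ) :* (:1 :- y :* y :* Q :* τ)) :=
           T :* ((:1 :- y :* τ) :* (:1 :- y :* Q :* τ)) :- T :* (:1 :- y) :* ((:1 :- y :* Q) :* τ))
           refl T y Q τ ⟩
    T * E - T * (1# - y) * ((1# - y * Q) * τ)
      ≈⟨ +-cong (*-congʳ T≈) (-‿cong (*-congʳ (*-congˡ (sym wκ≈)))) ⟩
    (1# + w * T) * E - T * (w * (Q̄ - y * Q)) * ((1# - y * Q) * τ)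
      -- Again the relation Q Q̄ = 1 is unknown to the solver; everything that depends on it is
      -- gathered in a multiple of Q Q̄ - 1.
      ≈⟨ solve 6 (λ T w y Q Q̄ τ →
           let E = (:1 :- y :* τ) :* (:1 :- y :* Q :* τ) in
           (:1 :+ w :* T) :* E :- T :* (w :* (Q̄ :- y :* Q)) :* ((:1 :- y :* Q) :* τ) :=
           E :+ w :* T :* ((:1 :- Q̄ :* τ) :* (:1 :- y :* y :* Q :* Q :* τ)
             :- (Q :* Q̄ :- :1) :* (y :* y :* Q :* τ :* τ :- y :* τ)))
           refl T w y Q Q̄ τ ⟩
    E + w * T * (N - (Q * Q̄ - 1#) * (y * y * Q * τ * τ - y * τ))
      ≈⟨ +-congˡ (*-congˡ (+-congˡ (-‿cong (*-congʳ (trans (+-congʳ QQ̄≈1) (-‿inverseʳ 1#)))))) ⟩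
    E + w * T * (N - 0# * (y * y * Q * τ * τ - y * τ))
      ≈⟨ solve 4 (λ E wT N e → E :+ wT :* (N :- con (+ 0) :* e) := E :+ wT :* N) refl E (w * T) N _ ⟩
    E + w * T * N ∎
    where
    E = (1# - y * τ) * (1# - y * Q * τ)
    N = (1# - Q̄ * τ) * (1# - y * y * Q * Q * τ)

-- The functional equation in one variable

module OneVariable (K : CommutativeRing c ℓ) where
  open PowerSeries K using (Series; const; const-*; var; var-*-suc)
  open SeriesProperties K
  open Units K using (Unit; value; inverse; inverts; _^ᶻ_)
  private
    module K = CommutativeRing K
    module KP = Exp K.commutativeSemiring
    module S = CommutativeRing (PowerSeries.commutativeRing K)
    module C = RingHom constʰ
    module IK = IntegerSolver K
    module BK = BigOperators K
  open S hiding (zero)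
  open BigOperators (PowerSeries.commutativeRing K) using (∏)
  open Cancellation (PowerSeries.commutativeRing K)
  open IntegerSolver (PowerSeries.commutativeRing K)
  open SetoidReasoning setoid

  private
    linear-* : ∀ x p → linear (x K.* p) ≈ 1# - const x * (const p * var)
    linear-* x p = +-congˡ (-‿cong (trans (*-congʳ (C.*-homo x p)) (*-assoc _ _ _)))

    const-yQ : ∀ y Q → const (y K.* Q) ≈ const y * const Q
    const-yQ = C.*-homo

    const-yyQ : ∀ y Q → const (y K.* y K.* Q) ≈ const y * const y * const Q
    const-yyQ y Q = trans (C.*-homo (y K.* y) Q) (*-congʳ (C.*-homo y y))

    const-yyQQ : ∀ y Q → const (y K.* y K.* Q K.* Q) ≈ const y * const y * const Q * const Q
    const-yyQQ y Q = trans (C.*-homo (y K.* y K.* Q) Q) (*-congʳ (const-yyQ y Q))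

  -- The hypothesis makes (1 - Q) s a combination of the geometric series of y p and y Q p.
  one-minus-series : ∀ y Q p (s : Series) → Cancellation.Cancellable K (K.1# K.- Q) →
    s 0 K.≈ K.0# →
    (∀ k → (K.1# K.- Q) K.* s (suc k) K.≈
      (K.1# K.- y) K.* (K.1# K.- y K.* Q) K.* p K.*
        ((y K.* p) KP.^ k K.- Q K.* (y K.* Q K.* p) KP.^ k)) →
    linear (y K.* p) * linear (y K.* Q K.* p) * (1# - s) ≈ linear p * linear (y K.* y K.* Q K.* p)
  one-minus-series y Q p s cancel-1-Q s₀≈0 s₁₊ₖ≈ = const-cancellable cancel-1-Q (begin
    const (K.1# K.- Q) * (u * v * (1# - s))
      ≈⟨ solve 4 (λ q u v s → q :* (u :* v :* (:1 :- s)) := u :* v :* q :- u :* v :* (q :* s))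
           refl (const (K.1# K.- Q)) u v s ⟩
    u * v * const (K.1# K.- Q) - u * v * (const (K.1# K.- Q) * s)
      ≈⟨ +-cong (*-congˡ 1-Q≈) (-‿cong (*-congˡ s≈)) ⟩
    u * v * (1# - Q̂) - u * v * ((1# - ŷ) * (1# - ŷ * Q̂) * τ * (g - Q̂ * h))
      ≈⟨ solve 7 (λ u v g h y Q τ →
           u :* v :* (:1 :- Q) :- u :* v :* ((:1 :- y) :* (:1 :- y :* Q) :* τ :* (g :- Q :* h)) :=
           u :* v :* (:1 :- Q) :-
             (:1 :- y) :* (:1 :- y :* Q) :* τ :* (v :* (u :* g) :- Q :* u :* (v :* h)))
           refl u v g h ŷ Q̂ τ ⟩
    u * v * (1# - Q̂) - (1# - ŷ) * (1# - ŷ * Q̂) * τ * (v * (u * g) - Q̂ * u * (v * h))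
      ≈⟨ +-congˡ (-‿cong (*-congˡ (+-cong (*-congˡ (linear-geometric (y K.* p)))
           (-‿cong (*-congˡ (linear-geometric (y K.* Q K.* p))))))) ⟩
    u * v * (1# - Q̂) - (1# - ŷ) * (1# - ŷ * Q̂) * τ * (v * 1# - Q̂ * u * 1#)
      ≈⟨ +-cong (*-congʳ (*-cong u≈ v≈)) (-‿cong (*-congˡ (+-cong (*-congʳ v≈) (-‿cong (*-congʳ (*-congˡ u≈)))))) ⟩
    u′ * v′ * (1# - Q̂) - (1# - ŷ) * (1# - ŷ * Q̂) * τ * (v′ * 1# - Q̂ * u′ * 1#)
      ≈⟨ solve 3 (λ y Q τ → let u = :1 :- y :* τ
                                v = :1 :- y :* Q :* τ in
           u :* v :* (:1 :- Q) :- (:1 :- y) :* (:1 :- y :* Q) :* τ :* (v :* :1 :- Q :* u :* :1) :=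
           (:1 :- Q) :* ((:1 :- τ) :* (:1 :- y :* y :* Q :* τ))) refl ŷ Q̂ τ ⟩
    (1# - Q̂) * ((1# - τ) * (1# - ŷ * ŷ * Q̂ * τ))
      ≈⟨ *-cong 1-Q≈ (*-congˡ (trans (linear-* (y K.* y K.* Q) p) (+-congˡ (-‿cong (*-congʳ (const-yyQ y Q)))))) ⟨
    const (K.1# K.- Q) * (linear p * linear (y K.* y K.* Q K.* p)) ∎)
    where
    ŷ = const y
    Q̂ = const Q
    τ = const p * var
    u = linear (y K.* p)
    v = linear (y K.* Q K.* p)
    u′ = 1# - ŷ * τ
    v′ = 1# - ŷ * Q̂ * τ
    g = geometric (y K.* p)
    h = geometric (y K.* Q K.* p)
    D = (K.1# K.- y) K.* (K.1# K.- y K.* Q)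

    1-Q≈ : const (K.1# K.- Q) ≈ 1# - Q̂
    1-Q≈ = C.minus-homo K.1# Q

    u≈ : u ≈ u′
    u≈ = linear-* y p

    v≈ : v ≈ v′
    v≈ = trans (linear-* (y K.* Q) p) (+-congˡ (-‿cong (*-congʳ (const-yQ y Q))))

    D≈ : const D ≈ (1# - ŷ) * (1# - ŷ * Q̂)
    D≈ = trans (C.*-homo (K.1# K.- y) (K.1# K.- y K.* Q)) (*-cong (C.minus-homo K.1# y)
           (trans (C.minus-homo K.1# (y K.* Q)) (+-congˡ (-‿cong (const-yQ y Q)))))

    coefficientwise : const (K.1# K.- Q) * s ≈ const (D K.* p) * (var * (g - Q̂ * h))
    coefficientwise ℕ.zero    = K.trans (K.*-congˡ s₀≈0) (K.trans (K.zeroʳ _)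
      (K.sym (K.trans (K.*-congˡ (K.zeroˡ ((g - Q̂ * h) 0))) (K.zeroʳ _))))
    coefficientwise (ℕ.suc k) = K.trans (const-* (K.1# K.- Q) s (suc k)) (K.trans (s₁₊ₖ≈ k)
      (K.sym (K.trans (const-* (D K.* p) (var * (g - Q̂ * h)) (suc k)) (K.*-congˡ (K.trans
        (var-*-suc (g - Q̂ * h) k) (K.+-congˡ (K.-‿cong (const-* Q h k))))))))

    s≈ : const (K.1# K.- Q) * s ≈ (1# - ŷ) * (1# - ŷ * Q̂) * τ * (g - Q̂ * h)
    s≈ = trans coefficientwise (trans (*-congʳ (trans (C.*-homo D p) (*-congʳ D≈)))
      (solve 4 (λ d p t g → d :* p :* (t :* g) := d :* (p :* t) :* g) refl _ (const p) var _))

  module _ (d : ℕ) .{{_ : NonZero d}} (x : Unit) where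
    private
      Q y : K.Carrier
      Q = value x KP.^ (2 ℕ.* d ∸ 1)
      y = value x K.* value x

    module _
      (T w : K.Carrier) (T≈ : T K.≈ K.1# K.+ w K.* T)
      (characteristic : K.1# K.≈ w K.* BK.∑ λ (i : Fin d) → x ^ᶻ odd i K.+ x ^ᶻ (ℤ.- odd i))
      (cancel-1-Q : Cancellation.Cancellable K (K.1# K.- Q))
      (s : ℤ → Series) (s₀≈0 : ∀ j → s j 0 K.≈ K.0#)
      (s₁₊ₖ≈ : ∀ j k → (K.1# K.- Q) K.* s j (suc k) K.≈
        (K.1# K.- y) K.* (K.1# K.- y K.* Q) K.* x ^ᶻ j K.*
          ((y K.* x ^ᶻ j) KP.^ k K.- Q K.* (y K.* Q K.* x ^ᶻ j) KP.^ k))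
      where
      open UnitPowers K

      private
        v v̄ ȳ Q̄ : K.Carrier
        v = value x
        v̄ = inverse x
        ȳ = v̄ K.* v̄
        Q̄ = v̄ KP.^ (2 ℕ.* d ∸ 1)

        2d≡1+r : 2 ℕ.* d ≡ suc (2 ℕ.* d ∸ 1)
        2d≡1+r = ≡.sym (ℕₚ.m+[n∸m]≡n (ℕ.>-nonZero⁻¹ (2 ℕ.* d) {{ℕₚ.m*n≢0 2 d}}))

        square^d : ∀ u → (u K.* u) KP.^ d K.≈ u K.* u KP.^ (2 ℕ.* d ∸ 1)
        square^d u = K.trans (K.sym (^-even u d)) (K.reflexive (≡.cong (u KP.^_) 2d≡1+r))

        QQ̄≈1 : Q K.* Q̄ K.≈ K.1#
        QQ̄≈1 = go (2 ℕ.* d ∸ 1)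
          where
          go : ∀ n → v KP.^ n K.* v̄ KP.^ n K.≈ K.1#
          go ℕ.zero    = K.*-identityˡ K.1#
          go (ℕ.suc n) = K.trans (IK.solve 4 (λ a b a′ b′ → a IK.:* b IK.:* (a′ IK.:* b′) IK.:=
              (a IK.:* a′) IK.:* (b IK.:* b′)) K.refl v (v KP.^ n) v̄ (v̄ KP.^ n))
            (K.trans (K.*-cong (inverts x) (go n)) (K.*-identityˡ K.1#))

        vȳᵈ≈Q̄ : v K.* ȳ KP.^ d K.≈ Q̄
        vȳᵈ≈Q̄ = K.trans (K.*-congˡ (square^d v̄)) (K.trans (K.sym (K.*-assoc v v̄ Q̄))
          (K.trans (K.*-congʳ (inverts x)) (K.*-identityˡ Q̄)))

        vyᵈ≈yQ : v K.* y KP.^ d K.≈ y K.* Q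
        vyᵈ≈yQ = K.trans (K.*-congˡ (square^d v)) (K.sym (K.*-assoc v v Q))

        -- This is the characteristic equation multiplied by 1 - y, its sum of odd powers having
        -- collapsed by `odd-powers-sum`.
        balance : w K.* (Q̄ K.- y K.* Q) K.≈ K.1# K.- y
        balance = K.sym (K.trans (K.sym (K.*-identityʳ _)) (K.trans (K.*-congˡ (K.trans characteristic
            (K.*-congˡ (FiniteSum.sum-cong-≋ K.+-commutativeMonoid {d} λ i →
              K.+-cong (^ᶻ-odd x i) (^ᶻ-neg-odd x i)))))
          (K.trans (IK.solve 3 (λ a b c → a IK.:* (b IK.:* c) IK.:= b IK.:* (a IK.:* c)) K.refl (K.1# K.- y) w _)
            (K.*-congˡ (K.trans (RingIdentities.odd-powers-sum K v v̄ (inverts x) d)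
              (K.+-cong vȳᵈ≈Q̄ (K.-‿cong vyᵈ≈yQ)))))))

        -- Here p is any expression equal to xʲ, so that the shifted indices j ± (2n + 1) can enter
        -- in the product form that the chains of the telescoping use.
        factor : ∀ j {p} → x ^ᶻ j K.≈ p →
          linear (y K.* p) * linear (y K.* Q K.* p) * (1# - s j) ≈ linear p * linear (y K.* y K.* Q K.* p)
        factor j {p} xʲ≈p = one-minus-series y Q p (s j) cancel-1-Q (s₀≈0 j) λ k →
          K.trans (s₁₊ₖ≈ j k) (K.*-cong (K.*-congˡ xʲ≈p) (K.+-cong (KP.^-congˡ k (K.*-congˡ xʲ≈p))
            (K.-‿cong (K.*-congˡ (KP.^-congˡ k (K.*-congˡ xʲ≈p))))))

      module _ (j : ℤ) where
        private
          p : K.Carrier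
          p = x ^ᶻ j

          -- The exponent of x beside p is 1 + 2n along `a` and 1 - 2n along `b`, so both chains
          -- start at 1 - pxt. The primed chains carry the additional factor yQ that separates the
          -- two denominators from 1 - pt and 1 - ypt.
          a a′ b b′ s⁺ s⁻ : ℕ → Series
          a n  = linear (p K.* (v K.* y KP.^ n))
          a′ n = linear (y K.* Q K.* (p K.* (v K.* y KP.^ n)))
          b n  = linear (p K.* (v K.* ȳ KP.^ n))
          b′ n = linear (y K.* Q K.* (p K.* (v K.* ȳ KP.^ n)))
          s⁺ n = 1# - s (j ℤ.+ + suc (2 ℕ.* n))
          s⁻ n = 1# - s (j ℤ.- + suc (2 ℕ.* n))

          up : ∀ n → a (suc n) * a′ n * s⁺ n ≈ a n * a′ (suc n)
          up n = trans (*-congʳ (*-congʳ (linear-cong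
              (IK.solve 4 (λ p v y yⁿ → p IK.:* (v IK.:* (y IK.:* yⁿ)) IK.:= y IK.:* (p IK.:* (v IK.:* yⁿ)))
                K.refl p v y (y KP.^ n)))))
            (trans (factor (j ℤ.+ + suc (2 ℕ.* n)) (K.trans (^ᶻ-+ x j (+ suc (2 ℕ.* n)))
              (K.*-congˡ (K.*-congˡ (^-even v n)))))
            (*-congˡ (linear-cong
              (IK.solve 5 (λ p v y Q yⁿ → y IK.:* y IK.:* Q IK.:* (p IK.:* (v IK.:* yⁿ)) IK.:=
                y IK.:* Q IK.:* (p IK.:* (v IK.:* (y IK.:* yⁿ)))) K.refl p v y Q (y KP.^ n)))))

          yv̄≈v : y K.* v̄ K.≈ v
          yv̄≈v = K.trans (K.*-assoc v v v̄) (K.trans (K.*-congˡ (inverts x)) (K.*-identityʳ v))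

          vȳ≈v̄ : v K.* ȳ K.≈ v̄
          vȳ≈v̄ = K.trans (K.sym (K.*-assoc v v̄ v̄)) (K.trans (K.*-congʳ (inverts x)) (K.*-identityˡ v̄))

          shift-y : ∀ n → y K.* (p K.* (v̄ K.* ȳ KP.^ n)) K.≈ p K.* (v K.* ȳ KP.^ n)
          shift-y n = K.trans (IK.solve 4 (λ p v̄ y yⁿ → y IK.:* (p IK.:* (v̄ IK.:* yⁿ)) IK.:=
              p IK.:* (y IK.:* v̄ IK.:* yⁿ)) K.refl p v̄ y (ȳ KP.^ n))
            (K.*-congˡ (K.*-congʳ yv̄≈v))

          shift-ȳ : ∀ n → p K.* (v K.* ȳ KP.^ suc n) K.≈ p K.* (v̄ K.* ȳ KP.^ n)
          shift-ȳ n = K.*-congˡ (K.trans (K.sym (K.*-assoc v ȳ _)) (K.*-congʳ vȳ≈v̄))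

          down : ∀ n → b n * b′ (suc n) * s⁻ n ≈ b (suc n) * b′ n
          down n = trans (*-congʳ (*-cong (linear-cong (K.sym (shift-y n)))
              (linear-cong (K.*-congˡ (shift-ȳ n)))))
            (trans (factor (j ℤ.- + suc (2 ℕ.* n)) (K.trans (^ᶻ-+ x j (ℤ.- (+ suc (2 ℕ.* n))))
              (K.*-congˡ (K.*-congˡ (^-even v̄ n)))))
            (*-cong (linear-cong (K.sym (shift-ȳ n))) (linear-cong (K.trans
              (IK.solve 3 (λ y Q q → y IK.:* y IK.:* Q IK.:* q IK.:= y IK.:* Q IK.:* (y IK.:* q))
                K.refl y Q _)
              (K.*-congˡ (shift-y n))))))

          P : Series
          P = ∏ λ (i : Fin d) → (1# - s (j ℤ.+ odd i)) * (1# - s (j ℤ.- odd i))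

          ad≈ : a d ≈ linear (y K.* Q K.* p)
          ad≈ = linear-cong (K.trans (K.*-congˡ vyᵈ≈yQ) (K.*-comm p _))

          bd≈ : b d ≈ linear (Q̄ K.* p)
          bd≈ = linear-cong (K.trans (K.*-congˡ vȳᵈ≈Q̄) (K.*-comm p _))

          a′d≈ : a′ d ≈ linear (y K.* y K.* Q K.* Q K.* p)
          a′d≈ = linear-cong (K.trans (K.*-congˡ (K.*-congˡ vyᵈ≈yQ))
            (IK.solve 3 (λ p y Q → y IK.:* Q IK.:* (p IK.:* (y IK.:* Q)) IK.:=
              y IK.:* y IK.:* Q IK.:* Q IK.:* p) K.refl p y Q))

          b′d≈ : b′ d ≈ linear (y K.* p)
          b′d≈ = linear-cong (K.trans (K.*-congˡ (K.*-congˡ vȳᵈ≈Q̄)) (K.trans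
            (IK.solve 4 (λ p y Q Q̄ → y IK.:* Q IK.:* (p IK.:* Q̄) IK.:= Q IK.:* Q̄ IK.:* (y IK.:* p))
              K.refl p y Q Q̄)
            (K.trans (K.*-congʳ QQ̄≈1) (K.*-identityˡ _))))

          -- At n = d the end values `a d` and `b′ d` are precisely the denominators of 1 - s j,
          -- because x yᵈ = yQ and Q x ȳᵈ = 1. Hence both sides of the final equation share these
          -- denominators, and only quadratics are left to compare.
          telescoped : linear (y K.* p) * linear (y K.* Q K.* p) * P ≈
                       linear (Q̄ K.* p) * linear (y K.* y K.* Q K.* Q K.* p)
          telescoped = trans (*-congʳ (trans (*-comm _ _) (sym (*-cong ad≈ b′d≈))))
            (trans (RingIdentities.telescope (PowerSeries.commutativeRing K) a a′ b b′ s⁺ s⁻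
              (λ _ → linear-cancellable _) (λ _ → linear-cancellable _)
              (λ _ → linear-cancellable _) (λ _ → linear-cancellable _) up down refl refl d)
            (*-cong bd≈ a′d≈))

          T̂ ŵ ŷ Q̂ Q̄̂ τ : Series
          T̂ = const T
          ŵ = const w
          ŷ = const y
          Q̂ = const Q
          Q̄̂ = const Q̄
          τ = const p * var

          quadratic : T̂ * ((1# - τ) * (1# - ŷ * ŷ * Q̂ * τ)) ≈
            (1# - ŷ * τ) * (1# - ŷ * Q̂ * τ) + ŵ * T̂ * ((1# - Q̄̂ * τ) * (1# - ŷ * ŷ * Q̂ * Q̂ * τ))
          quadratic = RingIdentities.quadratic-balance (PowerSeries.commutativeRing K) T̂ ŵ ŷ Q̂ Q̄̂ τ
            (trans (C.⟦⟧-cong T≈) (trans (C.+-homo K.1# (w K.* T)) (+-congˡ (C.*-homo w T))))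
            (trans (sym (C.*-homo Q Q̄)) (C.⟦⟧-cong QQ̄≈1))
            (trans (*-congˡ (sym (trans (C.minus-homo Q̄ (y K.* Q)) (+-congˡ (-‿cong (const-yQ y Q))))))
              (trans (sym (C.*-homo w (Q̄ K.- y K.* Q))) (trans (C.⟦⟧-cong balance) (C.minus-homo K.1# y))))

          scaled : ∀ {u û} → const u ≈ û → linear (u K.* p) ≈ 1# - û * τ
          scaled {u} eq = trans (linear-* u p) (+-congˡ (-‿cong (*-congʳ eq)))

        one-variable-equation : const T * (1# - s j) ≈ 1# + const (w K.* T) * P
        one-variable-equation =
          *-cancellable (linear-cancellable (y K.* p)) (linear-cancellable (y K.* Q K.* p)) (begin
            U * (T̂ * (1# - s j))
              ≈⟨ solve 3 (λ u t s → u :* (t :* s) := t :* (u :* s)) refl U T̂ _ ⟩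
            T̂ * (U * (1# - s j))
              ≈⟨ *-congˡ (factor j K.refl) ⟩
            T̂ * (linear p * linear (y K.* y K.* Q K.* p))
              ≈⟨ *-congˡ (*-congˡ (scaled (const-yyQ y Q))) ⟩
            T̂ * ((1# - τ) * (1# - ŷ * ŷ * Q̂ * τ))
              ≈⟨ quadratic ⟩
            (1# - ŷ * τ) * (1# - ŷ * Q̂ * τ) + ŵ * T̂ * ((1# - Q̄̂ * τ) * (1# - ŷ * ŷ * Q̂ * Q̂ * τ))
              ≈⟨ +-cong (*-cong (scaled refl) (scaled (const-yQ y Q)))
                   (*-cong (C.*-homo w T) (*-cong (scaled refl) (scaled (const-yyQQ y Q)))) ⟨
            U + const (w K.* T) * (linear (Q̄ K.* p) * linear (y K.* y K.* Q K.* Q K.* p))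
              ≈⟨ +-congˡ (*-congˡ telescoped) ⟨
            U + const (w K.* T) * (U * P)
              ≈⟨ solve 3 (λ u c P → u :+ c :* (u :* P) := u :* (:1 :+ c :* P)) refl U _ P ⟩
            U * (1# + const (w K.* T) * P) ∎)
          where
          U = linear (y K.* p) * linear (y K.* Q K.* p)

∏-axis : ∀ (R : CommutativeRing c ℓ) → let open CommutativeRing R; open BigOperators R in
         ∀ {r} (f : Fin r → ℕ → Carrier) → (∀ i → f i 0 ≈ 1#) →
         ∀ i k → ∏ (λ j → f j (lookup (axis i k) j)) ≈ f i k
∏-axis R {suc r} f f0≈1 zero k =
  trans (*-congˡ (trans (sum-cong-≋ {r} (λ j → trans (reflexive (≡.cong (f (suc j)) (lookup-replicate j 0)))
                                                     (f0≈1 (suc j))))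
                        (sum-replicate-zero r)))
        (*-identityʳ _)
  where
  open CommutativeRing R
  open FiniteSum *-commutativeMonoid
∏-axis R f f0≈1 (suc i) k =
  trans (*-cong (f0≈1 zero) (∏-axis R (f ∘ suc) (f0≈1 ∘ suc) i k)) (*-identityˡ _)
  where open CommutativeRing R using (trans; *-cong; *-identityˡ)

-- Comparison of coefficients

module Solution
  (𝕂 : CommutativeRing c ℓ) (Small : CommutativeRing.Carrier 𝕂 → Set ℓ)
  (d : ℕ) .{{_ : NonZero d}} (T z : CommutativeRing.Carrier 𝕂) (zT²ᵈ⁻¹ : Units.Unit 𝕂)
  where

  open TreeEquation 𝕂 Small d T zT²ᵈ⁻¹
  private
    module MP = MultivariateProperties 𝕂
    module LS = ListSums 𝕂
    module C = RingHom (MP.constantʰ r)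
    module IK = IntegerSolver 𝕂
    module IA = IntegerSolver K⟦α⟧
    module KP = Exp K.commutativeSemiring
    module AP = Exp A.commutativeSemiring
    module K∏ = FiniteSum K.*-commutativeMonoid
    module A∏ = FiniteSum A.*-commutativeMonoid
    module K∑ = FiniteSum K.+-commutativeMonoid
    module KR = SetoidReasoning K.setoid
    module AR = SetoidReasoning A.setoid
    w : K.Carrier
    w = K.value zT²ᵈ⁻¹
    w⁻¹ : K.Carrier
    w⁻¹ = K.inverse zT²ᵈ⁻¹
  open MP using (monomial)
  open Cancellation 𝕂
  open K using (_^ᶻ_)

  module _
    (T≈ : T K.≈ K.1# K.+ z K.* T K.^ (2 ℕ.* d))
    (w≈ : w K.≈ z K.* T K.^ (2 ℕ.* d ∸ 1))
    (1-small^-cancellable : ∀ x n → Small x → Cancellable (K.1# K.- x K.^ suc n))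
    (X : Fin r → K.Unit) (solutions : AreTheSmallSolutions X)
    (α : Vec ℕ r → A.Carrier) (family : Labels.IsCoefficientFamily X α)
    where

    open Labels X α
    open AreTheSmallSolutions solutions
    module F = IsCoefficientFamily family
    open UnitPowers 𝕂 using (^ᶻ-+; ^ᶻ-*ℕ)

    private
      2d≡1+r : 2 ℕ.* d ≡ suc r
      2d≡1+r = ≡.sym (ℕₚ.m+[n∸m]≡n (ℕ.>-nonZero⁻¹ (2 ℕ.* d) {{ℕₚ.m*n≢0 2 d}}))

      wT≈ : w K.* T K.≈ z K.* T K.^ (2 ℕ.* d)
      wT≈ = K.trans (K.*-congʳ w≈) (K.trans (K.*-assoc _ _ _) (K.*-congˡ (K.trans (K.*-comm _ T)
              (K.reflexive (≡.cong (T K.^_) (≡.sym 2d≡1+r))))))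

      T≈1+wT : T K.≈ K.1# K.+ w K.* T
      T≈1+wT = K.trans T≈ (K.+-congˡ (K.sym wT≈))

      𝐗-⊕ : ∀ j g h → 𝐗^ j (g ⊕ h) K.≈ 𝐗^ j g K.* 𝐗^ j h
      𝐗-⊕ j g h = K.trans (K∏.sum-cong-≋ {r} (λ i → K.trans
          (K.reflexive (≡.cong (X i ^ᶻ_) (≡.trans (≡.cong (λ k → j ℤ.* + k) (lookup-zipWith ℕ._+_ i g h))
            (ℤₚ.*-distribˡ-+ j (+ lookup g i) (+ lookup h i)))))
          (^ᶻ-+ (X i) (j ℤ.* + lookup g i) (j ℤ.* + lookup h i))))
        (K∏.∑-distrib-+ {r} _ _)

      𝐗-𝟎 : ∀ j → 𝐗^ j 𝟎 K.≈ K.1#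
      𝐗-𝟎 j = K.trans (K∏.sum-cong-≋ {r} (λ i → K.reflexive (≡.cong (X i ^ᶻ_)
          (≡.trans (≡.cong (λ k → j ℤ.* + k) (lookup-replicate i 0)) (ℤₚ.*-zeroʳ j)))))
        (K∏.sum-replicate-zero r)

      𝐗-+ : ∀ i j n → 𝐗^ (i ℤ.+ j) n K.≈ 𝐗^ i n K.* 𝐗^ j n
      𝐗-+ i j n = K.trans (K∏.sum-cong-≋ {r} (λ l → K.trans
          (K.reflexive (≡.cong (X l ^ᶻ_) (ℤₚ.*-distribʳ-+ (+ lookup n l) i j)))
          (^ᶻ-+ (X l) (i ℤ.* + lookup n l) (j ℤ.* + lookup n l))))
        (K∏.∑-distrib-+ {r} _ _)

      𝐗-axis : ∀ j i k → 𝐗^ j (axis i k) K.≈ (X i ^ᶻ j) K.^ k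
      𝐗-axis j i k = K.trans
        (∏-axis 𝕂 (λ l k → X l ^ᶻ (j ℤ.* + k)) (λ l → K.reflexive (≡.cong (X l ^ᶻ_) (ℤₚ.*-zeroʳ j))) i k)
        (^ᶻ-*ℕ (X i) j k)

      𝐗-total : ∀ j {k} (b : Vec ℤ k) (g : Vec (Vec ℕ r) k) →
        K.∏ (λ i → 𝐗^ (j ℤ.+ lookup b i) (lookup g i)) K.≈
        𝐗^ j (total g) K.* K.∏ λ i → 𝐗^ (lookup b i) (lookup g i)
      𝐗-total j {k} b g = K.trans (K∏.sum-cong-≋ {k} λ i → 𝐗-+ j (lookup b i) (lookup g i))
        (K.trans (K∏.∑-distrib-+ {k} _ _) (K.*-congʳ (go g)))
        where
        go : ∀ {k} (g : Vec (Vec ℕ r) k) → K.∏ (λ i → 𝐗^ j (lookup g i)) K.≈ 𝐗^ j (total g)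
        go []       = K.sym (𝐗-𝟎 j)
        go (g ∷ gs) = K.trans (K.*-congˡ (go gs)) (K.sym (𝐗-⊕ j g (total gs)))

      -- The scalar factor of αₙ: by `α≈`, what remains of αₙ is the monomial with exponent n.
      a : Vec ℕ r → K.Carrier
      a n = coefficient n (α n)

      coefficient-*-constant : ∀ (n : Vec ℕ r) (f : A.Carrier) x → coefficient n (f A.* ⟨ x ⟩) K.≈ coefficient n f K.* x
      coefficient-*-constant n f x = K.trans (MP.coefficient-cong n (A.*-comm f ⟨ x ⟩))
        (K.trans (MP.coefficient-constant-* n x f) (K.*-comm x _))

      coefficient-minus : ∀ (n : Vec ℕ r) (f g : A.Carrier) → coefficient n (f A.- g) K.≈ coefficient n f K.- coefficient n g
      coefficient-minus n f g = K.trans (MP.coefficient-+ n f (A.- g)) (K.+-congˡ (MP.coefficient-neg n g))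

      coefficient-sign : ∀ (n : Vec ℕ r) k (f : A.Carrier) → coefficient n ((A.- A.1#) A.^ k A.* f) K.≈
                         (K.- K.1#) K.^ k K.* coefficient n f
      coefficient-sign n k f = K.trans (MP.coefficient-cong n (A.*-congʳ (A.sym (A.trans
          (C.^-homo (K.- K.1#) k) (AP.^-congˡ k (A.trans (C.-‿homo K.1#) (A.-‿cong C.1-homo)))))))
        (MP.coefficient-constant-* n _ f)

      α≈ : ∀ n → α n A.≈ ⟨ a n ⟩ A.* monomial n
      α≈ n = A.trans α≈a′ (A.*-congʳ (C.⟦⟧-cong (K.sym a≈a′)))
        where
        a′ = proj₁ (F.monomial n)
        α≈a′ : α n A.≈ ⟨ a′ ⟩ A.* monomial n
        α≈a′ = A.trans (proj₂ (F.monomial n)) (A.*-congˡ (A∏.sum-cong-≋ {r} λ i →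
                 AP.^-congˡ (lookup n i) (F.unit-vector i)))
        a≈a′ : a n K.≈ a′
        a≈a′ = K.trans (MP.coefficient-cong n α≈a′) (K.trans (MP.coefficient-constant-* n a′ (monomial n))
                 (K.trans (K.*-congˡ (MP.coefficient-monomial n)) (K.*-identityʳ a′)))

      a𝟎≈0 : a 𝟎 K.≈ K.0#
      a𝟎≈0 = K.trans (MP.coefficient-cong (𝟎 {r}) F.zero-vector) (MP.coefficient-0 (𝟎 {r}))

      coefficient-ρ : ∀ j m → coefficient m (ρ j) K.≈ a m K.* 𝐗^ j m
      coefficient-ρ j m = begin
        coefficient m (ρ j)
          ≡⟨ MP.coefficient-fromCoefficients _ m ⟩
        K.∑ₗ (splittings m) (λ (n , _) → coefficient m (α n A.* ⟨ 𝐗^ j n ⟩))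
          ≈⟨ LS.∑ₗ-cong-All (All.map (λ { {n , h} ≡.refl → term n h }) (splittings-sum m)) ⟩
        K.∑ₗ (splittings m) (λ (n , h) → coefficient n f K.* coefficient h A.1#)
          ≈⟨ MP.coefficient-* m f A.1# ⟨
        coefficient m (f A.* A.1#)
          ≈⟨ MP.coefficient-cong m (A.*-identityʳ f) ⟩
        coefficient m f
          ≡⟨ MP.coefficient-fromCoefficients _ m ⟩
        a m K.* 𝐗^ j m ∎
        where
        open KR
        f : A.Carrier
        f = fromCoefficients λ n → a n K.* 𝐗^ j n
        -- The coefficient of αₙ at n ⊕ h is aₙ times that of 1 at h; hence the sum over all
        -- splittings is a coefficient of the product f · 1.
        term : ∀ (n h : Vec ℕ r) → coefficient (n ⊕ h) (α n A.* ⟨ 𝐗^ j n ⟩) K.≈ coefficient n f K.* coefficient h A.1#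
        term n h = begin
          coefficient (n ⊕ h) (α n A.* ⟨ 𝐗^ j n ⟩)
            ≈⟨ coefficient-*-constant (n ⊕ h) (α n) (𝐗^ j n) ⟩
          coefficient (n ⊕ h) (α n) K.* 𝐗^ j n
            ≈⟨ K.*-congʳ (MP.coefficient-cong (n ⊕ h) (A.trans (α≈ n)
                 (A.*-congˡ (A.sym (A.*-identityʳ (monomial n)))))) ⟩
          coefficient (n ⊕ h) (⟨ a n ⟩ A.* (monomial n A.* A.1#)) K.* 𝐗^ j n
            ≈⟨ K.*-congʳ (K.trans (MP.coefficient-constant-* (n ⊕ h) (a n) _)
                 (K.*-congˡ (MP.coefficient-monomial-* n h A.1#))) ⟩
          a n K.* coefficient h A.1# K.* 𝐗^ j n
            ≈⟨ IK.solve 3 (λ a b c → a IK.:* b IK.:* c IK.:= a IK.:* c IK.:* b) K.refl _ _ _ ⟩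
          a n K.* 𝐗^ j n K.* coefficient h A.1#
            ≡⟨ ≡.cong (K._* coefficient h A.1#) (MP.coefficient-fromCoefficients _ n) ⟨
          coefficient n f K.* coefficient h A.1# ∎

      σ : ℤ → A.Carrier
      σ j = A.1# A.- ρ j

      P : ℤ → A.Carrier
      P j = A.∏ λ (i : Fin d) → σ (j ℤ.+ odd i) A.* σ (j ℤ.- odd i)

      -- The coefficient at n of the claimed equation after the 2d factors T of the product are
      -- collected, zT²ᵈ being wT.
      Balanced : ℤ → Vec ℕ r → Set ℓ
      Balanced j n = coefficient n (T[ j ]) K.≈ coefficient n (A.1# A.+ ⟨ w K.* T ⟩ A.* P j)

    -- Exponents with at least two nonzero coordinates

    module Mixed (j : ℤ) (n : Vec ℕ r) (mixed : AtLeastTwoNonzero n) where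
      open KR
      private
        elementary : ℕ → A.Carrier
        elementary k = ListSums.elementarySymmetric K⟦α⟧ (λ b → ρ (j ℤ.+ b)) k (B d)

        S : K.Carrier
        S = K.∑ λ (i : Fin d) → 𝐗^ (odd i) n K.+ 𝐗^ (ℤ.- odd i) n

        𝐗^b : ∀ {k} → Vec ℤ k → Vec (Vec ℕ r) k → K.Carrier
        𝐗^b b g = K.∏ λ i → 𝐗^ (lookup b i) (lookup g i)

        recursionSum : ℕ → K.Carrier
        recursionSum k = K.∑ₗ (compositions k n) λ g →
          K.∏ (λ i → a (lookup g i)) K.* K.∑ₗ (choose k (B d)) λ b → 𝐗^b b g

      length-B : List.length (B d) ≡ 2 ℕ.* d
      length-B = ≡.trans (Listₚ.length-map _ (List.upTo (2 ℕ.* d))) (Listₚ.length-upTo (2 ℕ.* d))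

      -- B has 2d = r + 1 elements, so r + 2 terms reach the full degree. In this form degrees 0 and
      -- 1 split off by computation, and the other r terms are indexed as in the recursion.
      P-expand : P j A.≈ A.∑ {suc (suc r)} λ i → (A.- A.1#) A.^ toℕ i A.* elementary (toℕ i)
      P-expand = A.trans (A.sym (MonoidFold.fold-B A.*-commutativeMonoid d (λ b → σ (j ℤ.+ b))))
        (ListSums.∏ₗ-expand K⟦α⟧ (λ b → ρ (j ℤ.+ b)) (B d) (suc (suc r))
          (ℕₚ.≤-reflexive (≡.cong suc (≡.trans length-B 2d≡1+r))))

      -- The parts of a composition add up to n, so the factors of index j multiply to 𝐗ʲⁿ whatever
      -- the composition. This is why a recursion without j serves every j.
      coefficient-elementary : ∀ k → coefficient n (elementary k) K.≈ 𝐗^ j n K.* recursionSum k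
      coefficient-elementary k = begin
        coefficient n (elementary k)
          ≈⟨ MP.coefficient-∑ₗ n (choose k (B d)) _ ⟩
        K.∑ₗ (choose k (B d)) (λ b → coefficient n (A.∏ λ i → ρ (j ℤ.+ lookup b i)))
          ≈⟨ LS.∑ₗ-cong (choose k (B d)) (λ b → K.trans
               (MP.coefficient-∏ k (λ i → ρ (j ℤ.+ lookup b i)) (λ i → ρ₀≈0 (j ℤ.+ lookup b i)) n)
               (LS.∑ₗ-cong-All (All.map (λ {g} → term b g) (compositions-total k n)))) ⟩
        K.∑ₗ (choose k (B d)) (λ b → K.∑ₗ (compositions k n) λ g →
          𝐗^ j n K.* (K.∏ (λ i → a (lookup g i)) K.* 𝐗^b b g))
          ≈⟨ LS.∑ₗ-swap (choose k (B d)) (compositions k n) _ ⟩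
        K.∑ₗ (compositions k n) (λ g → K.∑ₗ (choose k (B d)) λ b →
          𝐗^ j n K.* (K.∏ (λ i → a (lookup g i)) K.* 𝐗^b b g))
          ≈⟨ LS.∑ₗ-cong (compositions k n) (λ g → K.trans
               (K.sym (LS.∑ₗ-distribˡ (𝐗^ j n) (choose k (B d)) _))
               (K.*-congˡ (K.sym (LS.∑ₗ-distribˡ _ (choose k (B d)) _)))) ⟩
        K.∑ₗ (compositions k n) (λ g → 𝐗^ j n K.* (K.∏ (λ i → a (lookup g i)) K.*
          K.∑ₗ (choose k (B d)) λ b → 𝐗^b b g))
          ≈⟨ LS.∑ₗ-distribˡ (𝐗^ j n) (compositions k n) _ ⟨
        𝐗^ j n K.* recursionSum k ∎
        where
        ρ₀≈0 : ∀ i → coefficient (𝟎 {r}) (ρ i) K.≈ K.0#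
        ρ₀≈0 i = K.trans (coefficient-ρ i 𝟎) (K.trans (K.*-congʳ a𝟎≈0) (K.zeroˡ _))
        term : ∀ (b : Vec ℤ k) g → total g ≡ n →
          K.∏ (λ i → coefficient (lookup g i) (ρ (j ℤ.+ lookup b i))) K.≈
          𝐗^ j n K.* (K.∏ (λ i → a (lookup g i)) K.* 𝐗^b b g)
        term b g ≡.refl = begin
          K.∏ (λ i → coefficient (lookup g i) (ρ (j ℤ.+ lookup b i)))
            ≈⟨ K∏.sum-cong-≋ {k} (λ i → coefficient-ρ (j ℤ.+ lookup b i) (lookup g i)) ⟩
          K.∏ (λ i → a (lookup g i) K.* 𝐗^ (j ℤ.+ lookup b i) (lookup g i))
            ≈⟨ K∏.∑-distrib-+ {k} _ _ ⟩
          K.∏ (λ i → a (lookup g i)) K.* K.∏ (λ i → 𝐗^ (j ℤ.+ lookup b i) (lookup g i))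
            ≈⟨ K.*-congˡ (𝐗-total j b g) ⟩
          K.∏ (λ i → a (lookup g i)) K.* (𝐗^ j (total g) K.* 𝐗^b b g)
            ≈⟨ IK.solve 3 (λ a x y → a IK.:* (x IK.:* y) IK.:= x IK.:* (a IK.:* y)) K.refl _ _ _ ⟩
          𝐗^ j (total g) K.* (K.∏ (λ i → a (lookup g i)) K.* 𝐗^b b g) ∎

      -- Degree one has the single composition n, so it involves αₙ itself; it is the part that the
      -- recursion keeps on its left side, as the sum in the kernel.
      coefficient-elementary-1 : coefficient n (elementary 1) K.≈ 𝐗^ j n K.* a n K.* S
      coefficient-elementary-1 = begin
        coefficient n (elementary 1)
          ≈⟨ MP.coefficient-∑ₗ n (choose 1 (B d)) _ ⟩
        K.∑ₗ (choose 1 (B d)) (λ b → coefficient n (ρ (j ℤ.+ lookup b zero) A.* A.1#))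
          ≈⟨ singletons (B d) _ ⟩
        K.∑ₗ (B d) (λ b → coefficient n (ρ (j ℤ.+ b) A.* A.1#))
          ≈⟨ LS.∑ₗ-cong (B d) (λ b → K.trans (MP.coefficient-cong n (A.*-identityʳ _))
               (K.trans (coefficient-ρ (j ℤ.+ b) n) (K.trans (K.*-congˡ (𝐗-+ j b n))
               (IK.solve 3 (λ a x y → a IK.:* (x IK.:* y) IK.:= x IK.:* a IK.:* y) K.refl _ _ _)))) ⟩
        K.∑ₗ (B d) (λ b → 𝐗^ j n K.* a n K.* 𝐗^ b n)
          ≈⟨ LS.∑ₗ-distribˡ (𝐗^ j n K.* a n) (B d) (λ b → 𝐗^ b n) ⟨
        𝐗^ j n K.* a n K.* K.∑ₗ (B d) (λ b → 𝐗^ b n)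
          ≈⟨ K.*-congˡ (MonoidFold.fold-B K.+-commutativeMonoid d (λ b → 𝐗^ b n)) ⟩
        𝐗^ j n K.* a n K.* S ∎
        where
        singletons : ∀ (xs : List ℤ) f → K.∑ₗ (choose 1 xs) f K.≈ K.∑ₗ xs λ x → f (x ∷ [])
        singletons []       f = K.refl
        singletons (x ∷ xs) f = K.+-congˡ (singletons xs f)

      -- All products of α's over compositions of n are scalars times one and the same monomial, so
      -- the recursion descends to the scalars.
      coefficient-recursion : a n K.* (K.- w⁻¹ K.+ S) K.≈
        K.∑ {r} λ i → (K.- K.1#) K.^ (2 ℕ.+ toℕ i) K.* recursionSum (2 ℕ.+ toℕ i)
      coefficient-recursion = begin
        a n K.* kernel n
          ≈⟨ coefficient-*-constant n (α n) (kernel n) ⟨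
        coefficient n (α n A.* ⟨ kernel n ⟩)
          ≈⟨ MP.coefficient-cong n (F.recursion n mixed) ⟩
        coefficient n (A.∑ {r} λ i → (A.- A.1#) A.^ (2 ℕ.+ toℕ i) A.* summand (2 ℕ.+ toℕ i))
          ≈⟨ MP.coefficient-∑ n {r} _ ⟩
        K.∑ {r} (λ i → coefficient n ((A.- A.1#) A.^ (2 ℕ.+ toℕ i) A.* summand (2 ℕ.+ toℕ i)))
          ≈⟨ K∑.sum-cong-≋ {r} (λ i → K.trans (coefficient-sign n (2 ℕ.+ toℕ i) _)
               (K.*-congˡ (coefficient-summand (2 ℕ.+ toℕ i)))) ⟩
        K.∑ {r} (λ i → (K.- K.1#) K.^ (2 ℕ.+ toℕ i) K.* recursionSum (2 ℕ.+ toℕ i)) ∎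
        where
        summand : ℕ → A.Carrier
        summand k = A.∑ₗ (compositions k n) λ g →
          A.∏ (λ i → α (lookup g i)) A.* ⟨ K.∑ₗ (choose k (B d)) (λ b → 𝐗^b b g) ⟩

        ∏α≈ : ∀ {k} (g : Vec (Vec ℕ r) k) → A.∏ (λ i → α (lookup g i)) A.≈
              ⟨ K.∏ (λ i → a (lookup g i)) ⟩ A.* monomial (total g)
        ∏α≈ []       = A.sym (A.trans (A.*-cong C.1-homo (MP.monomial-𝟎 r)) (A.*-identityˡ A.1#))
        ∏α≈ (g ∷ gs) = A.trans (A.*-cong (α≈ g) (∏α≈ gs)) (A.trans
          (IA.solve 4 (λ a m b l → (a IA.:* m) IA.:* (b IA.:* l) IA.:= (a IA.:* b) IA.:* (m IA.:* l))
            A.refl _ (monomial g) _ (monomial (total gs)))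
          (A.sym (A.*-cong (C.*-homo (a g) _) (MP.monomial-⊕ g (total gs)))))

        coefficient-summand : ∀ k → coefficient n (summand k) K.≈ recursionSum k
        coefficient-summand k = K.trans (MP.coefficient-∑ₗ n (compositions k n) _)
          (LS.∑ₗ-cong-All (All.map (λ { {g} ≡.refl → K.trans (coefficient-*-constant (total g) _ _)
            (K.*-congʳ (K.trans (MP.coefficient-cong (total g) (∏α≈ g))
              (K.trans (MP.coefficient-constant-* (total g) _ (monomial (total g)))
              (K.trans (K.*-congˡ (MP.coefficient-monomial (total g))) (K.*-identityʳ _))))) })
            (compositions-total k n)))

      coefficient-1≈0 : coefficient n A.1# K.≈ K.0#
      coefficient-1≈0 = MP.coefficient-1-≢𝟎 {n = n} (mixed⇒≢𝟎 {n = n} mixed)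

      -- Degree 0 drops out as n is not the zero vector. Degree one contributes `S` with sign -1,
      -- and the recursion puts -w⁻¹ + S for all higher degrees together, so that `S` cancels.
      coefficient-P : coefficient n (P j) K.≈ K.- (𝐗^ j n K.* a n K.* w⁻¹)
      coefficient-P = begin
        coefficient n (P j)
          ≈⟨ MP.coefficient-cong n P-expand ⟩
        coefficient n (A.∑ {suc (suc r)} λ i → (A.- A.1#) A.^ toℕ i A.* elementary (toℕ i))
          ≈⟨ MP.coefficient-∑ n {suc (suc r)} (λ i → (A.- A.1#) A.^ toℕ i A.* elementary (toℕ i)) ⟩
        K.∑ {suc (suc r)} (λ i → coefficient n ((A.- A.1#) A.^ toℕ i A.* elementary (toℕ i)))
          ≈⟨ K∑.sum-cong-≋ {suc (suc r)} (λ i → coefficient-sign n (toℕ i) (elementary (toℕ i))) ⟩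
        K.1# K.* coefficient n (elementary 0) K.+ ((K.- K.1#) K.* K.1# K.* coefficient n (elementary 1) K.+
          K.∑ {r} λ i → (K.- K.1#) K.^ (2 ℕ.+ toℕ i) K.* coefficient n (elementary (2 ℕ.+ toℕ i)))
          ≈⟨ K.+-cong (K.*-congˡ (K.trans (MP.coefficient-cong n (A.+-identityʳ A.1#)) coefficient-1≈0))
               (K.+-cong (K.*-congˡ coefficient-elementary-1) higher) ⟩
        K.1# K.* K.0# K.+ ((K.- K.1#) K.* K.1# K.* (𝐗^ j n K.* a n K.* S) K.+
          𝐗^ j n K.* (a n K.* (K.- w⁻¹ K.+ S)))
          ≈⟨ IK.solve 4 (λ x a s u → IK.:1 IK.:* IK.con (+ 0) IK.:+
               ((IK.:- IK.:1) IK.:* IK.:1 IK.:* (x IK.:* a IK.:* s) IK.:+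
                 x IK.:* (a IK.:* ((IK.:- u) IK.:+ s))) IK.:=
               IK.:- (x IK.:* a IK.:* u)) K.refl (𝐗^ j n) (a n) S w⁻¹ ⟩
        K.- (𝐗^ j n K.* a n K.* w⁻¹) ∎
        where
        higher : K.∑ {r} (λ i → (K.- K.1#) K.^ (2 ℕ.+ toℕ i) K.* coefficient n (elementary (2 ℕ.+ toℕ i)))
                 K.≈ 𝐗^ j n K.* (a n K.* (K.- w⁻¹ K.+ S))
        higher = K.trans (K∑.sum-cong-≋ {r} (λ i → K.trans (K.*-congˡ (coefficient-elementary (2 ℕ.+ toℕ i)))
            (IK.solve 3 (λ s x c → s IK.:* (x IK.:* c) IK.:= x IK.:* (s IK.:* c)) K.refl
              ((K.- K.1#) K.^ (2 ℕ.+ toℕ i)) (𝐗^ j n) (recursionSum (2 ℕ.+ toℕ i)))))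
          (K.trans (K.sym (SemiringSum.*-distribˡ-sum K.semiring {r} (𝐗^ j n) _))
            (K.*-congˡ (K.sym coefficient-recursion)))

      balanced : Balanced j n
      balanced = begin
        coefficient n (⟨ T ⟩ A.* σ j)
          ≈⟨ MP.coefficient-constant-* n T (σ j) ⟩
        T K.* coefficient n (σ j)
          ≈⟨ K.*-congˡ (K.trans (coefficient-minus n A.1# (ρ j))
               (K.+-cong coefficient-1≈0 (K.-‿cong (coefficient-ρ j n)))) ⟩
        T K.* (K.0# K.- a n K.* 𝐗^ j n)
          ≈⟨ IK.solve 3 (λ t a x → t IK.:* (IK.con (+ 0) IK.:- a IK.:* x) IK.:=
               IK.con (+ 0) IK.:+ IK.:1 IK.:* (t IK.:* (IK.:- (x IK.:* a)))) K.refl T (a n) (𝐗^ j n) ⟩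
        -- The factor 1 is a placeholder for w w⁻¹, from which wT is then split off; likewise 0
        -- stands for the coefficient of 1.
        K.0# K.+ K.1# K.* (T K.* (K.- (𝐗^ j n K.* a n)))
          ≈⟨ K.+-congˡ (K.*-congʳ (K.inverts zT²ᵈ⁻¹)) ⟨
        K.0# K.+ w K.* w⁻¹ K.* (T K.* (K.- (𝐗^ j n K.* a n)))
          ≈⟨ IK.solve 5 (λ w u t x a →
               IK.con (+ 0) IK.:+ w IK.:* u IK.:* (t IK.:* (IK.:- (x IK.:* a))) IK.:=
               IK.con (+ 0) IK.:+ w IK.:* t IK.:* (IK.:- (x IK.:* a IK.:* u)))
               K.refl w w⁻¹ T (𝐗^ j n) (a n) ⟩
        K.0# K.+ w K.* T K.* (K.- (𝐗^ j n K.* a n K.* w⁻¹))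
          ≈⟨ K.+-cong coefficient-1≈0 (K.trans (MP.coefficient-constant-* n (w K.* T) (P j))
               (K.*-congˡ coefficient-P)) ⟨
        coefficient n A.1# K.+ coefficient n (⟨ w K.* T ⟩ A.* P j)
          ≈⟨ MP.coefficient-+ n A.1# _ ⟨
        coefficient n (A.1# A.+ ⟨ w K.* T ⟩ A.* P j) ∎

    -- Exponents on a coordinate axis

    module Axis (ℓ₀ : Fin r) (j : ℤ) where
      private
        x = K.value (X ℓ₀)
        y = x K.* x
        Q = x K.^ r
        D = (K.1# K.- y) K.* (K.1# K.- y K.* Q)
        module SP = SeriesProperties 𝕂
        module PS = PowerSeries 𝕂
        module S = CommutativeRing PS.commutativeRing

        -- Restriction to the axis followed by t ↦ D t. The k-th coefficient is only multiplied by
        -- Dᵏ, which cancels, so an identity between images gives back the identity between the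
        -- original coefficients on the axis.
        φ : RingHom K⟦α⟧ PS.commutativeRing
        φ = SP.scaleʰ D ∘ʰ MP.restrictʰ ℓ₀
        module φ = RingHom φ

        cancel-1-x^ : ∀ k → Cancellable (K.1# K.- x K.^ suc k)
        cancel-1-x^ k = 1-small^-cancellable x k (proj₁ (small ℓ₀))

      cancellable-cong : ∀ {u v} → u K.≈ v → Cancellable u → Cancellable v
      cancellable-cong u≈v cu eq = cu (K.trans (K.*-congʳ u≈v) (K.trans eq (K.*-congʳ (K.sym u≈v))))

      cancel-D : ∀ k → Cancellable (D K.^ k)
      cancel-D k = ^-cancellable k (*-cancellable
        (cancellable-cong (K.+-congˡ (K.-‿cong (K.*-congˡ (K.*-identityʳ x)))) (cancel-1-x^ 1))
        (cancellable-cong (K.+-congˡ (K.-‿cong (K.sym (K.*-assoc x x Q)))) (cancel-1-x^ (suc r))))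

      cancel-1-Q : Cancellable (K.1# K.- Q)
      -- The axis `ℓ₀ : Fin r` itself shows that r is a successor, so that the exponent in Q = xʳ is
      -- positive.
      cancel-1-Q = go ℓ₀
        where
        go : ∀ {n} → Fin n → Cancellable (K.1# K.- x K.^ n)
        go {suc n} _ = cancel-1-x^ n

      φ-constant : ∀ u → φ.⟦ ⟨ u ⟩ ⟧ PS.≈ˢ PS.const u
      φ-constant u ℕ.zero    = K.trans (K.*-identityˡ _) (MP.restrict-constant ℓ₀ u 0)
      φ-constant u (ℕ.suc k) = K.trans (K.*-congˡ (MP.restrict-constant ℓ₀ u (suc k))) (K.zeroʳ _)

      axis-coefficient : ∀ k → a (axis ℓ₀ (suc k)) K.*
        ((K.1# K.- Q) K.* (K.1# K.- y) K.^ k K.* (K.1# K.- y K.* Q) K.^ k) K.≈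
        y K.^ k K.* (K.1# K.- Q K.^ suc k)
      axis-coefficient k = begin
        a n K.* ((K.1# K.- Q) K.* (K.1# K.- y) K.^ k K.* (K.1# K.- y K.* Q) K.^ k)
          ≈⟨ K.*-congˡ (K.*-cong (K.*-congˡ (KP.^-congˡ k (K.+-congˡ (K.-‿cong (K.*-congˡ (K.*-identityʳ x))))))
               (KP.^-congˡ k (K.+-congˡ (K.-‿cong x²ᵈ⁺¹≈)))) ⟨
        a n K.* e
          ≈⟨ coefficient-*-constant n (α n) e ⟨
        coefficient n (α n A.* ⟨ e ⟩)
          ≈⟨ MP.coefficient-cong n (A.*-congˡ (A.trans (C.*-homo _ _) (A.*-cong
               (A.trans (C.*-homo _ _) (A.*-congˡ (C.^-homo (K.1# K.- x K.^ 2) k)))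
               (C.^-homo (K.1# K.- x K.^ (2 ℕ.* d ℕ.+ 1)) k)))) ⟩
        coefficient n (α n A.* (⟨ K.1# K.- Q ⟩ A.* ⟨ K.1# K.- x K.^ 2 ⟩ A.^ k A.*
          ⟨ K.1# K.- x K.^ (2 ℕ.* d ℕ.+ 1) ⟩ A.^ k))
          ≈⟨ MP.coefficient-cong n (F.one-nonzero ℓ₀ k) ⟩
        coefficient n (α (axis ℓ₀ 1) A.^ suc k A.* ⟨ x K.^ (2 ℕ.* k) ⟩ A.*
          ⟨ K.1# K.- x K.^ (suc k ℕ.* r) ⟩)
          ≈⟨ coefficient-*-constant n (α (axis ℓ₀ 1) A.^ suc k A.* ⟨ x K.^ (2 ℕ.* k) ⟩) _ ⟩
        coefficient n (α (axis ℓ₀ 1) A.^ suc k A.* ⟨ x K.^ (2 ℕ.* k) ⟩) K.*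
          (K.1# K.- x K.^ (suc k ℕ.* r))
          ≈⟨ K.*-cong (coefficient-*-constant n (α (axis ℓ₀ 1) A.^ suc k) _)
               (K.+-congˡ (K.-‿cong (K.trans (K.reflexive (≡.cong (x K.^_) (ℕₚ.*-comm (suc k) r)))
                 (K.sym (KP.^-assocʳ x r (suc k)))))) ⟩
        coefficient n (α (axis ℓ₀ 1) A.^ suc k) K.* x K.^ (2 ℕ.* k) K.* (K.1# K.- Q K.^ suc k)
          ≈⟨ K.*-congʳ (K.*-cong leading (UnitPowers.^-even 𝕂 x k)) ⟩
        K.1# K.* y K.^ k K.* (K.1# K.- Q K.^ suc k)
          ≈⟨ K.*-congʳ (K.*-identityˡ _) ⟩
        y K.^ k K.* (K.1# K.- Q K.^ suc k) ∎
        where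
        open KR
        n : Vec ℕ r
        n = axis ℓ₀ (suc k)
        e : K.Carrier
        e = (K.1# K.- Q) K.* (K.1# K.- x K.^ 2) K.^ k K.* (K.1# K.- x K.^ (2 ℕ.* d ℕ.+ 1)) K.^ k

        x²ᵈ⁺¹≈ : x K.^ (2 ℕ.* d ℕ.+ 1) K.≈ y K.* Q
        x²ᵈ⁺¹≈ = K.trans (K.reflexive (≡.cong (x K.^_) (≡.trans (ℕₚ.+-comm (2 ℕ.* d) 1) (≡.cong suc 2d≡1+r))))
                   (K.sym (K.*-assoc x x Q))

        module R = RingHom (MP.restrictʰ ℓ₀)
        leading : coefficient n (α (axis ℓ₀ 1) A.^ suc k) K.≈ K.1#
        leading = begin
          coefficient n (α (axis ℓ₀ 1) A.^ suc k)
            ≈⟨ MP.coefficient-cong n (AP.^-congˡ (suc k) (F.unit-vector ℓ₀)) ⟩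
          R.⟦ indeterminate ℓ₀ A.^ suc k ⟧ (suc k)
            ≈⟨ R.^-homo (indeterminate ℓ₀) (suc k) (suc k) ⟩
          (R.⟦ indeterminate ℓ₀ ⟧ ^ˢ suc k) (suc k)
            ≈⟨ ^ˢ-congˡ (suc k) (MP.restrict-indeterminate ℓ₀) (suc k) ⟩
          (PS.var ^ˢ suc k) (suc k)
            ≈⟨ S.*-identityʳ (PS.var ^ˢ suc k) (suc k) ⟨
          (PS.var ^ˢ suc k S.* S.1#) (suc k)
            ≡⟨ ≡.cong (PS.var ^ˢ suc k S.* S.1#) (ℕₚ.+-identityʳ (suc k)) ⟨
          (PS.var ^ˢ suc k S.* S.1#) (suc k ℕ.+ 0)
            ≈⟨ PS.var^-*-high (suc k) S.1# 0 ⟩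
          K.1# ∎
          where
          open Exp S.commutativeSemiring using () renaming (_^_ to _^ˢ_; ^-congˡ to ^ˢ-congˡ)

      φ-ρ-zero : ∀ i → φ.⟦ ρ i ⟧ 0 K.≈ K.0#
      φ-ρ-zero i = K.trans (K.*-congˡ (K.trans (coefficient-ρ i (axis ℓ₀ 0))
        (K.trans (K.*-congʳ (K.trans (K.reflexive (≡.cong a (axis-0 ℓ₀))) a𝟎≈0)) (K.zeroˡ _)))) (K.zeroʳ _)

      -- Of the factor Dᵏ⁺¹, the part Dᵏ clears the denominators of the explicit coefficient and one
      -- D remains in front. The numerator 1 - Qᵏ⁺¹ splits into the terms of the two geometric
      -- series.
      φ-ρ-suc : ∀ i k → (K.1# K.- Q) K.* φ.⟦ ρ i ⟧ (suc k) K.≈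
        (K.1# K.- y) K.* (K.1# K.- y K.* Q) K.* X ℓ₀ ^ᶻ i K.*
          ((y K.* X ℓ₀ ^ᶻ i) K.^ k K.- Q K.* (y K.* Q K.* X ℓ₀ ^ᶻ i) K.^ k)
      φ-ρ-suc i k = begin
        (K.1# K.- Q) K.* (D K.* D K.^ k K.* coefficient n (ρ i))
          ≈⟨ K.*-congˡ (K.*-cong (K.*-congˡ (KP.^-distrib-* _ _ k))
               (K.trans (coefficient-ρ i n) (K.*-congˡ (𝐗-axis i ℓ₀ (suc k))))) ⟩
        (K.1# K.- Q) K.* (D K.* (u K.^ k K.* v K.^ k) K.* (a n K.* (p K.* p K.^ k)))
          ≈⟨ IK.solve 7 (λ q D u v a p pᵏ → q IK.:* (D IK.:* (u IK.:* v) IK.:* (a IK.:* (p IK.:* pᵏ))) IK.:=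
               D IK.:* p IK.:* (a IK.:* (q IK.:* u IK.:* v) IK.:* pᵏ))
               K.refl (K.1# K.- Q) D (u K.^ k) (v K.^ k) (a n) p (p K.^ k) ⟩
        D K.* p K.* (a n K.* ((K.1# K.- Q) K.* u K.^ k K.* v K.^ k) K.* p K.^ k)
          ≈⟨ K.*-congˡ (K.*-congʳ (axis-coefficient k)) ⟩
        D K.* p K.* (y K.^ k K.* (K.1# K.- Q K.* Q K.^ k) K.* p K.^ k)
          ≈⟨ K.*-congˡ (IK.solve 4 (λ yᵏ Q Qᵏ pᵏ → yᵏ IK.:* (IK.:1 IK.:- Q IK.:* Qᵏ) IK.:* pᵏ IK.:=
               yᵏ IK.:* pᵏ IK.:- Q IK.:* (yᵏ IK.:* Qᵏ IK.:* pᵏ)) K.refl (y K.^ k) Q (Q K.^ k) (p K.^ k)) ⟩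
        D K.* p K.* (y K.^ k K.* p K.^ k K.- Q K.* (y K.^ k K.* Q K.^ k K.* p K.^ k))
          ≈⟨ K.*-congˡ (K.+-cong (KP.^-distrib-* y p k) (K.-‿cong (K.*-congˡ (K.trans
               (KP.^-distrib-* (y K.* Q) p k) (K.*-congʳ (KP.^-distrib-* y Q k)))))) ⟨
        D K.* p K.* ((y K.* p) K.^ k K.- Q K.* (y K.* Q K.* p) K.^ k) ∎
        where
        open KR
        n : Vec ℕ r
        n = axis ℓ₀ (suc k)
        p u v : K.Carrier
        p = X ℓ₀ ^ᶻ i
        u = K.1# K.- y
        v = K.1# K.- y K.* Q

      φ-equation : φ.⟦ T[ j ] ⟧ S.≈ φ.⟦ A.1# A.+ ⟨ w K.* T ⟩ A.* P j ⟧
      φ-equation = begin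
        φ.⟦ ⟨ T ⟩ A.* σ j ⟧
          ≈⟨ S.trans (φ.*-homo ⟨ T ⟩ (σ j)) (S.*-cong (φ-constant T) (φ-σ j)) ⟩
        PS.const T S.* (S.1# S.- φ.⟦ ρ j ⟧)
          ≈⟨ OneVariable.one-variable-equation 𝕂 d (X ℓ₀) T w T≈1+wT (proj₂ (small ℓ₀)) cancel-1-Q
               (λ i → φ.⟦ ρ i ⟧) φ-ρ-zero φ-ρ-suc j ⟩
        S.1# S.+ PS.const (w K.* T) S.* BigOperators.∏ PS.commutativeRing (λ (i : Fin d) →
          (S.1# S.- φ.⟦ ρ (j ℤ.+ odd i) ⟧) S.* (S.1# S.- φ.⟦ ρ (j ℤ.- odd i) ⟧))
          ≈⟨ S.+-congˡ (S.*-congˡ (S.trans (φ.∏-homo {d} (λ i → σ (j ℤ.+ odd i) A.* σ (j ℤ.- odd i)))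
               (FiniteSum.sum-cong-≋ S.*-commutativeMonoid {d} λ i →
                 S.trans (φ.*-homo (σ (j ℤ.+ odd i)) (σ (j ℤ.- odd i)))
                   (S.*-cong (φ-σ (j ℤ.+ odd i)) (φ-σ (j ℤ.- odd i)))))) ⟨
        S.1# S.+ PS.const (w K.* T) S.* φ.⟦ P j ⟧
          ≈⟨ S.trans (φ.+-homo A.1# (⟨ w K.* T ⟩ A.* P j)) (S.+-cong φ.1-homo
               (S.trans (φ.*-homo ⟨ w K.* T ⟩ (P j)) (S.*-congʳ (φ-constant (w K.* T))))) ⟨
        φ.⟦ A.1# A.+ ⟨ w K.* T ⟩ A.* P j ⟧ ∎
        where
        open SetoidReasoning S.setoid
        φ-σ : ∀ i → φ.⟦ σ i ⟧ S.≈ S.1# S.- φ.⟦ ρ i ⟧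
        φ-σ i = S.trans (φ.minus-homo A.1# (ρ i)) (S.+-congʳ φ.1-homo)

      balanced : ∀ k → Balanced j (axis ℓ₀ k)
      balanced k = cancel-D k (φ-equation k)

    equation : ∀ j → T[ j ] A.≈ A.1# A.+ ⟨ z ⟩ A.* A.∏ λ (i : Fin d) → T[ j ℤ.+ odd i ] A.* T[ j ℤ.- odd i ]
    equation j = A.trans (MP.coefficient-ext r balanced) (A.+-congˡ (A.sym (begin
      ⟨ z ⟩ A.* A.∏ {d} (λ i → (t A.* σ (j ℤ.+ odd i)) A.* (t A.* σ (j ℤ.- odd i)))
        ≈⟨ A.*-congˡ (A.trans (A∏.sum-cong-≋ {d} λ i →
             IA.solve 3 (λ t a b → (t IA.:* a) IA.:* (t IA.:* b) IA.:= (t IA.:* t) IA.:* (a IA.:* b))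
               A.refl t (σ (j ℤ.+ odd i)) (σ (j ℤ.- odd i)))
             (A.trans (A∏.∑-distrib-+ {d} (λ _ → t A.* t) _) (A.*-congʳ (A.trans (A∏.sum-replicate d)
               (A.sym (UnitPowers.^-even K⟦α⟧ t d)))))) ⟩
      ⟨ z ⟩ A.* (t A.^ (2 ℕ.* d) A.* P j)
        ≈⟨ A.*-assoc ⟨ z ⟩ (t A.^ (2 ℕ.* d)) (P j) ⟨
      ⟨ z ⟩ A.* t A.^ (2 ℕ.* d) A.* P j
        ≈⟨ A.*-congʳ (A.trans (C.⟦⟧-cong wT≈) (A.trans (C.*-homo z _) (A.*-congˡ (C.^-homo T (2 ℕ.* d))))) ⟨
      ⟨ w K.* T ⟩ A.* P j ∎)))
      where
      open AR
      t : A.Carrier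
      t = ⟨ T ⟩
      0<r : 0 ℕ.< r
      0<r = ℕ.s≤s⁻¹ (≡.subst (2 ℕ.≤_) 2d≡1+r (ℕₚ.*-monoʳ-≤ 2 (ℕ.>-nonZero⁻¹ d)))
      balanced : ∀ n → Balanced j n
      balanced n with axis-or-mixed (Fin.fromℕ< 0<r) n
      ... | inj₁ (i , k , ≡.refl) = Axis.balanced i j k
      ... | inj₂ mixed            = Mixed.balanced j n mixed

-- Specialisation to Puiseux series

fromSeriesʰ : (R : CommutativeRing c ℓ) →
              RingHom (PowerSeries.commutativeRing R) (Puiseux.commutativeRing R)
fromSeriesʰ R = record
  { ⟦_⟧     = fromSeries
  ; ⟦⟧-cong = fromSeries-cong
  ; +-homo  = +-homo
  ; *-homo  = fromSeries-*
  ; 1-homo  = CommutativeRing.refl commutativeRing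
  }
  where
  open Puiseux R
  module S = CommutativeRing La.PS.commutativeRing

  dilate-1-x : ∀ x → La.dilate 1 x L.≈ x
  dilate-1-x x = La.dilate-injective 1 (La.dilate-dilate 1 1 x)

  +-homo : ∀ f g → fromSeries (f S.+ g) ≈ fromSeries f +ᴾ fromSeries g
  +-homo f g = cross (La.dilate-cong 1 (L.trans
    (La.cross (S.*-congʳ (S.sym (S.+-cong (S.*-identityʳ f) (S.*-identityʳ g)))))
    (L.+-cong (L.sym (dilate-1-x (f La./t^ 0))) (L.sym (dilate-1-x (g La./t^ 0))))))

module PuiseuxSolution (R : CommutativeRing c ℓ) where
  open TreeSeries R
  private
    module H = RingHom (fromSeriesʰ R)
    module K = CommutativeRing K
    module S = CommutativeRing F⟦z⟧
  open Exp S.commutativeSemiring using (_^_)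
  open Exp K.commutativeSemiring using () renaming (_^_ to _^ᴷ_)

  module _ (d : ℕ) .{{d≢0 : NonZero d}} (T : Z.Series) (T-tree : IsTreeSeries d T) where

    fromSeries-tree : P.fromSeries T K.≈ K.1# K.+ P.z K.* P.fromSeries T ^ᴷ (2 ℕ.* d)
    fromSeries-tree = K.trans (H.⟦⟧-cong (proj₂ T-tree))
      (K.trans (H.+-homo S.1# (Z.var S.* T ^ (2 ℕ.* d)))
      (K.+-congˡ (K.trans (H.*-homo Z.var (T ^ (2 ℕ.* d))) (K.*-congˡ (H.^-homo T (2 ℕ.* d))))))

    value-zT²ᵈ⁻¹ : Units.value (zT²ᵈ⁻¹ d {{d≢0}} T T-tree) K.≈ P.z K.* P.fromSeries T ^ᴷ (2 ℕ.* d ∸ 1)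
    value-zT²ᵈ⁻¹ = UnitPowers.value-*ᵘ-^ᵘ K zᵘ (Tᵘ d {{d≢0}} T T-tree) (2 ℕ.* d ∸ 1)

    puiseux-equation :
      let open TreeEquation K P.PositiveOrder d (P.fromSeries T) (zT²ᵈ⁻¹ d {{d≢0}} T T-tree) in
      (X : Fin (2 ℕ.* d ∸ 1) → K.Unit) → AreTheSmallSolutions X →
      (α : Vec ℕ (2 ℕ.* d ∸ 1) → A.Carrier) →
      let open A
          open Labels X α
      in
      IsCoefficientFamily →
      (j : ℤ) →
      T[ j ] ≈ 1# + ⟨ P.z ⟩ * ∏ (λ (i : Fin d) → T[ j ℤ.+ odd i ] * T[ j ℤ.- odd i ])
    puiseux-equation = Solution.equation K P.PositiveOrder d {{d≢0}} (P.fromSeries T) P.z (zT²ᵈ⁻¹ d {{d≢0}} T T-tree)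
      fromSeries-tree value-zT²ᵈ⁻¹ (PuiseuxProperties.1-positive^-cancellable R)

proposition2 :
    (d : ℕ) .{{_ : NonZero d}}
    (T : ℂTrees.Z.Series) (T-tree : ℂTrees.IsTreeSeries d T) →
    let open TreeEquation ℂTrees.K ℂTrees.P.PositiveOrder d
               (ℂTrees.P.fromSeries T) (ℂTrees.zT²ᵈ⁻¹ d T T-tree)
    in
    (X : Fin (2 ℕ.* d ∸ 1) → K.Unit) → AreTheSmallSolutions X →
    (α : Vec ℕ (2 ℕ.* d ∸ 1) → A.Carrier) →
    let open A
        open Labels X α
    in
    IsCoefficientFamily →
    (j : ℤ) →
    T[ j ] ≈ 1# + ⟨ ℂTrees.P.z ⟩ * ∏ (λ (i : Fin d) → T[ j ℤ.+ odd i ] * T[ j ℤ.- odd i ])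
proposition2 d {{d≢0}} T T-tree = PuiseuxSolution.puiseux-equation ℂ d {{d≢0}} T T-tree
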